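{- For any $(d_1,d_2)\in\mathbb Z^2$ and any $(p,q)\in\mathbb N^2$, \[ c(p,q)=\sum_{\omega}\mathrm{wt}(\omega), \] the sum over all compatible gradings $\omega$ on $\mathcal P([d_1]_+,[d_2]_+)$ with $\omega(\mathcal P_{\mathbf N})=p$ and $\omega(\mathcal P_{\mathbf E})=q$. Equivalently, $x[d_1,d_2]=x_1^{ -d_1}x_2^{ -d_2}\sum_\omega\mathrm{wt}(\omega)x_1^{\omega(\mathcal P_{\mathbf N})}x_2^{\omega(\mathcal P_{\mathbf E})}$, the sum over all compatible gradings on $\mathcal P([d_1]_+,[d_2]_+)$.
   Context: For $i=1,2$ let $p_{i,\bullet}=(p_{i,k})_{k=1}^{\ell_i}$, $\ell_i\in\mathbb Z_{\ge1}\cup\{\infty\}$, be independent variables; set $p_{i,0}=1$ and $p_{i,k}=0$ for $k>\ell_i$. For a sequence $p_\bullet=(p_k)_{k\ge1}$ and $m\ge0$ define polynomials $\pi_{m,n}(p_\bullet)$, $\varsigma_{m,n}(p_\bullet)$ by $(1+\sum_{k\ge1}p_kz^k)^m=\sum_{n\ge0}\pi_{m,n}(p_\bullet)z^n$ and $(1+\sum_{k\ge1}p_kz^k)^{ -m}=\sum_{n\ge0}\varsigma_{m,n}(p_\bullet)z^n$, with the conventions $\pi_{m,0}=\varsigma_{m,0}=1$ for all $m\in\mathbb Z$ and $\pi_{m,n}=\varsigma_{m,n}=0$ for $m<0$, $n\ne0$. For integer polynomials $f,g$ in the variables $p_{i,k}$, $\operatorname{T\text{ - }max}(f,g)=\sum_e\max([p^e]f,[p^e]g)\,p^e$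 (coefficientwise maximum over monomials $p^e$). Fix $(d_1,d_2)\in\mathbb Z^2$ and define $c(p,q)$ for $(p,q)\in\mathbb N^2$ recursively by $c(0,0)=1$ and $c(p,q)=\operatorname{T\text{ - }max}\Bigl(\sum_{k=1}^p-c(p-k,q)\varsigma_{d_2-q,k}(p_{1,\bullet}),\ \sum_{k=1}^q-c(p,q-k)\varsigma_{d_1-p,k}(p_{2,\bullet})\Bigr).$ The greedy element is $x[d_1,d_2]=x_1^{ -d_1}x_2^{ -d_2}\sum_{(p,q)\in\mathbb N^2}c(p,q)x_1^px_2^q$. Here $[d]_+=\max(d,0)$. Dyck paths and gradings: for $d_1,d_2\ge0$, $\mathcal P(d_1,d_2)$ is the highest lattice path of unit east (horizontal) and north (vertical) edges from $(0,0)$ to $(d_1,d_2)$ never passing strictly above the segment joining them; horizontal edges $u_1,\dots,u_{d_1}$ left to right, vertical edges $v_1,\dots,v_{d_2}$ bottom to top; $\mathcal P_{\mathbf E},\mathcal P_{\mathbf N}$ the horizontal/vertical edge sets; for a set $C$ of edges $C_{\mathbf E},C_{\mathbf N}$ and $|C|$ as usual; $\overrightarrow{ef}$ is the set of edges from $e$ to $f$ along the path inclusive, continuing cyclically from the last edge to the first if $f$ comes before $e$. A grading is a map $\omega$ from edges to $\mathbb N$, $\omega(C)=\sum_{e\in C}\omega(e)$. It is compatible if for all $u\in\mathcal P_{\mathbf E}$, $v\in\mathcal P_{\mathbf N}$ with $\omega(u)\omega(v)>0$ some $e\in\overrightarrow{uv}$ satisfies either $e\in\mathcal P_{\mathbf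 N}\setminus\{v\}$ and $|(\overrightarrow{ue})_{\mathbf N}|=\omega((\overrightarrow{ue})_{\mathbf E})$, or $e\in\mathcal P_{\mathbf E}\setminus\{u\}$ and $|(\overrightarrow{ev})_{\mathbf E}|=\omega((\overrightarrow{ev})_{\mathbf N})$. Weight: $\mathrm{wt}(\omega)=\prod_{i=1}^{d_1}p_{2,\omega(u_i)}\prod_{j=1}^{d_2}p_{1,\omega(v_j)}$. -}

module Defs where

open import Data.Bool using (Bool; true; false; not; if_then_else_)
open import Data.Empty using (⊥-elim)
open import Data.Fin as Fin using (Fin)
import Data.Fin.Properties as Fin
open import Data.Fin.Subset using (Subset; _∈_; _∩_; ∣_∣)
open import Data.Fin.Subset.Properties using (_∈?_)
open import Data.Integer as ℤ using (ℤ; +_; -[1+_]; 0ℤ; 1ℤ)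
open import Data.List as List
  using (List; []; _∷_; [_]; _++_; map; filter; foldr; deduplicate; cartesianProductWith;
         length; replicate; upTo; concatMap; take)
open import Data.List.Membership.Propositional using (lose) renaming (_∈_ to _∈ˡ_)
open import Data.List.Membership.Propositional.Properties
  using (∈-∃++; ∈-map⁺; ∈-map⁻; ∈-concatMap⁺; ∈-upTo⁺; ∈-filter⁺; ∈-filter⁻)
import Data.List.Membership.DecPropositional as DecMembership
open import Data.List.Relation.Binary.Permutation.Propositional
  using (_↭_; ↭-refl; ↭-sym; ↭-trans; prep)
open import Data.List.Relation.Binary.Permutation.Propositional.Properties
  using (∈-resp-↭; drop-mid; shift; ¬x∷xs↭[])
open import Data.List.Relation.Unary.All as All using ()
import Data.List.Relation.Unary.All.Properties as All
open import Data.List.Relation.Unary.AllPairs as AllPairs using ()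
import Data.List.Relation.Unary.AllPairs.Properties as AllPairs
import Data.List.Relation.Unary.Any as Any
open import Data.List.Relation.Unary.Unique.Propositional using (Unique)
open import Data.List.Relation.Unary.Unique.Propositional.Properties
  using (map⁺; concat⁺; filter⁺; upTo⁺)
open import Data.Nat as ℕ
  using (ℕ; zero; suc; _+_; _*_; _∸_; _≤_; _<_; _≤?_; _<?_; _≟_; _≤ᵇ_; NonZero; z≤n; s≤s)
import Data.Nat.Properties as ℕ
open import Data.Product using (∃; _×_; _,_; proj₁; proj₂)
open import Data.Sum using (_⊎_; inj₁; inj₂)
open import Data.Vec as Vec using (Vec; []; _∷_; fromList)
import Data.Vec.Properties as Vec
open import Function using (_∘_; _⇔_; mk⇔)
open import Relation.Binary.Definitions using (DecidableEquality)
open import Relation.Binary.PropositionalEquality hiding ([_])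
open import Relation.Nullary using (¬_; Dec; yes; no; does)
open import Relation.Nullary.Decidable using (map′; ¬?; _×-dec_; _⊎-dec_; _→-dec_)

------------------------------------------------------------------------
-- Integer polynomials in the variables p₁,ₖ and p₂,ₖ (k ≥ 1)

data Var : Set where
  p₁ p₂ : (k : ℕ) .{{_ : NonZero k}} → Var

_≟ᵛ_ : DecidableEquality Var
p₁ j ≟ᵛ p₁ k with j ≟ k
... | yes refl = yes refl
... | no j≢k   = no λ { refl → j≢k refl }
p₁ _ ≟ᵛ p₂ _ = no λ ()
p₂ _ ≟ᵛ p₁ _ = no λ ()
p₂ j ≟ᵛ p₂ k with j ≟ k
... | yes refl = yes refl
... | no j≢k   = no λ { refl → j≢k refl }

-- A monomial is the product of a list of variables; two lists denote the
-- same monomial exactly when they are permutations of one another.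
Monomial : Set
Monomial = List Var

_↭?_ : (e e′ : Monomial) → Dec (e ↭ e′)
[]       ↭? []      = yes ↭-refl
[]       ↭? (_ ∷ _) = no λ []↭ → ¬x∷xs↭[] (↭-sym []↭)
(x ∷ xs) ↭? ys with DecMembership._∈?_ _≟ᵛ_ x ys
... | no x∉ys = no λ x∷xs↭ys → x∉ys (∈-resp-↭ x∷xs↭ys (Any.here refl))
... | yes x∈ys with ∈-∃++ x∈ys
...   | as , bs , refl =
  map′ (λ xs↭ → ↭-trans (prep x xs↭) (↭-sym (shift x as bs))) (drop-mid [] as) (xs ↭? (as ++ bs))

-- A polynomial is a formal sum of terms.  Neither the order of the terms nor
-- their grouping is normalised: equality of polynomials is _≈_ below.
Poly : Set
Poly = List (ℤ × Monomial)

coeff : Monomial → Poly → ℤ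
coeff e = foldr (λ (a , e′) s → (if does (e ↭? e′) then a else 0ℤ) ℤ.+ s) 0ℤ

infix 4 _≈_
_≈_ : Poly → Poly → Set
f ≈ g = ∀ e → coeff e f ≡ coeff e g

0ᵖ 1ᵖ : Poly
0ᵖ = []
1ᵖ = [ (1ℤ , []) ]

var : Var → Poly
var v = [ (1ℤ , [ v ]) ]

infixl 6 _+ᵖ_
infixl 7 _*ᵖ_
infix  8 -ᵖ_

_+ᵖ_ _*ᵖ_ : Poly → Poly → Poly
_+ᵖ_ = _++_
_*ᵖ_ = cartesianProductWith (λ (a , e) (b , e′) → (a ℤ.* b , e ++ e′))

-ᵖ_ : Poly → Poly
-ᵖ_ = map (λ (a , e) → (ℤ.- a , e))

∑ ∏ : List Poly → Poly
∑ = foldr _+ᵖ_ 0ᵖ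
∏ = foldr _*ᵖ_ 1ᵖ

-- Only monomials occurring in f or g can contribute to the coefficientwise
-- maximum; each of them is taken once.
T-max : Poly → Poly → Poly
T-max f g =
  map (λ e → (coeff e f ℤ.⊔ coeff e g , e)) (deduplicate _↭?_ (map proj₂ (f ++ g)))

------------------------------------------------------------------------
-- The sequences p₁,• and p₂,•, and the polynomials π and ς

data ℕ≥1∪∞ : Set where
  fin : (ℓ : ℕ) .{{_ : NonZero ℓ}} → ℕ≥1∪∞
  ∞   : ℕ≥1∪∞

_≤∞ᵇ_ : ℕ → ℕ≥1∪∞ → Bool
k ≤∞ᵇ fin ℓ = k ≤ᵇ ℓ
k ≤∞ᵇ ∞     = true

Seq : Set
Seq = ℕ → Poly

p₁• p₂• : ℕ≥1∪∞ → Seq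
p₁• ℓ zero      = 1ᵖ
p₁• ℓ k@(suc _) = if k ≤∞ᵇ ℓ then var (p₁ k) else 0ᵖ
p₂• ℓ zero      = 1ᵖ
p₂• ℓ k@(suc _) = if k ≤∞ᵇ ℓ then var (p₂ k) else 0ᵖ

-- Power series in z are identified with their coefficient sequences.
_⊛_ : Seq → Seq → Seq
(f ⊛ g) n = ∑ (map (λ k → f k *ᵖ g (n ∸ k)) (upTo (suc n)))

π : ℕ → Seq → Seq
π zero    f zero    = 1ᵖ
π zero    f (suc _) = 0ᵖ
π (suc m) f         = f ⊛ π m f

-- The inverse g of a series f with constant term 1:
-- g₀ = 1 and gₙ = - ∑_{i<n} fₙ₋ᵢ gᵢ for n ≥ 1.
-- inverse-partial f n j is ∑_{i<j} fₙ₋ᵢ gᵢ.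
inverse         : Seq → Seq
inverse-partial : Seq → ℕ → ℕ → Poly

inverse f zero      = 1ᵖ
inverse f n@(suc _) = -ᵖ inverse-partial f n n

inverse-partial f n zero    = 0ᵖ
inverse-partial f n (suc i) = inverse-partial f n i +ᵖ f (n ∸ i) *ᵖ inverse f i

ς : ℤ → Seq → Seq
ς (+ m)    f n       = inverse (π m f) n
ς -[1+ _ ] f zero    = 1ᵖ
ς -[1+ _ ] f (suc _) = 0ᵖ

------------------------------------------------------------------------
-- The coefficients c(p,q) and the greedy element

module _ (ℓ₁ ℓ₂ : ℕ≥1∪∞) (d₁ d₂ : ℤ) where

  -- The two sums over k are indexed by i = p - k, respectively i = q - k, so
  -- that the recursion is structural:
  --   c-sum₁ p j q = ∑_{i<j} - c(i,q) ς_{d₂-q,p-i}(p₁,•)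
  --   c-sum₂ p q j = ∑_{i<j} - c(p,i) ς_{d₁-p,q-i}(p₂,•)
  c      : ℕ → ℕ → Poly
  c-sum₁ : ℕ → ℕ → ℕ → Poly
  c-sum₂ : ℕ → ℕ → ℕ → Poly

  c zero zero = 1ᵖ
  c p    q    = T-max (c-sum₁ p p q) (c-sum₂ p q q)

  c-sum₁ p zero    q = 0ᵖ
  c-sum₁ p (suc i) q =
    c-sum₁ p i q +ᵖ -ᵖ (c i q *ᵖ ς (d₂ ℤ.- + q) (p₁• ℓ₁) (p ∸ i))

  c-sum₂ p q zero    = 0ᵖ
  c-sum₂ p q (suc i) =
    c-sum₂ p q i +ᵖ -ᵖ (c p i *ᵖ ς (d₁ ℤ.- + p) (p₂• ℓ₂) (q ∸ i))

-- Formal Laurent series in x₁, x₂: the coefficient of x₁ⁱ x₂ʲ is F i j.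
Laurent : Set
Laurent = ℤ → ℤ → Poly

infix 4 _≈ᴸ_
_≈ᴸ_ : Laurent → Laurent → Set
F ≈ᴸ G = ∀ i j → F i j ≈ G i j

-- ∑_{(p,q) ∈ ℕ²} a(p,q) x₁ᵖ x₂ᵠ
series : (ℕ → ℕ → Poly) → Laurent
series a (+ p)    (+ q)    = a p q
series a (+ _)    -[1+ _ ] = 0ᵖ
series a -[1+ _ ] _        = 0ᵖ

infixr 7 x₁^_x₂^_·_
x₁^_x₂^_·_ : ℤ → ℤ → Laurent → Laurent
(x₁^ a x₂^ b · F) i j = F (i ℤ.- a) (j ℤ.- b)

x[_,_] : ℤ → ℤ → ℕ≥1∪∞ → ℕ≥1∪∞ → Laurent
x[ d₁ , d₂ ] ℓ₁ ℓ₂ = x₁^ (ℤ.- d₁) x₂^ (ℤ.- d₂) · series (c ℓ₁ ℓ₂ d₁ d₂)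

[_]₊ : ℤ → ℕ
[ + n      ]₊ = n
[ -[1+ _ ] ]₊ = 0

------------------------------------------------------------------------
-- Maximal Dyck paths

data Step : Set where
  east north : Step

Path : Set
Path = List Step

#east #north : Path → ℕ
#east []           = 0
#east (east  ∷ w)  = suc (#east w)
#east (north ∷ w)  = #east w
#north []          = 0
#north (east  ∷ w) = #north w
#north (north ∷ w) = suc (#north w)

-- The path starts at (0,0) and takes a north step whenever the point reached
-- is still weakly below the segment from (0,0) to (d₁,d₂); a point (a,b) of
-- the rectangle is so iff b d₁ ≤ a d₂.  The arguments of `from` are the
-- numbers of east and north steps still to be made.
𝒫 : ℕ → ℕ → Path
𝒫 d₁ d₂ = from d₁ d₂
  module MaximalDyckPath where
  from : ℕ → ℕ → Path
  from zero    s       = replicate s north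
  from (suc r) zero    = east ∷ from r zero
  from (suc r) (suc s) with (d₂ ∸ s) * d₁ ≤? (d₁ ∸ suc r) * d₂
  ... | yes _ = north ∷ from (suc r) s
  ... | no  _ = east  ∷ from r (suc s)

record IsDyckPath (d₁ d₂ : ℕ) (w : Path) : Set where
  field
    ends-east  : #east w ≡ d₁
    ends-north : #north w ≡ d₂
    below      : ∀ k → #north (take k w) * d₁ ≤ #east (take k w) * d₂

-- Paths with common endpoints are compared along antidiagonals: w is weakly
-- above w′ iff after each number k of steps it has made at least as many
-- north steps.
record IsHighestDyckPath (d₁ d₂ : ℕ) (w : Path) : Set where
  field
    isDyckPath : IsDyckPath d₁ d₂ w
    highest    : ∀ w′ → IsDyckPath d₁ d₂ w′ → ∀ k → #north (take k w′) ≤ #north (take k w)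

private
  #north-take : ∀ k w → #north (take k w) ≤ #north w
  #north-take zero    w           = z≤n
  #north-take (suc k) []          = z≤n
  #north-take (suc k) (east  ∷ w) = #north-take k w
  #north-take (suc k) (north ∷ w) = s≤s (#north-take k w)

  module _ (d₁ d₂ : ℕ) where
    open MaximalDyckPath d₁ d₂ using (from)

    record Under (a b : ℕ) : Set where
      constructor under
      field bound : b * d₁ ≤ a * d₂

    -- w continues, from the point (a,b), weakly below the segment.
    record Below (a b : ℕ) (w : Path) : Set where
      constructor mk
      field prefix : ∀ k → Under (a + #east (take k w)) (b + #north (take k w))
    open Below

    under-step : ∀ {a b} → Under a b → Under (suc a) b
    under-step (under h) = under (ℕ.≤-trans h (ℕ.m≤n+m _ d₂))

    below-head : ∀ {a b w} → Below a b w → Under a b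
    below-head {a} {b} h = subst₂ Under (ℕ.+-identityʳ a) (ℕ.+-identityʳ b) (prefix h 0)

    below-tail-east : ∀ {a b w} → Below a b (east ∷ w) → Below (suc a) b w
    below-tail-east {a} {b} {w} h = mk λ k → subst (λ x → Under x (b + #north (take k w))) (ℕ.+-suc a _) (prefix h (suc k))

    below-tail-north : ∀ {a b w} → Below a b (north ∷ w) → Below a (suc b) w
    below-tail-north {a} {b} h = mk λ k → subst (Under (a + _)) (ℕ.+-suc b _) (prefix h (suc k))

    under-0 : ∀ {a b} → Under a b → Under (a + 0) (b + 0)
    under-0 {a} {b} = subst₂ Under (sym (ℕ.+-identityʳ a)) (sym (ℕ.+-identityʳ b))

    below-nil : ∀ {a b} → Under a b → Below a b []
    below-nil h = mk λ { zero → under-0 h ; (suc _) → under-0 h }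

    below-east : ∀ {a b w} → Under a b → Below (suc a) b w → Below a b (east ∷ w)
    below-east {a} {b} {w} h t = mk λ
      { zero → under-0 h ; (suc k) → subst (λ x → Under x (b + #north (take k w))) (sym (ℕ.+-suc a _)) (prefix t k) }

    below-north : ∀ {a b w} → Under a b → Below a (suc b) w → Below a b (north ∷ w)
    below-north {a} {b} h t = mk λ
      { zero → under-0 h ; (suc k) → subst (Under (a + _)) (sym (ℕ.+-suc b _)) (prefix t k) }

    suc-swap : ∀ {x y z} → x + suc y ≡ z → suc x + y ≡ z
    suc-swap {x} {y} e = trans (sym (ℕ.+-suc x y)) e

    rest : ∀ {x y z} → x + y ≡ z → z ∸ y ≡ x
    rest {x} {y} refl = ℕ.m+n∸n≡m x y

    from-#east : ∀ r s → #east (from r s) ≡ r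
    from-#east zero zero = refl
    from-#east zero (suc s) = from-#east zero s
    from-#east (suc r) zero = cong suc (from-#east r zero)
    from-#east (suc r) (suc s) with (d₂ ∸ s) * d₁ ≤? (d₁ ∸ suc r) * d₂
    ... | yes _ = from-#east (suc r) s
    ... | no  _ = cong suc (from-#east r (suc s))

    from-#north : ∀ r s → #north (from r s) ≡ s
    from-#north zero zero = refl
    from-#north zero (suc s) = cong suc (from-#north zero s)
    from-#north (suc r) zero = from-#north r zero
    from-#north (suc r) (suc s) with (d₂ ∸ s) * d₁ ≤? (d₁ ∸ suc r) * d₂
    ... | yes _ = cong suc (from-#north (suc r) s)
    ... | no  _ = from-#north r (suc s)

    from-below : ∀ r s {a b} → a + r ≡ d₁ → b + s ≡ d₂ → Under a b → Below a b (from r s)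
    from-below zero zero a+r b+s h = below-nil h
    from-below zero (suc s) {a} {b} a+r b+s h = below-north h (from-below zero s a+r (suc-swap b+s) (under h′))
      where
      a≡d₁ : a ≡ d₁
      a≡d₁ = trans (sym (ℕ.+-identityʳ a)) a+r
      h′ : suc b * d₁ ≤ a * d₂
      h′ = subst₂ _≤_ (ℕ.*-comm d₁ (suc b)) (cong (_* d₂) (sym a≡d₁))
             (ℕ.*-monoʳ-≤ d₁ (subst (suc b ≤_) (suc-swap b+s) (ℕ.m≤m+n (suc b) s)))
    from-below (suc r) zero a+r b+s h =
      below-east h (from-below r zero (suc-swap a+r) b+s (under-step h))
    from-below (suc r) (suc s) a+r b+s h with (d₂ ∸ s) * d₁ ≤? (d₁ ∸ suc r) * d₂
    ... | yes p = below-north h (from-below (suc r) s a+r (suc-swap b+s)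
                    (subst₂ Under (rest a+r) (rest (suc-swap b+s)) (under p)))
    ... | no  _ = below-east h (from-below r (suc s) (suc-swap a+r) b+s (under-step h))

    from-highest : ∀ r s {a b a′ b′} w′ → a + r ≡ d₁ → b + s ≡ d₂ → a′ + b′ ≡ a + b → b′ ≤ b →
                   b′ + #north w′ ≡ d₂ → Below a′ b′ w′ →
                   ∀ k → b′ + #north (take k w′) ≤ b + #north (take k (from r s))
    from-highest r s w′ a+r b+s diag b′≤b end h zero = ℕ.+-monoˡ-≤ 0 b′≤b
    from-highest r zero {b = b} {b′ = b′} w′ a+r b+s diag b′≤b end h (suc k) =
      ℕ.≤-trans (ℕ.+-monoʳ-≤ b′ (#north-take (suc k) w′))
        (ℕ.≤-trans (ℕ.≤-reflexive (trans end (trans (sym b+s) (ℕ.+-identityʳ b)))) (ℕ.m≤m+n b _))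
    from-highest r (suc s) {b = b} {b′ = b′} [] a+r b+s diag b′≤b end h (suc k) =
      ℕ.≤-trans (ℕ.≤-reflexive (ℕ.+-identityʳ b′)) (ℕ.≤-trans b′≤b (ℕ.m≤m+n b _))
    from-highest zero (suc s) {b = b} (east ∷ w′) a+r b+s diag b′≤b end h (suc k) =
      ℕ.≤-trans (from-highest zero s w′ a+r (suc-swap b+s)
                  (trans (cong suc diag) (sym (ℕ.+-suc _ b))) (ℕ.m≤n⇒m≤1+n b′≤b) end (below-tail-east h) k)
                (ℕ.≤-reflexive (sym (ℕ.+-suc b _)))
    from-highest zero (suc s) {b = b} {b′ = b′} (north ∷ w′) a+r b+s diag b′≤b end h (suc k) =
      subst₂ _≤_ (sym (ℕ.+-suc b′ _)) (sym (ℕ.+-suc b _))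
        (from-highest zero s w′ a+r (suc-swap b+s)
          (trans (ℕ.+-suc _ b′) (trans (cong suc diag) (sym (ℕ.+-suc _ b)))) (s≤s b′≤b)
          (suc-swap end) (below-tail-north h) k)
    from-highest (suc r) (suc s) {a} {b} {a′} {b′} (x ∷ w′) a+r b+s diag b′≤b end h (suc k)
      with (d₂ ∸ s) * d₁ ≤? (d₁ ∸ suc r) * d₂
    from-highest (suc r) (suc s) {b = b} (east ∷ w′) a+r b+s diag b′≤b end h (suc k) | yes p =
      ℕ.≤-trans (from-highest (suc r) s w′ a+r (suc-swap b+s)
                  (trans (cong suc diag) (sym (ℕ.+-suc _ b))) (ℕ.m≤n⇒m≤1+n b′≤b) end (below-tail-east h) k)
                (ℕ.≤-reflexive (sym (ℕ.+-suc b _)))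
    from-highest (suc r) (suc s) {b = b} {b′ = b′} (north ∷ w′) a+r b+s diag b′≤b end h (suc k) | yes p =
      subst₂ _≤_ (sym (ℕ.+-suc b′ _)) (sym (ℕ.+-suc b _))
        (from-highest (suc r) s w′ a+r (suc-swap b+s)
          (trans (ℕ.+-suc _ b′) (trans (cong suc diag) (sym (ℕ.+-suc _ b)))) (s≤s b′≤b)
          (suc-swap end) (below-tail-north h) k)
    from-highest (suc r) (suc s) (east ∷ w′) a+r b+s diag b′≤b end h (suc k) | no ¬p =
      from-highest r (suc s) w′ (suc-swap a+r) b+s (cong suc diag) b′≤b end (below-tail-east h) k
    from-highest (suc r) (suc s) {a} {b} {a′} {b′} (north ∷ w′) a+r b+s diag b′≤b end h (suc k) | no ¬p
      with b′ ≟ b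
    ... | yes refl = ⊥-elim (¬p (Under.bound (subst₂ Under
                       (trans (ℕ.+-cancelʳ-≡ b a′ a diag) (sym (rest a+r))) (sym (rest (suc-swap b+s)))
                       (below-head (below-tail-north h)))))
    ... | no b′≢b = subst (_≤ b + #north (take k (from r (suc s)))) (sym (ℕ.+-suc b′ _))
        (from-highest r (suc s) w′ (suc-swap a+r) b+s (trans (ℕ.+-suc _ b′) (cong suc diag))
          (ℕ.≤∧≢⇒< b′≤b b′≢b) (suc-swap end) (below-tail-north h) k)

𝒫-highest : ∀ d₁ d₂ → IsHighestDyckPath d₁ d₂ (𝒫 d₁ d₂)
𝒫-highest d₁ d₂ = record
  { isDyckPath = record
    { ends-east  = from-#east d₁ d₂ d₁ d₂
    ; ends-north = from-#north d₁ d₂ d₁ d₂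
    ; below      = Under.bound ∘ Below.prefix (from-below d₁ d₂ d₁ d₂ {0} {0} refl refl (under z≤n))
    }
  ; highest = λ w′ w′-dyck → from-highest d₁ d₂ d₁ d₂ {0} {0} {0} {0} w′ refl refl refl z≤n
      (IsDyckPath.ends-north w′-dyck) (mk (under ∘ IsDyckPath.below w′-dyck))
  }

------------------------------------------------------------------------
-- Gradings

isEast : Step → Bool
isEast east  = true
isEast north = false

horizontal vertical : (w : Path) → Subset (length w)
horizontal w = Vec.map isEast (fromList w)
vertical   w = Vec.map (not ∘ isEast) (fromList w)

-- Membership of g in the set of edges from e to f, with cyclic wrap-around
-- when f comes before e.
Between : ∀ {n} → Fin n → Fin n → Fin n → Set
Between e f g = (e Fin.≤ f × e Fin.≤ g × g Fin.≤ f) ⊎ (f Fin.< e × (e Fin.≤ g ⊎ g Fin.≤ f))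

between? : ∀ {n} (e f g : Fin n) → Dec (Between e f g)
between? e f g =
  (e Fin.≤? f ×-dec e Fin.≤? g ×-dec g Fin.≤? f) ⊎-dec (f Fin.<? e ×-dec (e Fin.≤? g ⊎-dec g Fin.≤? f))

arc : ∀ {n} → Fin n → Fin n → Subset n
arc e f = Vec.tabulate (does ∘ between? e f)

Grading : Path → Set
Grading w = Vec ℕ (length w)

infix 9 _⟨_⟩
_⟨_⟩ : ∀ {n} → Vec ℕ n → Subset n → ℕ
ω ⟨ C ⟩ = Vec.sum (Vec.zipWith (λ s k → if s then k else 0) C ω)

module _ (w : Path) (ω : Grading w) where

  private
    E N : Subset (length w)
    E = horizontal w
    N = vertical w

  Witness : (u v e : Fin (length w)) → Set
  Witness u v e = e ∈ arc u v ×
    ( ((e ∈ N × e ≢ v) × ∣ arc u e ∩ N ∣ ≡ ω ⟨ arc u e ∩ E ⟩)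
    ⊎ ((e ∈ E × e ≢ u) × ∣ arc e v ∩ E ∣ ≡ ω ⟨ arc e v ∩ N ⟩) )

  Compatible : Set
  Compatible = ∀ u v → u ∈ E → v ∈ N → 0 < Vec.lookup ω u * Vec.lookup ω v → ∃ (Witness u v)

  compatible? : Dec Compatible
  compatible? = Fin.all? λ u → Fin.all? λ v →
    (u ∈? E) →-dec ((v ∈? N) →-dec ((0 <? _) →-dec Fin.any? λ e →
      (e ∈? arc u v) ×-dec
        (  (((e ∈? N) ×-dec ¬? (e Fin.≟ v)) ×-dec (_ ≟ _))
        ⊎-dec (((e ∈? E) ×-dec ¬? (e Fin.≟ u)) ×-dec (_ ≟ _)))))

wt : ℕ≥1∪∞ → ℕ≥1∪∞ → (w : Path) → Grading w → Poly
wt ℓ₁ ℓ₂ w ω = ∏ (Vec.toList (Vec.zipWith factor (fromList w) ω))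
  where
  factor : Step → ℕ → Poly
  factor east  = p₂• ℓ₂
  factor north = p₁• ℓ₁

vectorsOfSum : (n s : ℕ) → List (Vec ℕ n)
vectorsOfSum zero    zero    = [ [] ]
vectorsOfSum zero    (suc _) = []
vectorsOfSum (suc n) s       = concatMap (λ k → map (k ∷_) (vectorsOfSum n (s ∸ k))) (upTo (suc s))

HasDegree : (w : Path) → ℕ → ℕ → Grading w → Set
HasDegree w p q ω = ω ⟨ vertical w ⟩ ≡ p × ω ⟨ horizontal w ⟩ ≡ q

hasDegree? : (w : Path) (p q : ℕ) (ω : Grading w) → Dec (HasDegree w p q ω)
hasDegree? w p q ω = (ω ⟨ vertical w ⟩ ≟ p) ×-dec (ω ⟨ horizontal w ⟩ ≟ q)

-- The compatible gradings ω on w with ω(vertical edges) = p and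
-- ω(horizontal edges) = q, each listed once (`∈-gradings`, `gradings-unique`).
gradings : (w : Path) → ℕ → ℕ → List (Grading w)
gradings w p q =
  filter (λ ω → hasDegree? w p q ω ×-dec compatible? w ω) (vectorsOfSum (length w) (p + q))

private
  ∈-vectorsOfSum⁺ : ∀ {n} (ω : Vec ℕ n) → ω ∈ˡ vectorsOfSum n (Vec.sum ω)
  ∈-vectorsOfSum⁺ []      = Any.here refl
  ∈-vectorsOfSum⁺ (k ∷ ω) = ∈-concatMap⁺ _ (lose (∈-upTo⁺ (s≤s (ℕ.m≤m+n k (Vec.sum ω)))) (∈-map⁺ (k ∷_)
    (subst (λ s → ω ∈ˡ vectorsOfSum _ s) (sym (ℕ.m+n∸m≡n k (Vec.sum ω))) (∈-vectorsOfSum⁺ ω))))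

  vectorsOfSum-unique : ∀ n s → Unique (vectorsOfSum n s)
  vectorsOfSum-unique zero    zero    = All.[] AllPairs.∷ AllPairs.[]
  vectorsOfSum-unique zero    (suc s) = AllPairs.[]
  vectorsOfSum-unique (suc n) s       = concat⁺
    (All.map⁺ (All.universal (λ k → map⁺ Vec.∷-injectiveʳ (vectorsOfSum-unique n (s ∸ k))) (upTo (suc s))))
    (AllPairs.map⁺ (AllPairs.map disjoint (upTo⁺ (suc s))))
    where
    disjoint : ∀ {j k} → j ≢ k →
      ∀ {ω} → ¬ (ω ∈ˡ map (j ∷_) (vectorsOfSum n (s ∸ j)) × ω ∈ˡ map (k ∷_) (vectorsOfSum n (s ∸ k)))
    disjoint j≢k (ω∈j , ω∈k) with ∈-map⁻ _ ω∈j | ∈-map⁻ _ ω∈k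
    ... | _ , _ , refl | _ , _ , eq = j≢k (Vec.∷-injectiveˡ eq)

  vertical+horizontal : ∀ w (ω : Grading w) → ω ⟨ vertical w ⟩ + ω ⟨ horizontal w ⟩ ≡ Vec.sum ω
  vertical+horizontal []          []      = refl
  vertical+horizontal (east  ∷ w) (k ∷ ω) = begin
    v + (k + h)  ≡⟨ ℕ.+-assoc v k h ⟨
    v + k + h    ≡⟨ cong (_+ h) (ℕ.+-comm v k) ⟩
    k + v + h    ≡⟨ ℕ.+-assoc k v h ⟩
    k + (v + h)  ≡⟨ cong (λ x → k + x) (vertical+horizontal w ω) ⟩
    k + Vec.sum ω  ∎
    where
    open ≡-Reasoning
    v = ω ⟨ vertical w ⟩
    h = ω ⟨ horizontal w ⟩
  vertical+horizontal (north ∷ w) (k ∷ ω) =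
    trans (ℕ.+-assoc k _ _) (cong (λ x → k + x) (vertical+horizontal w ω))

∈-gradings : ∀ w p q (ω : Grading w) → ω ∈ˡ gradings w p q ⇔ (HasDegree w p q ω × Compatible w ω)
∈-gradings w p q ω = mk⇔ (proj₂ ∘ ∈-filter⁻ P? {xs = vectorsOfSum (length w) (p + q)}) from
  where
  P? : ∀ ω → Dec (HasDegree w p q ω × Compatible w ω)
  P? ω = hasDegree? w p q ω ×-dec compatible? w ω
  from : HasDegree w p q ω × Compatible w ω → ω ∈ˡ gradings w p q
  from Pω@((refl , refl) , _) = ∈-filter⁺ P?
    (subst (λ s → ω ∈ˡ vectorsOfSum _ s) (sym (vertical+horizontal w ω)) (∈-vectorsOfSum⁺ ω)) Pω

gradings-unique : ∀ w p q → Unique (gradings w p q)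
gradings-unique w p q =
  filter⁺ (λ ω → hasDegree? w p q ω ×-dec compatible? w ω) (vectorsOfSum-unique (length w) (p + q))

gradingSum : ℕ≥1∪∞ → ℕ≥1∪∞ → Path → ℕ → ℕ → Poly
gradingSum ℓ₁ ℓ₂ w p q = ∑ (map (wt ℓ₁ ℓ₂ w) (gradings w p q))

-- The formal sum of wt(ω) x₁^ω(vertical) x₂^ω(horizontal) over all compatible
-- gradings ω; there may be infinitely many, but finitely many of each degree.
gradingSeries : ℕ≥1∪∞ → ℕ≥1∪∞ → Path → Laurent
gradingSeries ℓ₁ ℓ₂ w = series (gradingSum ℓ₁ ℓ₂ w)

{-# OPTIONS --safe #-}
module Submission where

-- Read 𝒫(d₁,d₂) cyclically.  For fixed weights on the horizontal edges, let
-- F gain ω(u) at a horizontal edge u and lose 1 at a vertical edge; a vertical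
-- edge is free if F is at its lowest over the preceding period.  There are
-- max(d₂ - q, 0) free vertical edges, and by the first alternative in the
-- definition of compatibility their weights do not matter.  So for fixed q the
-- grading sum is p₁(z)^(d₂-q) times the sum R₁ over the compatible gradings
-- that vanish on the free edges, which means that R₁(p,q) is the difference of
-- the grading sum and the first sum of the recursion.  Reflecting the path, the
-- difference to the second sum is the analogous R₂(p,q).  Both have nonnegative
-- coefficients, so the recursion amounts to R₁(p,q) = 0 or R₂(p,q) = 0 for
-- (p,q) ≠ (0,0).  Indeed a nonzero grading that contributes to R₁ satisfies
-- d₂ p < d₁ q, and one that contributes to R₂ satisfies d₁ q < d₂ p: let K gain
-- 1 at a horizontal edge and lose ω(v) at a vertical edge v.  While F stays
-- above its value before a horizontal edge u, so does K, by compatibility.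
-- Cut a period at record lows of F.  When F first returns to a record low, K
-- has risen, and d₁ F + d₂ K has gained at least d₂, more than the distance of
-- the path from the diagonal can account for.

open import Defs
open import Data.Nat using (ℕ)
open import Data.Integer using (ℤ; -_)
open import Data.Product using (_×_)
open import Algebra.Bundles using (CommutativeRing)
import Algebra.Properties.CommutativeSemigroup as CommutativeSemigroupProperties
open import Data.Bool using (Bool; true; false; not; if_then_else_; _∧_)
import Data.Bool.Properties as Bool
open import Data.Empty using (⊥-elim)
open import Data.Fin as Fin using (Fin; toℕ; fromℕ<)
import Data.Fin.Properties as Fin
open import Data.Fin.Subset using (Subset; _∈_; _∩_; ∣_∣)
open import Data.Integer as ℤ using (+_; -[1+_]; 0ℤ; 1ℤ; -1ℤ)
import Data.Integer.Properties as ℤ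
open import Algebra.Properties.AbelianGroup ℤ.+-0-abelianGroup using (∙-cancelʳ)
open import Data.Integer.Tactic.RingSolver using (solve-∀)
open import Data.List as List using (List; []; _∷_; _++_; length; take; upTo; applyUpTo; concatMap; filter)
import Data.List.Properties as List
open import Data.List.Membership.Propositional.Properties using (∈-∃++)
import Data.List.Membership.DecPropositional as DecMembership
open import Data.List.Relation.Binary.Permutation.Propositional using (_↭_; ↭-refl; ↭-sym; ↭-trans; prep)
open import Data.List.Relation.Binary.Permutation.Propositional.Properties using (∈-resp-↭; drop-∷; shift; ++-comm)
open import Data.List.Relation.Unary.All as All using (All)
import Data.List.Relation.Unary.All.Properties as All
open import Data.List.Relation.Unary.AllPairs as AllPairs using ()
open import Data.List.Relation.Unary.Any as Any using (Any)
import Data.List.Relation.Unary.Any.Properties as Any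
import Data.List.Relation.Unary.Unique.DecSetoid.Properties as Unique
open import Data.Nat as ℕ using (zero; suc; _∸_; z≤n; s≤s; NonZero)
open import Data.Nat.DivMod using (_%_; _mod_; m<n⇒m%n≡m; m%n<n; [m+n]%n≡m%n)
import Data.Nat.Properties as ℕ
open import Data.Product using (∃; _,_; proj₁; proj₂)
open import Data.Sum using (_⊎_; inj₁; inj₂)
open import Data.Vec as Vec using (Vec; []; _∷_; fromList; lookup; tabulate)
import Data.Vec.Properties as Vec
open import Function using (_∘_; _⇔_; mk⇔; flip; id)
open import Relation.Binary.Bundles using (DecSetoid)
open import Relation.Binary.PropositionalEquality
  using (_≡_; _≢_; refl; sym; trans; cong; cong₂; subst; subst₂; module ≡-Reasoning)
open import Relation.Nullary using (¬_; Dec; yes; no; does)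
open import Relation.Nullary.Decidable
  using (map′; ¬?; _×-dec_; _→-dec_; dec-true; dec-false; does-⇔; decidable-stable)

-- The commutative ring of polynomials

-- Weights on free edges do not matter because an interval starting at a horizontal edge u on which
-- F stays above F(u) contains no free edge: the compatibility of u and v is either settled by a
-- return of F to F(u) before v, or tested on such an interval. The set of free edges depends on the
-- grading, so the power of p₁(z) is split off separately for each possible set; gradings that agree
-- off the free set of one of them share that set. The power is then cancelled by its inverse series
-- ς. The slope estimate uses a third potential D, gaining d₁ω(u) at a horizontal edge u and losing
-- d₂ω(v) at a vertical edge v, hence d₁q - d₂p over a period. It equals d₁F + d₂K - h, where h
-- measures the distance below the diagonal. A block over which F returns to its value ends after a
-- vertical edge, where h < d₂, while d₂K has gained at least d₂; so D rises. If q > d₂, F rises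
-- over each period and has no recurring record lows to cut at. Then a whole period starting at a
-- last minimum of F is covered; h returns to its value, F gains at least 1, and K does not fall.

term : Monomial → ℤ → Monomial → ℤ
term e a e′ = if does (e ↭? e′) then a else 0ℤ

term-yes : ∀ {e e′} a → e ↭ e′ → term e a e′ ≡ a
term-yes {e} {e′} a e↭e′ = cong (if_then a else 0ℤ) (dec-true (e ↭? e′) e↭e′)

term-no : ∀ {e e′} a → ¬ (e ↭ e′) → term e a e′ ≡ 0ℤ
term-no {e} {e′} a e↭̸e′ = cong (if_then a else 0ℤ) (dec-false (e ↭? e′) e↭̸e′)

term-⇔ : ∀ {e₁ e₁′ e₂ e₂′} a → (e₁ ↭ e₁′) ⇔ (e₂ ↭ e₂′) → term e₁ a e₁′ ≡ term e₂ a e₂′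
term-⇔ {e₁} {e₁′} {e₂} {e₂′} a eqv = cong (if_then a else 0ℤ) (does-⇔ eqv (e₁ ↭? e₁′) (e₂ ↭? e₂′))

coeff-++ : ∀ e f g → coeff e (f ++ g) ≡ coeff e f ℤ.+ coeff e g
coeff-++ e []             g = sym (ℤ.+-identityˡ _)
coeff-++ e ((a , e′) ∷ f) g = trans (cong (λ z → term e a e′ ℤ.+ z) (coeff-++ e f g)) (sym (ℤ.+-assoc (term e a e′) _ _))

coeff-neg : ∀ e f → coeff e (-ᵖ f) ≡ ℤ.- coeff e f
coeff-neg e []             = refl
coeff-neg e ((a , e′) ∷ f) with does (e ↭? e′)
... | true  = trans (cong (λ z → ℤ.- a ℤ.+ z) (coeff-neg e f)) (sym (ℤ.neg-distrib-+ a _))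
... | false = trans (ℤ.+-identityˡ _) (trans (coeff-neg e f) (cong ℤ.-_ (sym (ℤ.+-identityˡ _))))

coeff-resp-↭ : ∀ {e e′} f → e ↭ e′ → coeff e f ≡ coeff e′ f
coeff-resp-↭ []             e↭e′ = refl
coeff-resp-↭ ((a , e″) ∷ f) e↭e′ = cong₂ ℤ._+_
  (term-⇔ a (mk⇔ (↭-trans (↭-sym e↭e′)) (↭-trans e↭e′))) (coeff-resp-↭ f e↭e′)

coeff-absent : ∀ e f → ¬ Any (e ↭_) (List.map proj₂ f) → coeff e f ≡ 0ℤ
coeff-absent e []             e∉ = refl
coeff-absent e ((a , e′) ∷ f) e∉ =
  cong₂ ℤ._+_ (term-no a (e∉ ∘ Any.here)) (coeff-absent e f (e∉ ∘ Any.there))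

↭-decSetoid : DecSetoid _ _
↭-decSetoid = record
  { Carrier = Monomial ; _≈_ = _↭_
  ; isDecEquivalence = record
    { isEquivalence = record { refl = ↭-refl ; sym = ↭-sym ; trans = ↭-trans } ; _≟_ = _↭?_ } }

module _ (a : Monomial → ℤ) (a-resp : ∀ {e e′} → e ↭ e′ → a e ≡ a e′) where

  coeff-distinct-absent : ∀ e es → All (λ e′ → ¬ (e ↭ e′)) es → coeff e (List.map (λ e′ → (a e′ , e′)) es) ≡ 0ℤ
  coeff-distinct-absent e []        All.[]        = refl
  coeff-distinct-absent e (e′ ∷ es) (e≁e′ All.∷ e≁) = cong₂ ℤ._+_ (term-no (a e′) e≁e′) (coeff-distinct-absent e es e≁)

  coeff-distinct : ∀ e es → AllPairs.AllPairs (λ e₁ e₂ → ¬ (e₁ ↭ e₂)) es → Any (e ↭_) es →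
                   coeff e (List.map (λ e′ → (a e′ , e′)) es) ≡ a e
  coeff-distinct e (e′ ∷ es) (e′≁ AllPairs.∷ distinct) (Any.here e↭e′) =
    trans (cong₂ ℤ._+_ (trans (term-yes (a e′) e↭e′) (a-resp (↭-sym e↭e′)))
                       (coeff-distinct-absent e es (All.map (λ e′≁e″ e↭e″ → e′≁e″ (↭-trans (↭-sym e↭e′) e↭e″)) e′≁)))
          (ℤ.+-identityʳ (a e))
  coeff-distinct e (e′ ∷ es) (e′≁ AllPairs.∷ distinct) (Any.there e∈) =
    trans (cong₂ ℤ._+_ (term-no (a e′) e≁e′) (coeff-distinct e es distinct e∈)) (ℤ.+-identityˡ (a e))
    where
    e≁e′ : ¬ (e ↭ e′)
    e≁e′ e↭e′ = All.lookupWith (λ e′≁e″ e↭e″ → e′≁e″ (↭-trans (↭-sym e↭e′) e↭e″)) e′≁ e∈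

-- A monomial occurring in neither polynomial has coefficient 0 in both, and max(0,0) = 0, so
-- listing only the occurring ones loses nothing; `deduplicate` leaves one representative of each
-- permutation class.
coeff-T-max : ∀ e f g → coeff e (T-max f g) ≡ coeff e f ℤ.⊔ coeff e g
coeff-T-max e f g with Any.any? (e ↭?_) (List.map proj₂ (f ++ g))
... | yes e∈ = coeff-distinct (λ e′ → coeff e′ f ℤ.⊔ coeff e′ g)
      (λ e↭e′ → cong₂ ℤ._⊔_ (coeff-resp-↭ f e↭e′) (coeff-resp-↭ g e↭e′)) e _
      (Unique.deduplicate-! ↭-decSetoid _)
      (Any.deduplicate⁺ _↭?_ (λ e″↭e′ e↭e′ → ↭-trans e↭e′ (↭-sym e″↭e′)) e∈)
... | no e∉ = trans
      (coeff-distinct-absent (λ e′ → coeff e′ f ℤ.⊔ coeff e′ g)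
        (λ e↭e′ → cong₂ ℤ._⊔_ (coeff-resp-↭ f e↭e′) (coeff-resp-↭ g e↭e′)) e _
        (All.deduplicate⁺ _↭?_ (All.¬Any⇒All¬ _ e∉)))
      (sym (cong₂ ℤ._⊔_
        (coeff-absent e f (e∉ ∘ subst (Any _) (sym (List.map-++ proj₂ f g)) ∘ Any.++⁺ˡ))
        (coeff-absent e g (e∉ ∘ subst (Any _) (sym (List.map-++ proj₂ f g)) ∘ Any.++⁺ʳ _))))

infixl 7 _·ᵗ_
_·ᵗ_ : ℤ × Monomial → Poly → Poly
(a , e) ·ᵗ g = List.map (λ (b , e′) → (a ℤ.* b , e ++ e′)) g

coeff-scale : ∀ e a g → coeff e ((a , []) ·ᵗ g) ≡ a ℤ.* coeff e g
coeff-scale e a []             = sym (ℤ.*-zeroʳ a)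
coeff-scale e a ((b , e′) ∷ g) with does (e ↭? e′)
... | true  = trans (cong (λ z → a ℤ.* b ℤ.+ z) (coeff-scale e a g)) (sym (ℤ.*-distribˡ-+ a b _))
... | false = trans (ℤ.+-identityˡ _) (trans (coeff-scale e a g) (cong (a ℤ.*_) (sym (ℤ.+-identityˡ _))))

module _ (x : Var) where

  shiftVar : Poly → Poly
  shiftVar = List.map (λ (b , e′) → (b , x ∷ e′))

  coeff-shiftVar-∈ : ∀ {e e₀} g → e ↭ x ∷ e₀ → coeff e (shiftVar g) ≡ coeff e₀ g
  coeff-shiftVar-∈ []             e↭ = refl
  coeff-shiftVar-∈ ((b , e′) ∷ g) e↭ = cong₂ ℤ._+_
    (term-⇔ b (mk⇔ (λ p → drop-∷ (↭-trans (↭-sym e↭) p)) (λ p → ↭-trans e↭ (prep x p)))) (coeff-shiftVar-∈ g e↭)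

  coeff-shiftVar-∉ : ∀ {e} g → ¬ Any (x ≡_) e → coeff e (shiftVar g) ≡ 0ℤ
  coeff-shiftVar-∉ []             x∉ = refl
  coeff-shiftVar-∉ ((b , e′) ∷ g) x∉ =
    cong₂ ℤ._+_ (term-no b (λ p → x∉ (∈-resp-↭ (↭-sym p) (Any.here refl)))) (coeff-shiftVar-∉ g x∉)

  shiftVar-cong : ∀ {f g} → f ≈ g → shiftVar f ≈ shiftVar g
  shiftVar-cong {f} {g} f≈g e with DecMembership._∈?_ _≟ᵛ_ x e
  ... | no x∉ = trans (coeff-shiftVar-∉ f x∉) (sym (coeff-shiftVar-∉ g x∉))
  ... | yes x∈ with ∈-∃++ x∈
  ...   | as , bs , refl = trans (coeff-shiftVar-∈ f (shift x as bs))
                             (trans (f≈g (as ++ bs)) (sym (coeff-shiftVar-∈ g (shift x as bs))))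

-- Monomials are compared up to permutation, so a monomial factor is peeled off one variable at a
-- time: the coefficient of e in x·f is that of e with one x deleted, or 0 if x does not occur in e.
·ᵗ-cong : ∀ t {f g} → f ≈ g → t ·ᵗ f ≈ t ·ᵗ g
·ᵗ-cong (a , []) {f} {g} f≈g e =
  trans (coeff-scale e a f) (trans (cong (a ℤ.*_) (f≈g e)) (sym (coeff-scale e a g)))
·ᵗ-cong (a , x ∷ m) {f} {g} f≈g e =
  subst₂ (λ h k → coeff e h ≡ coeff e k) (sym (List.map-∘ f)) (sym (List.map-∘ g))
    (shiftVar-cong x {(a , m) ·ᵗ f} {(a , m) ·ᵗ g} (·ᵗ-cong (a , m) {f} {g} f≈g) e)

infix 4 _≋_
-- The wrapper keeps both polynomials visible to unification, which could not recover them from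
-- their coefficients.
record _≋_ (f g : Poly) : Set where
  constructor mk≋
  field coeffs : f ≈ g
open _≋_ public

≡⇒≋ : ∀ {f g} → f ≡ g → f ≋ g
≡⇒≋ refl = mk≋ λ e → refl

≋-sym : ∀ {f g} → f ≋ g → g ≋ f
≋-sym p = mk≋ λ e → sym (coeffs p e)

≋-trans : ∀ {f g h} → f ≋ g → g ≋ h → f ≋ h
≋-trans p q = mk≋ λ e → trans (coeffs p e) (coeffs q e)

+ᵖ-cong : ∀ {f f′ g g′} → f ≋ f′ → g ≋ g′ → f +ᵖ g ≋ f′ +ᵖ g′
+ᵖ-cong {f} {f′} {g} {g′} f≋ g≋ = mk≋ λ e →
  trans (coeff-++ e f g) (trans (cong₂ ℤ._+_ (coeffs f≋ e) (coeffs g≋ e)) (sym (coeff-++ e f′ g′)))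

+ᵖ-comm : ∀ f g → f +ᵖ g ≋ g +ᵖ f
+ᵖ-comm f g = mk≋ λ e → trans (coeff-++ e f g) (trans (ℤ.+-comm (coeff e f) _) (sym (coeff-++ e g f)))

*ᵖ-congˡ : ∀ f {g g′} → g ≋ g′ → f *ᵖ g ≋ f *ᵖ g′
*ᵖ-congˡ []      g≋ = mk≋ λ e → refl
*ᵖ-congˡ (t ∷ f) {g} {g′} g≋ = +ᵖ-cong (mk≋ (·ᵗ-cong t {g} {g′} (coeffs g≋))) (*ᵖ-congˡ f g≋)

*ᵖ-zeroʳ : ∀ f → f *ᵖ 0ᵖ ≡ 0ᵖ
*ᵖ-zeroʳ []      = refl
*ᵖ-zeroʳ (t ∷ f) = *ᵖ-zeroʳ f

-- The product recurses on its left factor; peeling a term off the right factor makes commutativity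
-- an induction.
coeff-*-∷ʳ : ∀ e f t g → coeff e (f *ᵖ (t ∷ g)) ≡ coeff e (t ·ᵗ f) ℤ.+ coeff e (f *ᵖ g)
coeff-*-∷ʳ e []            t         g = refl
coeff-*-∷ʳ e ((a , m) ∷ f) (b , m′) g = begin
  term e (a ℤ.* b) (m ++ m′) ℤ.+ coeff e (((a , m) ·ᵗ g) ++ f *ᵖ ((b , m′) ∷ g))
    ≡⟨ cong₂ ℤ._+_ (trans (term-⇔ {e} {m ++ m′} {e} {m′ ++ m} (a ℤ.* b) (mk⇔ (λ p → ↭-trans p (++-comm m m′)) (λ p → ↭-trans p (++-comm m′ m))))
                          (cong (λ z → term e z (m′ ++ m)) (ℤ.*-comm a b)))
                   (trans (coeff-++ e ((a , m) ·ᵗ g) (f *ᵖ ((b , m′) ∷ g))) (cong (λ z → coeff e ((a , m) ·ᵗ g) ℤ.+ z) (coeff-*-∷ʳ e f (b , m′) g))) ⟩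
  x ℤ.+ (y ℤ.+ (u ℤ.+ v)) ≡⟨ rearrange x y u v ⟩
  (x ℤ.+ u) ℤ.+ (y ℤ.+ v) ≡⟨ cong (λ z → (x ℤ.+ u) ℤ.+ z) (sym (coeff-++ e ((a , m) ·ᵗ g) (f *ᵖ g))) ⟩
  _ ∎
  where
  open ≡-Reasoning
  x = term e (b ℤ.* a) (m′ ++ m)
  y = coeff e ((a , m) ·ᵗ g)
  u = coeff e ((b , m′) ·ᵗ f)
  v = coeff e (f *ᵖ g)
  rearrange : ∀ x y u v → x ℤ.+ (y ℤ.+ (u ℤ.+ v)) ≡ (x ℤ.+ u) ℤ.+ (y ℤ.+ v)
  rearrange = solve-∀

*ᵖ-comm : ∀ f g → f *ᵖ g ≋ g *ᵖ f
*ᵖ-comm f []      = ≡⇒≋ (*ᵖ-zeroʳ f)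
*ᵖ-comm f (t ∷ g) = mk≋ λ e → trans (coeff-*-∷ʳ e f t g)
  (trans (cong (λ z → coeff e (t ·ᵗ f) ℤ.+ z) (coeffs (*ᵖ-comm f g) e)) (sym (coeff-++ e (t ·ᵗ f) _)))

*ᵖ-cong : ∀ {f f′ g g′} → f ≋ f′ → g ≋ g′ → f *ᵖ g ≋ f′ *ᵖ g′
*ᵖ-cong {f} {f′} {g} {g′} f≋ g≋ =
  ≋-trans (*ᵖ-congˡ f g≋) (≋-trans (*ᵖ-comm f g′) (≋-trans (*ᵖ-congˡ g′ f≋) (*ᵖ-comm g′ f′)))

*ᵖ-distribʳ : ∀ f g h → (f ++ g) *ᵖ h ≡ f *ᵖ h ++ g *ᵖ h
*ᵖ-distribʳ []      g h = refl
*ᵖ-distribʳ (t ∷ f) g h = trans (cong (t ·ᵗ h ++_) (*ᵖ-distribʳ f g h)) (sym (List.++-assoc (t ·ᵗ h) _ _))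

·ᵗ-·ᵗ : ∀ a m b m′ h → (a ℤ.* b , m ++ m′) ·ᵗ h ≡ (a , m) ·ᵗ ((b , m′) ·ᵗ h)
·ᵗ-·ᵗ a m b m′ h = trans (List.map-cong (λ (d , m″) → cong₂ _,_ (ℤ.*-assoc a b d) (List.++-assoc m m′ m″)) h) (List.map-∘ h)

·ᵗ-* : ∀ t g h → (t ·ᵗ g) *ᵖ h ≡ t ·ᵗ (g *ᵖ h)
·ᵗ-* t       []             h = refl
·ᵗ-* (a , m) ((b , m′) ∷ g) h =
  trans (cong₂ _++_ (·ᵗ-·ᵗ a m b m′ h) (·ᵗ-* (a , m) g h)) (sym (List.map-++ _ ((b , m′) ·ᵗ h) _))

*ᵖ-assoc : ∀ f g h → (f *ᵖ g) *ᵖ h ≡ f *ᵖ (g *ᵖ h)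
*ᵖ-assoc []      g h = refl
*ᵖ-assoc (t ∷ f) g h = trans (*ᵖ-distribʳ (t ·ᵗ g) (f *ᵖ g) h) (cong₂ _++_ (·ᵗ-* t g h) (*ᵖ-assoc f g h))

1*ᵖ : ∀ f → 1ᵖ *ᵖ f ≡ f
1*ᵖ f = trans (List.++-identityʳ _)
  (trans (List.map-cong (λ (a , m) → cong (_, m) (ℤ.*-identityˡ a)) f) (List.map-id f))

Poly-commutativeRing : CommutativeRing _ _
Poly-commutativeRing = record
  { Carrier = Poly ; _≈_ = _≋_ ; _+_ = _+ᵖ_ ; _*_ = _*ᵖ_ ; -_ = -ᵖ_ ; 0# = 0ᵖ ; 1# = 1ᵖ
  ; isCommutativeRing = record
    { isRing = record
      { +-isAbelianGroup = record
        { isGroup = record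
          { isMonoid = record
            { isSemigroup = record
              { isMagma = record
                { isEquivalence = record { refl = ≡⇒≋ refl ; sym = ≋-sym ; trans = ≋-trans }
                ; ∙-cong = +ᵖ-cong }
              ; assoc = λ f g h → ≡⇒≋ (List.++-assoc f g h) }
            ; identity = (λ f → ≡⇒≋ refl) , λ f → ≡⇒≋ (List.++-identityʳ f) }
          ; inverse = inverseˡ , λ f → ≋-trans (+ᵖ-comm f (-ᵖ f)) (inverseˡ f)
          ; ⁻¹-cong = λ {f} {g} f≋g →
              mk≋ λ e → trans (coeff-neg e f) (trans (cong ℤ.-_ (coeffs f≋g e)) (sym (coeff-neg e g))) }
        ; comm = +ᵖ-comm }
      ; *-cong = *ᵖ-cong
      ; *-assoc = λ f g h → ≡⇒≋ (*ᵖ-assoc f g h)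
      ; *-identity = (λ f → ≡⇒≋ (1*ᵖ f)) , λ f → ≋-trans (*ᵖ-comm f 1ᵖ) (≡⇒≋ (1*ᵖ f))
      ; distrib = distribˡ , λ h f g → ≡⇒≋ (*ᵖ-distribʳ f g h) }
    ; *-comm = *ᵖ-comm } }
  where
  inverseˡ : ∀ f → (-ᵖ f) +ᵖ f ≋ 0ᵖ
  inverseˡ f = mk≋ λ e →
    trans (coeff-++ e (-ᵖ f) f) (trans (cong (ℤ._+ coeff e f) (coeff-neg e f)) (ℤ.+-inverseˡ (coeff e f)))
  distribˡ : ∀ f g h → f *ᵖ (g +ᵖ h) ≋ f *ᵖ g +ᵖ f *ᵖ h
  distribˡ f g h = ≋-trans (*ᵖ-comm f (g ++ h))
    (≋-trans (≡⇒≋ (*ᵖ-distribʳ g h f)) (+ᵖ-cong (*ᵖ-comm g f) (*ᵖ-comm h f)))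

-- Convolutions and sums over gradings, over an arbitrary commutative ring

count : ∀ {n} → Vec Bool n → ℕ
count []          = 0
count (true  ∷ S) = suc (count S)
count (false ∷ S) = count S

ZeroOn : ∀ {n} → Vec Bool n → Vec ℕ n → Bool
ZeroOn []          []          = true
ZeroOn (false ∷ S) (_     ∷ ω) = ZeroOn S ω
ZeroOn (true  ∷ S) (zero  ∷ ω) = ZeroOn S ω
ZeroOn (true  ∷ S) (suc _ ∷ ω) = false

AgreeOff : ∀ {n} → Vec Bool n → Vec ℕ n → Vec ℕ n → Set
AgreeOff S ω ω′ = ∀ i → Vec.lookup S i ≡ false → Vec.lookup ω i ≡ Vec.lookup ω′ i

_==_ : ∀ {n} → Vec Bool n → Vec Bool n → Bool
[]          == []          = true
(true  ∷ S) == (true  ∷ S′) = S == S′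
(false ∷ S) == (false ∷ S′) = S == S′
(true  ∷ S) == (false ∷ S′) = false
(false ∷ S) == (true  ∷ S′) = false

==⇒≡ : ∀ {n} (S S′ : Vec Bool n) → (S == S′) ≡ true → S ≡ S′
==⇒≡ []          []           _  = refl
==⇒≡ (true  ∷ S) (true  ∷ S′) eq = cong (true ∷_) (==⇒≡ S S′ eq)
==⇒≡ (false ∷ S) (false ∷ S′) eq = cong (false ∷_) (==⇒≡ S S′ eq)

-- For `isEast` and `not ∘ isEast` this unfolds to the total weight of the horizontal and of the
-- vertical edges; with the predicate left open, one argument serves both halves of the recursion.
deg : (Step → Bool) → (w : Path) → Grading w → ℕ
deg χ w ω = ω ⟨ Vec.map χ (fromList w) ⟩

module Series {c ℓ} (R : CommutativeRing c ℓ) where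
  open CommutativeRing R renaming (_≈_ to _∼_; refl to ∼-refl; sym to ∼-sym; trans to ∼-trans)
  open CommutativeSemigroupProperties +-commutativeSemigroup using (interchange)
  open import Relation.Binary.Reasoning.Setoid setoid

  -- Summation over k + j = n. A general H is needed because in `T` the sum over the remaining edges
  -- still depends on the weight k of the first one.
  dconv : (ℕ → ℕ → Carrier) → ℕ → Carrier
  dconv H zero    = H 0 0
  dconv H (suc n) = H 0 (suc n) + dconv (H ∘ suc) n

  conv : (ℕ → Carrier) → (ℕ → Carrier) → ℕ → Carrier
  conv f g = dconv λ k j → f k * g j

  δ : ℕ → Carrier
  δ zero    = 1#
  δ (suc _) = 0#

  pow : ℕ → (ℕ → Carrier) → ℕ → Carrier
  pow zero    f = δ
  pow (suc m) f = conv f (pow m f)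

  sum< : (ℕ → Carrier) → ℕ → Carrier
  sum< h zero    = 0#
  sum< h (suc n) = sum< h n + h n

  dconv-cong : ∀ {H H′} n → (∀ k j → k ℕ.+ j ≡ n → H k j ∼ H′ k j) → dconv H n ∼ dconv H′ n
  dconv-cong zero    eq = eq 0 0 refl
  dconv-cong (suc n) eq = +-cong (eq 0 (suc n) refl) (dconv-cong n λ k j k+j → eq (suc k) j (cong suc k+j))

  dconv-0 : ∀ n → dconv (λ _ _ → 0#) n ∼ 0#
  dconv-0 zero    = ∼-refl
  dconv-0 (suc n) = ∼-trans (+-identityˡ _) (dconv-0 n)

  dconv-+ : ∀ H H′ n → dconv (λ k j → H k j + H′ k j) n ∼ dconv H n + dconv H′ n
  dconv-+ H H′ zero    = ∼-refl
  dconv-+ H H′ (suc n) = ∼-trans (+-congˡ (dconv-+ (H ∘ suc) (H′ ∘ suc) n)) (interchange _ _ _ _)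

  dconv-*ˡ : ∀ r H n → r * dconv H n ∼ dconv (λ k j → r * H k j) n
  dconv-*ˡ r H zero    = ∼-refl
  dconv-*ˡ r H (suc n) = ∼-trans (distribˡ r _ _) (+-congˡ (dconv-*ˡ r (H ∘ suc) n))

  dconv-last : ∀ H n → dconv H (suc n) ∼ dconv (λ k j → H k (suc j)) n + H (suc n) 0
  dconv-last H zero    = ∼-refl
  dconv-last H (suc n) = ∼-trans (+-congˡ (dconv-last (H ∘ suc) n)) (∼-sym (+-assoc _ _ _))

  dconv-flip : ∀ H n → dconv H n ∼ dconv (flip H) n
  dconv-flip H zero    = ∼-refl
  dconv-flip H (suc n) = begin
    H 0 (suc n) + dconv (H ∘ suc) n                  ≈⟨ +-congˡ (dconv-flip (H ∘ suc) n) ⟩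
    H 0 (suc n) + dconv (λ k j → H (suc j) k) n      ≈⟨ +-comm _ _ ⟩
    dconv (λ k j → H (suc j) k) n + H 0 (suc n)      ≈⟨ dconv-last (flip H) n ⟨
    dconv (flip H) (suc n)                           ∎

  sum<-head : ∀ h n → sum< h (suc n) ∼ h 0 + sum< (h ∘ suc) n
  sum<-head h zero    = +-comm _ _
  sum<-head h (suc n) = ∼-trans (+-congʳ (sum<-head h n)) (+-assoc _ _ _)

  dconv-sum< : ∀ H n → dconv H n ∼ sum< (λ i → H i (n ∸ i)) (suc n)
  dconv-sum< H zero    = ∼-sym (+-identityˡ _)
  dconv-sum< H (suc n) = ∼-trans (+-congˡ (dconv-sum< (H ∘ suc) n)) (∼-sym (sum<-head _ (suc n)))

  conv-cong : ∀ {f f′ g g′} n → (∀ i → f i ∼ f′ i) → (∀ i → g i ∼ g′ i) → conv f g n ∼ conv f′ g′ n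
  conv-cong n f≈ g≈ = dconv-cong n λ k j _ → *-cong (f≈ k) (g≈ j)

  conv-+ˡ : ∀ f f′ g n → conv (λ i → f i + f′ i) g n ∼ conv f g n + conv f′ g n
  conv-+ˡ f f′ g n = ∼-trans (dconv-cong n λ k j _ → distribʳ (g j) (f k) (f′ k)) (dconv-+ _ _ n)

  conv-0ˡ : ∀ {f} g n → (∀ i → f i ∼ 0#) → conv f g n ∼ 0#
  conv-0ˡ g n f≈0 = ∼-trans (dconv-cong n λ k j _ → ∼-trans (*-congʳ (f≈0 k)) (zeroˡ (g j))) (dconv-0 n)

  conv-*ˡ : ∀ r f g n → r * conv f g n ∼ conv (λ i → r * f i) g n
  conv-*ˡ r f g n = ∼-trans (dconv-*ˡ r _ n) (dconv-cong n λ k j _ → ∼-sym (*-assoc r (f k) (g j)))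

  conv-comm : ∀ f g n → conv f g n ∼ conv g f n
  conv-comm f g n = ∼-trans (dconv-flip _ n) (dconv-cong n λ k j _ → *-comm (f j) (g k))

  conv-δʳ : ∀ f n → conv f δ n ∼ f n
  conv-δʳ f zero    = *-identityʳ _
  conv-δʳ f (suc n) = ∼-trans (+-congʳ (zeroʳ _)) (∼-trans (+-identityˡ _) (conv-δʳ (f ∘ suc) n))

  -- Both sides sum over three indices with total n; the case of a product H is associativity of
  -- `conv`.
  dconv-conv : ∀ H g n → dconv (λ k → conv (H k) g) n ∼ conv (dconv H) g n
  dconv-conv H g zero    = ∼-refl
  dconv-conv H g (suc n) = begin
    H 0 0 * g (suc n) + conv (H 0 ∘ suc) g n + dconv (λ k → conv (H (suc k)) g) n
      ≈⟨ +-congˡ (dconv-conv (H ∘ suc) g n) ⟩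
    H 0 0 * g (suc n) + conv (H 0 ∘ suc) g n + conv (dconv (H ∘ suc)) g n
      ≈⟨ +-assoc _ _ _ ⟩
    H 0 0 * g (suc n) + (conv (H 0 ∘ suc) g n + conv (dconv (H ∘ suc)) g n)
      ≈⟨ +-congˡ (conv-+ˡ _ _ g n) ⟨
    H 0 0 * g (suc n) + conv (dconv H ∘ suc) g n ∎

  conv-assoc : ∀ f g h n → conv f (conv g h) n ∼ conv (conv f g) h n
  conv-assoc f g h n = ∼-trans (dconv-cong n λ k j _ → conv-*ˡ (f k) g h j) (dconv-conv _ h n)

  conv-divide : ∀ {f r g s} → (∀ i → f i ∼ conv r g i) → (∀ i → conv g s i ∼ δ i) → ∀ n → conv f s n ∼ r n
  conv-divide {f} {r} {g} {s} f≈ gs≈δ n = begin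
    conv f s n            ≈⟨ conv-cong n f≈ (λ _ → ∼-refl) ⟩
    conv (conv r g) s n   ≈⟨ conv-assoc r g s n ⟨
    conv r (conv g s) n   ≈⟨ conv-cong n (λ _ → ∼-refl) gs≈δ ⟩
    conv r δ n            ≈⟨ conv-δʳ r n ⟩
    r n                   ∎

  pow-0 : ∀ m {f} → f 0 ∼ 1# → pow m f 0 ∼ 1#
  pow-0 zero    f0≈1 = ∼-refl
  pow-0 (suc m) f0≈1 = ∼-trans (*-cong f0≈1 (pow-0 m f0≈1)) (*-identityˡ 1#)

  -- The sum over all subsets of n edges, used to sort gradings by their set of free edges.
  ∑S : ∀ n → (Vec Bool n → Carrier) → Carrier
  ∑S zero    h = h []
  ∑S (suc n) h = ∑S n (h ∘ (false ∷_)) + ∑S n (h ∘ (true ∷_))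

  ∑S-cong : ∀ n {h h′} → (∀ S → h S ∼ h′ S) → ∑S n h ∼ ∑S n h′
  ∑S-cong zero    eq = eq []
  ∑S-cong (suc n) eq = +-cong (∑S-cong n (eq ∘ (false ∷_))) (∑S-cong n (eq ∘ (true ∷_)))

  ∑S-0 : ∀ n → ∑S n (λ _ → 0#) ∼ 0#
  ∑S-0 zero    = ∼-refl
  ∑S-0 (suc n) = ∼-trans (+-cong (∑S-0 n) (∑S-0 n)) (+-identityˡ 0#)

  ∑S-pick : ∀ n (S₀ : Vec Bool n) (h : Vec Bool n → Carrier) → ∑S n (λ S → if S₀ == S then h S else 0#) ∼ h S₀
  ∑S-pick zero    []           h = ∼-refl
  ∑S-pick (suc n) (true  ∷ S₀) h = ∼-trans (+-cong (∑S-0 n) (∑S-pick n S₀ (h ∘ (true ∷_)))) (+-identityˡ _)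
  ∑S-pick (suc n) (false ∷ S₀) h = ∼-trans (+-cong (∑S-pick n S₀ (h ∘ (false ∷_))) (∑S-0 n)) (+-identityʳ _)

  ∑S-conv : ∀ n (h : Vec Bool n → ℕ → Carrier) g a → ∑S n (λ S → conv (h S) g a) ∼ conv (λ i → ∑S n λ S → h S i) g a
  ∑S-conv zero    h g a = ∼-refl
  ∑S-conv (suc n) h g a =
    ∼-trans (+-cong (∑S-conv n (h ∘ (false ∷_)) g a) (∑S-conv n (h ∘ (true ∷_)) g a)) (∼-sym (conv-+ˡ _ _ g a))

  -- The sum of Φ(ω) ∏ (f or g)(ω(e)) over all ω of degree a on the edges
  -- selected by χ, which carry f, and of degree b on the others, which carry g.
  T : (χ : Step → Bool) (f g : ℕ → Carrier) (w : Path) → (Grading w → Carrier) → ℕ → ℕ → Carrier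
  T χ f g []      Φ zero    zero    = Φ []
  T χ f g []      Φ zero    (suc _) = 0#
  T χ f g []      Φ (suc _) _       = 0#
  T χ f g (x ∷ w) Φ a b =
    if χ x then dconv (λ k j → f k * T χ f g w (Φ ∘ (k ∷_)) j b) a
           else dconv (λ k j → g k * T χ f g w (Φ ∘ (k ∷_)) a j) b

  module _ (χ : Step → Bool) (f g : ℕ → Carrier) where

    T-cong : ∀ w {Φ Ψ} a b → (∀ ω → deg χ w ω ≡ a → deg (not ∘ χ) w ω ≡ b → Φ ω ∼ Ψ ω) →
             T χ f g w Φ a b ∼ T χ f g w Ψ a b
    T-cong []      zero    zero    eq = eq [] refl refl
    T-cong []      zero    (suc _) eq = ∼-refl
    T-cong []      (suc _) _       eq = ∼-refl
    T-cong (x ∷ w) a b eq with χ x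
    ... | true  = dconv-cong a λ k j k+j → *-congˡ (T-cong w j b λ ω da db →
                    eq (k ∷ ω) (trans (cong (k ℕ.+_) da) k+j) db)
    ... | false = dconv-cong b λ k j k+j → *-congˡ (T-cong w a j λ ω da db →
                    eq (k ∷ ω) da (trans (cong (k ℕ.+_) db) k+j))

    T-0 : ∀ w a b → T χ f g w (λ _ → 0#) a b ∼ 0#
    T-0 []      zero    zero    = ∼-refl
    T-0 []      zero    (suc _) = ∼-refl
    T-0 []      (suc _) _       = ∼-refl
    T-0 (x ∷ w) a b with χ x
    ... | true  = ∼-trans (dconv-cong a λ k j _ → ∼-trans (*-congˡ (T-0 w j b)) (zeroʳ _)) (dconv-0 a)
    ... | false = ∼-trans (dconv-cong b λ k j _ → ∼-trans (*-congˡ (T-0 w a j)) (zeroʳ _)) (dconv-0 b)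

    T-+ : ∀ w Φ Ψ a b → T χ f g w (λ ω → Φ ω + Ψ ω) a b ∼ T χ f g w Φ a b + T χ f g w Ψ a b
    T-+ []      Φ Ψ zero    zero    = ∼-refl
    T-+ []      Φ Ψ zero    (suc _) = ∼-sym (+-identityˡ 0#)
    T-+ []      Φ Ψ (suc _) _       = ∼-sym (+-identityˡ 0#)
    T-+ (x ∷ w) Φ Ψ a b with χ x
    ... | true  = ∼-trans (dconv-cong a λ k j _ → ∼-trans (*-congˡ (T-+ w _ _ j b)) (distribˡ _ _ _)) (dconv-+ _ _ a)
    ... | false = ∼-trans (dconv-cong b λ k j _ → ∼-trans (*-congˡ (T-+ w _ _ a j)) (distribˡ _ _ _)) (dconv-+ _ _ b)

    T-∑S : ∀ w n (Φ : Vec Bool n → Grading w → Carrier) a b →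
           T χ f g w (λ ω → ∑S n λ S → Φ S ω) a b ∼ ∑S n λ S → T χ f g w (Φ S) a b
    T-∑S w zero    Φ a b = ∼-refl
    T-∑S w (suc n) Φ a b = ∼-trans (T-+ w _ _ a b) (+-cong (T-∑S w n _ a b) (T-∑S w n _ a b))

    restrict : ∀ {n} → Vec Bool n → (Vec ℕ n → Carrier) → Vec ℕ n → Carrier
    restrict S Φ ω = if ZeroOn S ω then Φ ω else 0#

    -- Edges on which Φ does not depend contribute a factor ∑ f(k) zᵏ each.
    T-independent : f 0 ∼ 1# → ∀ w (S : Vec Bool (length w)) Φ →
      (∀ i → Vec.lookup S i ≡ true → χ (Vec.lookup (fromList w) i) ≡ true) →
      (∀ ω ω′ → AgreeOff S ω ω′ → Φ ω ∼ Φ ω′) → ∀ a b →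
      T χ f g w Φ a b ∼ conv (λ i → T χ f g w (restrict S Φ) i b) (pow (count S) f) a
    T-independent f0≈1 [] [] Φ S⊆ ind a b = ∼-trans
      (T-cong [] a b λ { [] _ _ → ∼-refl }) (∼-sym (conv-δʳ (λ i → T χ f g [] (restrict [] Φ) i b) a))
    T-independent f0≈1 (x ∷ w) (false ∷ S) Φ S⊆ ind a b with χ x
    ... | true = ∼-trans
      (dconv-cong a λ k j _ → ∼-trans (*-congˡ (IH k j b)) (conv-*ˡ (f k) _ _ j))
      (dconv-conv _ _ a)
      where
      IH = λ k → T-independent f0≈1 w S (Φ ∘ (k ∷_)) (λ i → S⊆ (Fin.suc i))
                   λ ω ω′ eq → ind _ _ λ { Fin.zero _ → refl ; (Fin.suc i) → eq i }
    -- This edge carries g and consumes degree b, whereas the convolution runs over degree a, so the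
    -- two sums are interchanged.
    ... | false = ∼-trans
      (dconv-cong b λ k j _ → ∼-trans (*-congˡ (IH k a j)) (conv-*ˡ (g k) _ _ a))
      (∼-trans (exchange _ b) (conv-cong a (λ i → ∼-refl) λ i → ∼-refl))
      where
      IH = λ k → T-independent f0≈1 w S (Φ ∘ (k ∷_)) (λ i → S⊆ (Fin.suc i))
                   λ ω ω′ eq → ind _ _ λ { Fin.zero _ → refl ; (Fin.suc i) → eq i }
      exchange : ∀ (h : ℕ → ℕ → ℕ → Carrier) b →
        dconv (λ k j → conv (λ i → h i k j) (pow (count S) f) a) b ∼
        conv (λ i → dconv (h i) b) (pow (count S) f) a
      exchange h zero    = ∼-refl
      exchange h (suc b) = ∼-trans (+-congˡ (exchange (λ i k → h i (suc k)) b)) (∼-sym (conv-+ˡ _ _ _ a))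
    T-independent f0≈1 (x ∷ w) (true ∷ S) Φ S⊆ ind a b with χ x | S⊆ Fin.zero refl
    ... | true | _ = begin
      dconv (λ k j → f k * T χ f g w (Φ ∘ (k ∷_)) j b) a
        -- Φ ignores the weight of this edge, which may thus be replaced by 0 inside Φ; the edge
        -- then contributes the bare factor f.
        ≈⟨ dconv-cong a (λ k j _ → *-congˡ (T-cong w j b λ ω _ _ → ind _ _ λ { Fin.zero () ; (Fin.suc i) _ → refl })) ⟩
      conv f (λ j → T χ f g w Φ₀ j b) a
        ≈⟨ conv-cong a (λ _ → ∼-refl) (λ j → T-independent f0≈1 w S Φ₀ (λ i → S⊆ (Fin.suc i))
             (λ ω ω′ eq → ind _ _ λ { Fin.zero () ; (Fin.suc i) → eq i }) j b) ⟩
      conv f (conv r (pow (count S) f)) a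
        ≈⟨ conv-assoc f r _ a ⟩
      conv (conv f r) (pow (count S) f) a
        ≈⟨ conv-cong a (conv-comm f r) (λ _ → ∼-refl) ⟩
      conv (conv r f) (pow (count S) f) a
        ≈⟨ conv-assoc r f _ a ⟨
      conv r (conv f (pow (count S) f)) a
        ≈⟨ conv-cong a r≈ (λ _ → ∼-refl) ⟩
      conv (λ i → dconv (λ k j → f k * T χ f g w (restrict (true ∷ S) Φ ∘ (k ∷_)) j b) i) (conv f (pow (count S) f)) a ∎
      where
      Φ₀ : Grading w → Carrier
      Φ₀ = Φ ∘ (0 ∷_)
      r : ℕ → Carrier
      r i = T χ f g w (restrict S Φ₀) i b
      -- The restriction kills every weight but 0 on this edge, and f(0) = 1.
      r≈ : ∀ i → r i ∼ dconv (λ k j → f k * T χ f g w (restrict (true ∷ S) Φ ∘ (k ∷_)) j b) i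
      r≈ zero    = ∼-sym (∼-trans (*-congʳ f0≈1) (*-identityˡ _))
      r≈ (suc i) = ∼-sym (∼-trans (+-cong (∼-trans (*-congʳ f0≈1) (*-identityˡ _))
        (∼-trans (dconv-cong i λ k j _ → ∼-trans (*-congˡ (T-0 w j b)) (zeroʳ _)) (dconv-0 i))) (+-identityʳ _))

    -- Since the free set varies with ω, the sum is split by its value S. For fixed S, the function
    -- that is Φ where `free ω == S` and 0 elsewhere does not depend on the weights on S, so
    -- `T-independent` applies; every S that occurs has d ∸ b elements, so the same power comes out
    -- of all parts.
    T-free : f 0 ∼ 1# → ∀ w (free : Grading w → Vec Bool (length w)) (Φ : Grading w → Carrier) d →
      (∀ ω i → Vec.lookup (free ω) i ≡ true → χ (Vec.lookup (fromList w) i) ≡ true) →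
      (∀ ω → count (free ω) ≡ d ∸ deg (not ∘ χ) w ω) →
      (∀ ω ω′ → AgreeOff (free ω) ω ω′ → free ω ≡ free ω′ × Φ ω ∼ Φ ω′) → ∀ a b →
      T χ f g w Φ a b ∼ conv (λ i → T χ f g w (λ ω → restrict (free ω) Φ ω) i b) (pow (d ∸ b) f) a
    T-free f0≈1 w free Φ d free⊆ free-count ind a b = begin
      T χ f g w Φ a b
        ≈⟨ T-cong w a b (λ ω _ _ → ∼-sym (∑S-pick n (free ω) (λ _ → Φ ω))) ⟩
      T χ f g w (λ ω → ∑S n λ S → Φ[ S ] ω) a b
        ≈⟨ T-∑S w n _ a b ⟩
      ∑S n (λ S → T χ f g w Φ[ S ] a b)
        ≈⟨ ∑S-cong n part ⟩
      ∑S n (λ S → conv (λ i → T χ f g w (restrict S Φ[ S ]) i b) (pow (d ∸ b) f) a)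
        ≈⟨ ∑S-conv n _ _ a ⟩
      conv (λ i → ∑S n λ S → T χ f g w (restrict S Φ[ S ]) i b) (pow (d ∸ b) f) a
        ≈⟨ conv-cong a (λ i → ∼-sym (T-∑S w n _ i b)) (λ _ → ∼-refl) ⟩
      conv (λ i → T χ f g w (λ ω → ∑S n λ S → restrict S Φ[ S ] ω) i b) (pow (d ∸ b) f) a
        ≈⟨ conv-cong a (λ i → T-cong w i b λ ω _ _ → ∼-trans (∑S-cong n λ S → if-swap (ZeroOn S ω) (free ω == S))
                                                      (∑S-pick n (free ω) λ S → restrict S Φ ω)) (λ _ → ∼-refl) ⟩
      conv (λ i → T χ f g w (λ ω → restrict (free ω) Φ ω) i b) (pow (d ∸ b) f) a ∎
      where
      n = length w
      Φ[_] : Vec Bool n → Grading w → Carrier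
      Φ[ S ] ω = if free ω == S then Φ ω else 0#
      if-swap : ∀ x y {z} → (if x then (if y then z else 0#) else 0#) ∼ (if y then (if x then z else 0#) else 0#)
      if-swap true  y     = ∼-refl
      if-swap false true  = ∼-refl
      if-swap false false = ∼-refl
      independent : ∀ S ω ω′ → AgreeOff S ω ω′ → (free ω == S) ≡ true → free ω ≡ free ω′ × Φ ω ∼ Φ ω′
      independent S ω ω′ agree eq = ind ω ω′ (subst (λ S → AgreeOff S ω ω′) (sym (==⇒≡ (free ω) S eq)) agree)
      Φ[]-ind : ∀ S ω ω′ → AgreeOff S ω ω′ → Φ[ S ] ω ∼ Φ[ S ] ω′
      Φ[]-ind S ω ω′ agree with free ω == S in eq | free ω′ == S in eq′
      ... | true  | true  = proj₂ (independent S ω ω′ agree eq)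
      ... | false | false = ∼-refl
      ... | true  | false with () ← trans (sym eq′) (trans (cong (_== S) (sym (proj₁ (independent S ω ω′ agree eq)))) eq)
      ... | false | true  with () ← trans (sym eq) (trans (cong (_== S) (sym (proj₁
                                (independent S ω′ ω (λ i i∉ → sym (agree i i∉)) eq′)))) eq′)
      part : ∀ S → T χ f g w Φ[ S ] a b ∼ conv (λ i → T χ f g w (restrict S Φ[ S ]) i b) (pow (d ∸ b) f) a
      part S with (count S ℕ.≟ d ∸ b) ×-dec
                  Fin.all? (λ i → (Vec.lookup S i Bool.≟ true) →-dec (χ (Vec.lookup (fromList w) i) Bool.≟ true))
      -- No grading with the given degree off χ has S as its free set, so both sides vanish.
      ... | no ≢ = ∼-trans (∼-trans (T-cong w a b λ ω _ → vanish ω) (T-0 w a b)) (∼-sym (conv-0ˡ _ a λ i →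
                     ∼-trans (T-cong w i b λ ω _ db → restrict-0 ω (vanish ω db)) (T-0 w i b)))
        where
        vanish : ∀ ω → deg (not ∘ χ) w ω ≡ b → Φ[ S ] ω ∼ 0#
        vanish ω db with free ω == S in eq
        ... | false = ∼-refl
        ... | true  = ⊥-elim (≢ (trans (cong count (sym (==⇒≡ (free ω) S eq))) (trans (free-count ω) (cong (d ∸_) db)) ,
                        subst (λ S → ∀ i → Vec.lookup S i ≡ true → χ (Vec.lookup (fromList w) i) ≡ true) (==⇒≡ (free ω) S eq) (free⊆ ω)))
        restrict-0 : ∀ ω → Φ[ S ] ω ∼ 0# → restrict S Φ[ S ] ω ∼ 0#
        restrict-0 ω eq with ZeroOn S ω
        ... | true  = eq
        ... | false = ∼-refl
      ... | yes (eq , S⊆) = ∼-trans (T-independent f0≈1 w S Φ[ S ] S⊆ (Φ[]-ind S) a b)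
                       (conv-cong a (λ _ → ∼-refl) λ i → reflexive (cong (λ m → pow m f i) eq))

  T-swap : ∀ χ f g w Φ a b → T χ f g w Φ a b ∼ T (not ∘ χ) g f w Φ b a
  T-swap χ f g []      Φ zero    zero    = ∼-refl
  T-swap χ f g []      Φ zero    (suc _) = ∼-refl
  T-swap χ f g []      Φ (suc _) zero    = ∼-refl
  T-swap χ f g []      Φ (suc _) (suc _) = ∼-refl
  T-swap χ f g (x ∷ w) Φ a b with χ x
  ... | true  = dconv-cong a λ k j _ → *-congˡ (T-swap χ f g w _ j b)
  ... | false = dconv-cong b λ k j _ → *-congˡ (T-swap χ f g w _ a j)

-- Cyclic words: shadows and compatibility

infix 4 _≺_
-- Strictness is written as an explicit unit so that strict and weak inequalities can be combined by
-- ring identities.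
_≺_ : ℤ → ℤ → Set
a ≺ b = 1ℤ ℤ.+ a ℤ.≤ b

-- The identity of differences is what the ring solver checks; `≤-from₂` does the same for the sum
-- of two inequalities.
≤-from : ∀ {a b c d} → a ℤ.≤ b → b ℤ.- a ≡ d ℤ.- c → c ℤ.≤ d
≤-from a≤b eq = ℤ.0≤i-j⇒j≤i (subst (0ℤ ℤ.≤_) eq (ℤ.i≤j⇒0≤j-i a≤b))

≤-from₂ : ∀ {a b a′ b′ c d} → a ℤ.≤ b → a′ ℤ.≤ b′ → (b ℤ.- a) ℤ.+ (b′ ℤ.- a′) ≡ d ℤ.- c → c ℤ.≤ d
≤-from₂ p q eq = ℤ.0≤i-j⇒j≤i (subst (0ℤ ℤ.≤_) eq (ℤ.+-mono-≤ (ℤ.i≤j⇒0≤j-i p) (ℤ.i≤j⇒0≤j-i q)))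

≺⇒≤ : ∀ {a b} → a ≺ b → a ℤ.≤ b
≺⇒≤ {a} {b} p = ℤ.≤-trans (ℤ.i≤suc[i] a) p

≺⇒≱ : ∀ {a b} → a ≺ b → ¬ (b ℤ.≤ a)
≺⇒≱ p q = ℤ.<⇒≱ (ℤ.suc[i]≤j⇒i<j p) q

≰⇒≺ : ∀ {a b} → ¬ (b ℤ.≤ a) → a ≺ b
≰⇒≺ q = ℤ.i<j⇒suc[i]≤j (ℤ.≰⇒> q)

≤∧≢⇒≺ : ∀ {a b} → a ℤ.≤ b → a ≢ b → a ≺ b
≤∧≢⇒≺ p q = ℤ.i<j⇒suc[i]≤j (ℤ.≤∧≢⇒< p q)

+ℕ-≤ : ∀ a k → a ℤ.≤ a ℤ.+ + k
+ℕ-≤ a k = ≤-from (ℤ.+≤+ (z≤n {k})) (eq a (+ k)) where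
  eq : ∀ a k → k ℤ.- 0ℤ ≡ a ℤ.+ k ℤ.- a
  eq = solve-∀

pred-≤ : ∀ a → a ℤ.+ -1ℤ ℤ.≤ a
pred-≤ a = ≤-from (ℤ.+≤+ (z≤n {1})) (eq a) where
  eq : ∀ a → 1ℤ ℤ.- 0ℤ ≡ a ℤ.- (a ℤ.+ -1ℤ)
  eq = solve-∀

+pos-≺ : ∀ a {k} → 0 ℕ.< k → a ≺ a ℤ.+ + k
+pos-≺ a {k} 0<k = ≤-from (ℤ.+≤+ 0<k) (eq a (+ k)) where
  eq : ∀ a k → k ℤ.- 1ℤ ≡ a ℤ.+ k ℤ.- (1ℤ ℤ.+ a)
  eq = solve-∀

pre : (ℕ → ℤ) → ℕ → ℤ
pre f zero    = 0ℤ
pre f (suc i) = pre f i ℤ.+ f i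

pre-cong : ∀ {f g} → (∀ i → f i ≡ g i) → ∀ t → pre f t ≡ pre g t
pre-cong eq zero    = refl
pre-cong eq (suc t) = cong₂ ℤ._+_ (pre-cong eq t) (eq t)

pre-shift : ∀ {f} n → (∀ i → f (i ℕ.+ n) ≡ f i) → ∀ t → pre f (t ℕ.+ n) ≡ pre f t ℤ.+ pre f n
pre-shift {f} n per zero    = sym (ℤ.+-identityˡ _)
pre-shift {f} n per (suc t) = trans (cong₂ ℤ._+_ (pre-shift n per t) (per t)) (eq (pre f t) (pre f n) (f t)) where
  eq : ∀ a b c → a ℤ.+ b ℤ.+ c ≡ a ℤ.+ c ℤ.+ b
  eq = solve-∀

pre-agree : ∀ {f g} e k → (∀ i → e ℕ.≤ i → i ℕ.< k ℕ.+ e → f i ≡ g i) →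
            pre f (k ℕ.+ e) ℤ.- pre f e ≡ pre g (k ℕ.+ e) ℤ.- pre g e
pre-agree {f} {g} e zero    eq = trans (ℤ.+-inverseʳ (pre f e)) (sym (ℤ.+-inverseʳ (pre g e)))
pre-agree {f} {g} e (suc k) eq = trans (rearrange (pre f (k ℕ.+ e)) (f (k ℕ.+ e)) (pre f e))
  (trans (cong₂ ℤ._+_ (pre-agree e k λ i e≤i i< → eq i e≤i (ℕ.m≤n⇒m≤1+n i<)) (eq (k ℕ.+ e) (ℕ.m≤n+m e k) ℕ.≤-refl))
    (sym (rearrange (pre g (k ℕ.+ e)) (g (k ℕ.+ e)) (pre g e))))
  where
  rearrange : ∀ a b c → a ℤ.+ b ℤ.- c ≡ a ℤ.- c ℤ.+ b
  rearrange = solve-∀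

fδ kδ : Step → ℕ → ℤ
fδ east  k = + k
fδ north k = -1ℤ
kδ east  k = 1ℤ
kδ north k = ℤ.- + k

periodic-induction : ∀ {p} (P : ℕ → Set p) {n} → 0 ℕ.< n → (∀ t → t ℕ.< n → P t) → (∀ t → P t → P (t ℕ.+ n)) → ∀ t → P t
periodic-induction P {n} 0<n base step t = go t t ℕ.≤-refl
  where
  go : ∀ bound t → t ℕ.≤ bound → P t
  go bound t t≤ with t ℕ.<? n
  ... | yes t<n = base t t<n
  go zero    t t≤ | no t≮n = ⊥-elim (t≮n (ℕ.≤-trans (s≤s t≤) 0<n))
  go (suc bound) t t≤ | no t≮n = subst P (ℕ.m∸n+n≡m n≤t) (step (t ∸ n) (go bound (t ∸ n)
      (ℕ.≤-pred (ℕ.≤-trans (ℕ.≤-trans (ℕ.∸-monoʳ-< {t} {n} {0} 0<n n≤t) t≤) ℕ.≤-refl))))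
    where n≤t = ℕ.≮⇒≥ t≮n

does⇒ : ∀ {p} {P : Set p} (p? : Dec P) → does p? ≡ true → P
does⇒ (yes p) _ = p

∧-true : ∀ x {y} → x ∧ y ≡ true → y ≡ true
∧-true true eq = eq

module Cyclic (n : ℕ) (0<n : 0 ℕ.< n) (st : ℕ → Step) (st-per : ∀ i → st (i ℕ.+ n) ≡ st i) where

  F K : (ℕ → ℕ) → ℕ → ℤ
  F ω = pre λ i → fδ (st i) (ω i)
  K ω = pre λ i → kδ (st i) (ω i)

  -- The two alternatives in the definition of compatibility, whose equations
  -- between numbers of edges and sums of weights become returns of F and K.
  Good : (ℕ → ℕ) → ℕ → ℕ → Set
  Good ω u v = (∃ λ e → u ℕ.≤ e × e ℕ.< v × st e ≡ north × F ω (suc e) ≡ F ω u)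
             ⊎ (∃ λ e → u ℕ.< e × e ℕ.≤ v × st e ≡ east × K ω e ≡ K ω (suc v))

  -- Positions run over ℕ with period n, so a cyclic arc becomes an interval of length at most n and
  -- wrap-around disappears.
  CompatibleAt : (ℕ → ℕ) → ℕ → ℕ → Set
  CompatibleAt ω u v = u ℕ.≤ v → v ℕ.< u ℕ.+ n → st u ≡ east → st v ≡ north → 0 ℕ.< ω u → 0 ℕ.< ω v → Good ω u v

  Compat : (ℕ → ℕ) → Set
  Compat ω = ∀ u v → CompatibleAt ω u v

  Covered : (ℕ → ℕ) → ℕ → ℕ → Set
  Covered ω u v = ∀ t → u ℕ.< t → t ℕ.≤ v → F ω u ≺ F ω t

  -- Stated for v + n, so that the preceding period has nonnegative positions.
  Free : (ℕ → ℕ) → ℕ → Set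
  Free ω v = ∀ j → j ℕ.≤ n → F ω (v ℕ.+ n) ℤ.≤ F ω (v ℕ.+ j)

  free? : ∀ ω v → Dec (Free ω v)
  free? ω v = map′ (λ f j j≤n → f (s≤s j≤n)) (λ f {j} j<1+n → f j (ℕ.≤-pred j<1+n))
    (ℕ.allUpTo? (λ j → F ω (v ℕ.+ n) ℤ.≤? F ω (v ℕ.+ j)) (suc n))

  isFree : (ℕ → ℕ) → ℕ → Bool
  isFree ω v = not (isEast (st v)) ∧ does (free? ω v)

  F-east : ∀ ω i → st i ≡ east → F ω (suc i) ≡ F ω i ℤ.+ + ω i
  F-east ω i eq = cong (λ s → F ω i ℤ.+ fδ s (ω i)) eq

  F-north : ∀ ω i → st i ≡ north → F ω (suc i) ≡ F ω i ℤ.+ -1ℤ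
  F-north ω i eq = cong (λ s → F ω i ℤ.+ fδ s (ω i)) eq

  K-east : ∀ ω i → st i ≡ east → K ω (suc i) ≡ K ω i ℤ.+ 1ℤ
  K-east ω i eq = cong (λ s → K ω i ℤ.+ kδ s (ω i)) eq

  K-north : ∀ ω i → st i ≡ north → K ω (suc i) ≡ K ω i ℤ.+ ℤ.- + ω i
  K-north ω i eq = cong (λ s → K ω i ℤ.+ kδ s (ω i)) eq

  -- F falls only in unit steps, so leaving its value at u upwards it can
  -- come back below only by attaining it after a north edge.
  hit-or-covered : ∀ ω {u} → st u ≡ east → 0 ℕ.< ω u → ∀ k →
    (∃ λ e → u ℕ.≤ e × e ℕ.< k ℕ.+ suc u × st e ≡ north × F ω (suc e) ≡ F ω u × Covered ω u e)
    ⊎ Covered ω u (k ℕ.+ suc u)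
  hit-or-covered ω {u} eq 0<ω zero = inj₂ λ t u<t t≤ →
    subst (λ t → F ω u ≺ F ω t) (ℕ.≤-antisym u<t t≤)
      (subst (F ω u ≺_) (sym (F-east ω u eq)) (+pos-≺ (F ω u) 0<ω))
  hit-or-covered ω {u} eq 0<ω (suc k) with hit-or-covered ω eq 0<ω k
  ... | inj₁ (e , u≤e , e<v , hit) = inj₁ (e , u≤e , ℕ.m≤n⇒m≤1+n e<v , hit)
  ... | inj₂ covered = go (st v) refl
    where
    v = k ℕ.+ suc u
    u<v : u ℕ.< v
    u<v = ℕ.m≤n+m (suc u) k
    extend : F ω u ≺ F ω (suc v) → Covered ω u (suc v)
    extend p t u<t t≤ with t ℕ.≟ suc v
    ... | yes refl = p
    ... | no t≢ = covered t u<t (ℕ.≤-pred (ℕ.≤∧≢⇒< t≤ t≢))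
    go : ∀ s → st v ≡ s →
      (∃ λ e → u ℕ.≤ e × e ℕ.< suc v × st e ≡ north × F ω (suc e) ≡ F ω u × Covered ω u e) ⊎ Covered ω u (suc v)
    go east  v-east = inj₂ (extend (ℤ.≤-trans (covered v u<v ℕ.≤-refl)
      (subst (F ω v ℤ.≤_) (sym (F-east ω v v-east)) (+ℕ-≤ (F ω v) (ω v)))))
    go north v-north with F ω (suc v) ℤ.≟ F ω u
    ... | yes hit = inj₁ (v , ℕ.<⇒≤ u<v , ℕ.≤-refl , v-north , hit , covered)
    ... | no miss = inj₂ (extend (≤∧≢⇒≺ (subst (F ω u ℤ.≤_) (sym (F-north ω v v-north))
        (≤-from (covered v u<v ℕ.≤-refl) (shuffle (F ω u) (F ω v)))) (miss ∘ sym)))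
      where
      shuffle : ∀ a b → b ℤ.- (1ℤ ℤ.+ a) ≡ b ℤ.+ -1ℤ ℤ.- a
      shuffle = solve-∀

  module _ (ω : ℕ → ℕ) (ω-per : ∀ i → ω (i ℕ.+ n) ≡ ω i) where

    F-shift : ∀ t → F ω (t ℕ.+ n) ≡ F ω t ℤ.+ F ω n
    F-shift = pre-shift n λ i → cong₂ fδ (st-per i) (ω-per i)

    K-shift : ∀ t → K ω (t ℕ.+ n) ≡ K ω t ℤ.+ K ω n
    K-shift = pre-shift n λ i → cong₂ kδ (st-per i) (ω-per i)

    F-shift-≤ : ∀ s t → F ω s ℤ.≤ F ω t → F ω (s ℕ.+ n) ℤ.≤ F ω (t ℕ.+ n)
    F-shift-≤ s t p = subst₂ ℤ._≤_ (sym (F-shift s)) (sym (F-shift t)) (ℤ.+-monoˡ-≤ (F ω n) p)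

    F-unshift-≤ : ∀ s t → F ω (s ℕ.+ n) ℤ.≤ F ω (t ℕ.+ n) → F ω s ℤ.≤ F ω t
    F-unshift-≤ s t p = ≤-from (subst₂ ℤ._≤_ (F-shift s) (F-shift t) p) (eq (F ω s) (F ω t) (F ω n)) where
      eq : ∀ a b c → b ℤ.+ c ℤ.- (a ℤ.+ c) ≡ b ℤ.- a
      eq = solve-∀

    compatibleAt-shift : ∀ u v → CompatibleAt ω u v → CompatibleAt ω (u ℕ.+ n) (v ℕ.+ n)
    compatibleAt-shift u v c u≤v v<u+n u-east v-north 0<ωu 0<ωv with
      c (ℕ.+-cancelʳ-≤ n u v u≤v) (ℕ.+-cancelʳ-≤ n (suc v) (u ℕ.+ n) v<u+n) (trans (sym (st-per u)) u-east)
        (trans (sym (st-per v)) v-north) (subst (0 ℕ.<_) (ω-per u) 0<ωu) (subst (0 ℕ.<_) (ω-per v) 0<ωv)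
    ... | inj₁ (e , u≤e , e<v , e-north , hit) = inj₁ (e ℕ.+ n , ℕ.+-monoˡ-≤ n u≤e , ℕ.+-monoˡ-≤ n e<v ,
            trans (st-per e) e-north , trans (F-shift (suc e)) (trans (cong (ℤ._+ F ω n) hit) (sym (F-shift u))))
    ... | inj₂ (e , u<e , e≤v , e-east , hit) = inj₂ (e ℕ.+ n , ℕ.+-monoˡ-≤ n u<e , ℕ.+-monoˡ-≤ n e≤v ,
            trans (st-per e) e-east , trans (K-shift e) (trans (cong (ℤ._+ K ω n) hit) (sym (K-shift (suc v)))))

    compat-reduce : (∀ u v → u ℕ.< n → CompatibleAt ω u v) → Compat ω
    compat-reduce base = periodic-induction (λ u → ∀ v → CompatibleAt ω u v) 0<n (λ u u<n v → base u v u<n)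
      λ u c v u≤v → let n≤v = ℕ.≤-trans (ℕ.m≤n+m n u) u≤v in
        subst (CompatibleAt ω (u ℕ.+ n)) (ℕ.m∸n+n≡m n≤v) (compatibleAt-shift u (v ∸ n) (c (v ∸ n))) u≤v

    -- `Free` is phrased one period later; periodicity moves the comparison back to v itself.
    free-low : ∀ {u v} → Free ω v → u ℕ.≤ v → v ℕ.≤ u ℕ.+ n → F ω v ℤ.≤ F ω u
    free-low {u} {v} free u≤v v≤u+n = F-unshift-≤ v u (subst (λ t → F ω (v ℕ.+ n) ℤ.≤ F ω t) (ℕ.m+[n∸m]≡n v≤u+n)
      (free (u ℕ.+ n ∸ v) (ℕ.≤-trans (ℕ.∸-monoʳ-≤ (u ℕ.+ n) u≤v) (ℕ.≤-reflexive (ℕ.m+n∸m≡n u n)))))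

    isFree⇒Free : ∀ v → isFree ω v ≡ true → Free ω v
    isFree⇒Free v eq = does⇒ (free? ω v) (∧-true (not (isEast (st v))) eq)

    Free⇒isFree : ∀ v → st v ≡ north → Free ω v → isFree ω v ≡ true
    Free⇒isFree v v-north free = cong₂ (λ s b → not (isEast s) ∧ b) v-north (dec-true (free? ω v) free)

    isFree-shift : ∀ v → isFree ω (v ℕ.+ n) ≡ isFree ω v
    isFree-shift v = cong₂ (λ s b → not (isEast s) ∧ b) (st-per v) same
      where
      comm : ∀ j → v ℕ.+ n ℕ.+ j ≡ v ℕ.+ j ℕ.+ n
      comm j = trans (ℕ.+-assoc v n j) (trans (cong (λ z → v ℕ.+ z) (ℕ.+-comm n j)) (sym (ℕ.+-assoc v j n)))
      same : does (free? ω (v ℕ.+ n)) ≡ does (free? ω v)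
      same = does-⇔ (mk⇔
        (λ free j j≤n → F-unshift-≤ (v ℕ.+ n) (v ℕ.+ j) (subst (λ t → F ω (v ℕ.+ n ℕ.+ n) ℤ.≤ F ω t) (comm j) (free j j≤n)))
        (λ free j j≤n → subst (λ t → F ω (v ℕ.+ n ℕ.+ n) ℤ.≤ F ω t) (sym (comm j)) (F-shift-≤ (v ℕ.+ n) (v ℕ.+ j) (free j j≤n))))
        (free? ω (v ℕ.+ n)) (free? ω v)

    -- K falls only at vertical edges of positive weight, and there compatibility with u applies.
    -- The first alternative is a return of F to F(u), which coverage excludes. The second says that
    -- K falls back to a value it had at an earlier position after u, where the claim is known by
    -- induction.
    K-rises : Compat ω → ∀ {u v} → st u ≡ east → Covered ω u v → v ℕ.< u ℕ.+ n → 0 ℕ.< ω u →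
              ∀ k s → u ℕ.< s → s ℕ.≤ k ℕ.+ suc u → s ℕ.≤ suc v → K ω u ≺ K ω s
    K-rises compat {u} {v} u-east covered v<u+n 0<ωu zero s u<s s≤ _ =
      subst (λ s → K ω u ≺ K ω s) (ℕ.≤-antisym u<s s≤)
        (subst (K ω u ≺_) (sym (K-east ω u u-east)) (+pos-≺ (K ω u) (s≤s z≤n)))
    K-rises compat {u} {v} u-east covered v<u+n 0<ωu (suc k) s u<s s≤ s≤v+1 with s ℕ.≟ suc k ℕ.+ suc u
    ... | no s≢ = K-rises compat u-east covered v<u+n 0<ωu k s u<s (ℕ.≤-pred (ℕ.≤∧≢⇒< s≤ s≢)) s≤v+1
    ... | yes refl = go (st t) refl
      where
      t = k ℕ.+ suc u
      u<t : u ℕ.< t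
      u<t = ℕ.m≤n+m (suc u) k
      t≤v : t ℕ.≤ v
      t≤v = ℕ.≤-pred s≤v+1
      IH : ∀ s → u ℕ.< s → s ℕ.≤ t → K ω u ≺ K ω s
      IH s u<s s≤t = K-rises compat u-east covered v<u+n 0<ωu k s u<s s≤t (ℕ.≤-trans s≤t (ℕ.m≤n⇒m≤1+n t≤v))
      go : ∀ x → st t ≡ x → K ω u ≺ K ω (suc t)
      go east  t-east = ℤ.≤-trans (IH t u<t ℕ.≤-refl) (subst (K ω t ℤ.≤_) (sym (K-east ω t t-east)) (+ℕ-≤ (K ω t) 1))
      go north t-north = weigh (ω t) refl
        where
        weigh : ∀ m → ω t ≡ m → K ω u ≺ K ω (suc t)
        weigh zero    ωt = subst (K ω u ≺_) (sym (trans (K-north ω t t-north)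
                       (trans (cong (λ k → K ω t ℤ.+ ℤ.- + k) ωt) (ℤ.+-identityʳ _)))) (IH t u<t ℕ.≤-refl)
        weigh (suc _) ωt with compat u t (ℕ.<⇒≤ u<t) (ℕ.≤-trans (s≤s t≤v) v<u+n) u-east t-north 0<ωu (subst (0 ℕ.<_) (sym ωt) (s≤s z≤n))
        ... | inj₁ (e , u≤e , e<t , _ , hit) =
                ⊥-elim (≺⇒≱ (covered (suc e) (s≤s u≤e) (ℕ.≤-trans e<t t≤v)) (ℤ.≤-reflexive hit))
        ... | inj₂ (e , u<e , e≤t , _ , hit) = subst (K ω u ≺_) hit (IH e u<e e≤t)

    covered⇒K-rises : Compat ω → ∀ {u v} → st u ≡ east → Covered ω u v → v ℕ.< u ℕ.+ n → 0 ℕ.< ω u →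
                      u ℕ.≤ v → K ω u ≺ K ω (suc v)
    covered⇒K-rises compat {u} {v} u-east covered v<u+n 0<ωu u≤v =
      K-rises compat u-east covered v<u+n 0<ωu (v ∸ u) (suc v) (s≤s u≤v)
        (ℕ.≤-reflexive (sym (trans (ℕ.+-suc (v ∸ u) u) (cong suc (ℕ.m∸n+n≡m u≤v))))) ℕ.≤-refl

    -- Choosing the last of the minima makes F strictly higher at all later positions up to v.
    last-minimum : ∀ v → ∃ λ u → u ℕ.≤ v × (∀ t → t ℕ.≤ v → F ω u ℤ.≤ F ω t) × Covered ω u v
    last-minimum zero = 0 , z≤n , (λ { zero _ → ℤ.≤-refl }) , λ { (suc _) _ () }
    last-minimum (suc v) with last-minimum v
    ... | u , u≤v , min , covered with F ω (suc v) ℤ.≤? F ω u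
    ...   | yes p = suc v , ℕ.≤-refl ,
              (λ t t≤ → case-≤ t t≤ (λ t≤v → ℤ.≤-trans p (min t t≤v)) λ { refl → ℤ.≤-refl }) ,
              λ t v<t t≤v → ⊥-elim (ℕ.<⇒≱ v<t t≤v)
      where
      case-≤ : ∀ t {P : Set} → t ℕ.≤ suc v → (t ℕ.≤ v → P) → (t ≡ suc v → P) → P
      case-≤ t t≤ f g with t ℕ.≟ suc v
      ... | yes eq = g eq
      ... | no ≢   = f (ℕ.≤-pred (ℕ.≤∧≢⇒< t≤ ≢))
    ...   | no ¬p = u , ℕ.m≤n⇒m≤1+n u≤v , min′ , covered′
      where
      min′ : ∀ t → t ℕ.≤ suc v → F ω u ℤ.≤ F ω t
      min′ t t≤ with t ℕ.≟ suc v
      ... | yes refl = ≺⇒≤ (≰⇒≺ ¬p)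
      ... | no ≢     = min t (ℕ.≤-pred (ℕ.≤∧≢⇒< t≤ ≢))
      covered′ : Covered ω u (suc v)
      covered′ t u<t t≤ with t ℕ.≟ suc v
      ... | yes refl = ≰⇒≺ ¬p
      ... | no ≢     = covered t u<t (ℕ.≤-pred (ℕ.≤∧≢⇒< t≤ ≢))

  module _ (ω ω′ : ℕ → ℕ) (ω-per : ∀ i → ω (i ℕ.+ n) ≡ ω i) (agree : ∀ i → isFree ω i ≡ false → ω i ≡ ω′ i) where

    -- Horizontal edges are never free and F ignores vertical weights, so F, and with it the free
    -- set, does not see a change on free edges.
    agree-on-east : ∀ i → fδ (st i) (ω i) ≡ fδ (st i) (ω′ i)
    agree-on-east i with st i in eq
    ... | north = refl
    ... | east  = cong +_ (agree i (cong (λ s → not (isEast s) ∧ does (free? ω i)) eq))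

    F-agree : ∀ t → F ω t ≡ F ω′ t
    F-agree = pre-cong agree-on-east

    isFree-agree : ∀ v → isFree ω v ≡ isFree ω′ v
    isFree-agree v = cong (not (isEast (st v)) ∧_) same
      where
      same : does (free? ω v) ≡ does (free? ω′ v)
      same = does-⇔ (mk⇔
        (λ free j j≤n → subst₂ ℤ._≤_ (F-agree (v ℕ.+ n)) (F-agree (v ℕ.+ j)) (free j j≤n))
        (λ free j j≤n → subst₂ ℤ._≤_ (sym (F-agree (v ℕ.+ n))) (sym (F-agree (v ℕ.+ j))) (free j j≤n)))
        (free? ω v) (free? ω′ v)

    -- An interval above its starting level contains no free edge.
    covered-agree : ∀ {u v} → Covered ω u v → st u ≡ east → v ℕ.< u ℕ.+ n → ∀ i → u ℕ.≤ i → i ℕ.≤ v → ω i ≡ ω′ i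
    covered-agree {u} {v} covered u-east v<u+n i u≤i i≤v = agree i not-free
      where
      not-free : isFree ω i ≡ false
      not-free with isFree ω i in eq
      ... | false = refl
      ... | true with u ℕ.≟ i
      ...   | yes refl with () ← trans (sym eq) (cong (λ s → not (isEast s) ∧ does (free? ω i)) u-east)
      ...   | no u≢i = ⊥-elim (≺⇒≱ (covered i (ℕ.≤∧≢⇒< u≤i u≢i) i≤v)
                (free-low ω ω-per (isFree⇒Free ω ω-per i eq) u≤i (ℕ.≤-trans i≤v (ℕ.<⇒≤ v<u+n))))

    -- If F returns to F(u) before v, the first alternative holds for any vertical weights.
    -- Otherwise the interval is covered, the two gradings coincide on it, and the alternative valid
    -- for ω carries over.
    compat-agree : Compat ω → Compat ω′
    compat-agree compat u v u≤v v<u+n u-east v-north 0<ω′u 0<ω′v with u ℕ.≟ v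
    ... | yes refl with () ← trans (sym u-east) v-north
    ... | no u≢v with hit-or-covered ω′ u-east 0<ω′u (v ∸ suc u)
    ...   | inj₁ (e , u≤e , e<v , e-north , hit , _) =
              inj₁ (e , u≤e , subst (e ℕ.<_) (ℕ.m∸n+n≡m (ℕ.≤∧≢⇒< u≤v u≢v)) e<v , e-north , hit)
    ...   | inj₂ covered′ = transfer (compat u v u≤v v<u+n u-east v-north
              (subst (0 ℕ.<_) (sym (ω≡ω′ u ℕ.≤-refl u≤v)) 0<ω′u) (subst (0 ℕ.<_) (sym (ω≡ω′ v u≤v ℕ.≤-refl)) 0<ω′v))
      where
      covered : Covered ω u v
      covered t u<t t≤v = subst₂ _≺_ (sym (F-agree u)) (sym (F-agree t))
        (covered′ t u<t (subst (t ℕ.≤_) (sym (ℕ.m∸n+n≡m (ℕ.≤∧≢⇒< u≤v u≢v))) t≤v))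
      ω≡ω′ = covered-agree covered u-east v<u+n
      transfer : Good ω u v → Good ω′ u v
      transfer (inj₁ (e , u≤e , e<v , e-north , hit)) =
        inj₁ (e , u≤e , e<v , e-north , trans (sym (F-agree (suc e))) (trans hit (F-agree u)))
      transfer (inj₂ (e , u<e , e≤v , e-east , hit)) = inj₂ (e , u<e , e≤v , e-east ,
        sym (ℤ.i-j≡0⇒i≡j _ _ (trans (sym same) (ℤ.i≡j⇒i-j≡0 (sym hit)))))
        where
        e≤1+v = ℕ.m≤n⇒m≤1+n e≤v
        same : K ω (suc v) ℤ.- K ω e ≡ K ω′ (suc v) ℤ.- K ω′ e
        same = subst (λ t → K ω t ℤ.- K ω e ≡ K ω′ t ℤ.- K ω′ e) (ℕ.m∸n+n≡m e≤1+v)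
          (pre-agree e (suc v ∸ e) λ i e≤i i< → cong (kδ (st i)) (ω≡ω′ i (ℕ.≤-trans (ℕ.<⇒≤ u<e) e≤i)
            (ℕ.≤-pred (subst (i ℕ.<_) (ℕ.m∸n+n≡m e≤1+v) i<))))

  -- The number of free edges in a period

  indicator : Bool → ℤ
  indicator b = if b then 1ℤ else 0ℤ

  module _ (ω : ℕ → ℕ) (ω-per : ∀ i → ω (i ℕ.+ n) ≡ ω i) where

    minimum : ℕ → ℤ
    minimum v = F ω (proj₁ (last-minimum ω ω-per v))

    minimum-≤ : ∀ v t → t ℕ.≤ v → minimum v ℤ.≤ F ω t
    minimum-≤ v = proj₁ (proj₂ (proj₂ (last-minimum ω ω-per v)))

    minimum-unique : ∀ v {x} → (∀ t → t ℕ.≤ v → x ℤ.≤ F ω t) → (∃ λ t → t ℕ.≤ v × F ω t ℤ.≤ x) → minimum v ≡ x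
    minimum-unique v low (t , t≤v , attained) = ℤ.≤-antisym (ℤ.≤-trans (minimum-≤ v t t≤v) attained)
      (low _ (proj₁ (proj₂ (last-minimum ω ω-per v))))

    minimum-attained : ∀ v → ∃ λ t → t ℕ.≤ v × F ω t ℤ.≤ minimum v
    minimum-attained v = _ , proj₁ (proj₂ (last-minimum ω ω-per v)) , ℤ.≤-refl

    minimum-keeps : ∀ v → minimum v ℤ.≤ F ω (suc v) → minimum (suc v) ≡ minimum v
    minimum-keeps v p = minimum-unique (suc v) low
      (let t , t≤v , attained = minimum-attained v in t , ℕ.m≤n⇒m≤1+n t≤v , attained)
      where
      low : ∀ t → t ℕ.≤ suc v → minimum v ℤ.≤ F ω t
      low t t≤ with t ℕ.≟ suc v
      ... | yes refl = p
      ... | no ≢     = minimum-≤ v t (ℕ.≤-pred (ℕ.≤∧≢⇒< t≤ ≢))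

    minimum-drops : ∀ v → F ω (suc v) ℤ.≤ minimum v → minimum (suc v) ≡ F ω (suc v)
    minimum-drops v p = minimum-unique (suc v) low (suc v , ℕ.≤-refl , ℤ.≤-refl)
      where
      low : ∀ t → t ℕ.≤ suc v → F ω (suc v) ℤ.≤ F ω t
      low t t≤ with t ℕ.≟ suc v
      ... | yes refl = ℤ.≤-refl
      ... | no ≢     = ℤ.≤-trans p (minimum-≤ v t (ℕ.≤-pred (ℕ.≤∧≢⇒< t≤ ≢)))

    shift-≤ : F ω n ℤ.≤ 0ℤ → ∀ t → F ω (t ℕ.+ n) ℤ.≤ F ω t
    shift-≤ F≤0 t = subst₂ ℤ._≤_ (sym (F-shift ω ω-per t)) (ℤ.+-identityʳ (F ω t)) (ℤ.+-monoʳ-≤ (F ω t) F≤0)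

    record⇒Free : ∀ v → F ω (v ℕ.+ n) ℤ.≤ minimum (v ℕ.+ n) → Free ω v
    record⇒Free v p j j≤n = ℤ.≤-trans p (minimum-≤ (v ℕ.+ n) (v ℕ.+ j) (ℕ.+-monoʳ-≤ v j≤n))

    -- Freeness looks back over one period only; as F does not rise over a period, older positions
    -- are at least as high as their translates into that period.
    Free⇒record : F ω n ℤ.≤ 0ℤ → ∀ {v} → v ℕ.< n → Free ω v → F ω (v ℕ.+ n) ≡ minimum (v ℕ.+ n)
    Free⇒record F≤0 {v} v<n free = sym (minimum-unique (v ℕ.+ n) low (v ℕ.+ n , ℕ.≤-refl , ℤ.≤-refl))
      where
      window : ∀ y → v ℕ.≤ y → y ℕ.≤ v ℕ.+ n → F ω (v ℕ.+ n) ℤ.≤ F ω y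
      window y v≤y y≤ = subst (λ y → F ω (v ℕ.+ n) ℤ.≤ F ω y) (ℕ.m+[n∸m]≡n v≤y)
        (free (y ∸ v) (ℕ.≤-trans (ℕ.∸-monoˡ-≤ v y≤) (ℕ.≤-reflexive (ℕ.m+n∸m≡n v n))))
      low : ∀ y → y ℕ.≤ v ℕ.+ n → F ω (v ℕ.+ n) ℤ.≤ F ω y
      low y y≤ with v ℕ.≤? y
      ... | yes v≤y = window y v≤y y≤
      ... | no v≰y  = ℤ.≤-trans (window (y ℕ.+ n) (ℕ.≤-trans (ℕ.<⇒≤ v<n) (ℕ.m≤n+m n y))
                        (ℕ.+-monoˡ-≤ n (ℕ.<⇒≤ (ℕ.≰⇒> v≰y)))) (shift-≤ F≤0 y)

    freeCount : ℕ → ℤ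
    freeCount = pre λ v → indicator (isFree ω v)

    -- F falls in unit steps, so its running minimum drops, by exactly 1, at those vertical edges
    -- before which F stands at that minimum, and these are the free ones. The shift by n provides
    -- the period that freeness looks back on.
    minimum-step : F ω n ℤ.≤ 0ℤ → ∀ v → v ℕ.< n → minimum (suc v ℕ.+ n) ℤ.+ indicator (isFree ω v) ≡ minimum (v ℕ.+ n)
    minimum-step F≤0 v v<n = go (st v) refl
      where
      t = v ℕ.+ n
      go : ∀ s → st v ≡ s → minimum (suc t) ℤ.+ indicator (isFree ω v) ≡ minimum t
      go east v-east = trans (cong₂ ℤ._+_ keeps (cong (λ s → indicator (not (isEast s) ∧ does (free? ω v))) v-east))
                             (ℤ.+-identityʳ _)
        where
        keeps : minimum (suc t) ≡ minimum t
        keeps = minimum-keeps t (ℤ.≤-trans (minimum-≤ t t ℕ.≤-refl) (subst (F ω t ℤ.≤_)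
          (sym (F-east ω t (trans (st-per v) v-east))) (+ℕ-≤ (F ω t) (ω t))))
      go north v-north with isFree ω v in eq
      ... | true = trans (cong (ℤ._+ 1ℤ) (trans (minimum-drops t (subst (ℤ._≤ minimum t) (sym F-next)
                       (subst (λ z → z ℤ.+ -1ℤ ℤ.≤ minimum t) (sym F≡min) (pred-≤ (minimum t))))) F-next))
                     (trans (cancel (F ω t)) F≡min)
        where
        F≡min = Free⇒record F≤0 v<n (isFree⇒Free ω ω-per v eq)
        F-next = F-north ω t (trans (st-per v) v-north)
        cancel : ∀ a → a ℤ.+ -1ℤ ℤ.+ 1ℤ ≡ a
        cancel = solve-∀
      ... | false = trans (ℤ.+-identityʳ _) (minimum-keeps t (subst (minimum t ℤ.≤_)
                      (sym (F-north ω t (trans (st-per v) v-north))) (≤-from above (cancel (F ω t) (minimum t)))))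
        where
        above : minimum t ≺ F ω t
        above = ≰⇒≺ λ p → case-false (trans (sym eq) (Free⇒isFree ω ω-per v v-north (record⇒Free v p)))
          where
          case-false : ¬ (false ≡ true)
          case-false ()
        cancel : ∀ a m → a ℤ.- (1ℤ ℤ.+ m) ≡ a ℤ.+ -1ℤ ℤ.- m
        cancel = solve-∀

    freeCount-minimum : F ω n ℤ.≤ 0ℤ → ∀ t → t ℕ.≤ n → freeCount t ≡ minimum n ℤ.- minimum (t ℕ.+ n)
    freeCount-minimum F≤0 zero    _   = sym (ℤ.+-inverseʳ (minimum n))
    freeCount-minimum F≤0 (suc t) t<n = trans (cong (ℤ._+ indicator (isFree ω t)) (freeCount-minimum F≤0 t (ℕ.<⇒≤ t<n)))
      (trans (cong (λ z → minimum n ℤ.- z ℤ.+ indicator (isFree ω t)) (sym (minimum-step F≤0 t t<n)))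
        (cancel (minimum n) (minimum (suc t ℕ.+ n)) (indicator (isFree ω t))))
      where
      cancel : ∀ a b c → a ℤ.- (b ℤ.+ c) ℤ.+ c ≡ a ℤ.- b
      cancel = solve-∀

    minimum-period : F ω n ℤ.≤ 0ℤ → minimum (n ℕ.+ n) ≡ minimum n ℤ.+ F ω n
    minimum-period F≤0 = minimum-unique (n ℕ.+ n) low
      (let t , t≤n , attained = minimum-attained n in t ℕ.+ n , ℕ.+-monoˡ-≤ n t≤n ,
        subst (ℤ._≤ minimum n ℤ.+ F ω n) (sym (F-shift ω ω-per t)) (ℤ.+-monoˡ-≤ (F ω n) attained))
      where
      low : ∀ t → t ℕ.≤ n ℕ.+ n → minimum n ℤ.+ F ω n ℤ.≤ F ω t
      low t t≤ with t ℕ.≤? n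
      ... | yes t≤n = ℤ.≤-trans (subst (minimum n ℤ.+ F ω n ℤ.≤_) (ℤ.+-identityʳ (minimum n)) (ℤ.+-monoʳ-≤ (minimum n) F≤0))
                        (minimum-≤ n t t≤n)
      ... | no t≰n = subst (minimum n ℤ.+ F ω n ℤ.≤_) (trans (sym (F-shift ω ω-per (t ∸ n))) (cong (F ω) (ℕ.m∸n+n≡m n≤t)))
                       (ℤ.+-monoˡ-≤ (F ω n) (minimum-≤ n (t ∸ n) (ℕ.+-cancelʳ-≤ n (t ∸ n) n
                         (subst (ℕ._≤ n ℕ.+ n) (sym (ℕ.m∸n+n≡m n≤t)) t≤))))
        where n≤t = ℕ.<⇒≤ (ℕ.≰⇒> t≰n)

    -- The count telescopes to the fall of the running minimum over the second period, which by
    -- periodicity is the fall of F.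
    freeCount-falling : F ω n ℤ.≤ 0ℤ → freeCount n ≡ ℤ.- F ω n
    freeCount-falling F≤0 = trans (freeCount-minimum F≤0 n ℕ.≤-refl)
      (trans (cong (λ z → minimum n ℤ.- z) (minimum-period F≤0)) (cancel (minimum n) (F ω n)))
      where
      cancel : ∀ a b → a ℤ.- (a ℤ.+ b) ≡ ℤ.- b
      cancel = solve-∀

    -- At a free edge F is not above its value one period earlier, which is impossible if F rises
    -- over a period.
    freeCount-rising : ¬ (F ω n ℤ.≤ 0ℤ) → ∀ t → freeCount t ≡ 0ℤ
    freeCount-rising F≰0 zero    = refl
    freeCount-rising F≰0 (suc t) = cong₂ ℤ._+_ (freeCount-rising F≰0 t) (cong indicator none)
      where
      none : isFree ω t ≡ false
      none with isFree ω t in eq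
      ... | false = refl
      ... | true  = ⊥-elim (F≰0 (≤-from (isFree⇒Free ω ω-per t eq 0 z≤n)
              (trans (cong₂ (λ x y → F ω x ℤ.- y) (ℕ.+-identityʳ t) (F-shift ω ω-per t)) (cancel (F ω t) (F ω n)))))
        where
        cancel : ∀ a b → a ℤ.- (a ℤ.+ b) ≡ 0ℤ ℤ.- b
        cancel = solve-∀

-- Slopes of reduced gradings

hδ : ℕ → ℕ → Step → ℤ
hδ d₁ d₂ east  = + d₂
hδ d₁ d₂ north = ℤ.- + d₁

-- Over a period these add up to d₁ω(horizontal) - d₂ω(vertical), whose positivity is the slope
-- inequality.
dδ : ℕ → ℕ → Step → ℕ → ℤ
dδ d₁ d₂ east  k = + d₁ ℤ.* + k
dδ d₁ d₂ north k = ℤ.- (+ d₂ ℤ.* + k)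

-- h(t) measures how far the path lies below the diagonal after t edges.
record Bounds (d₁ d₂ n : ℕ) (st : ℕ → Step) : Set where
  h : ℕ → ℤ
  h = pre λ i → hδ d₁ d₂ (st i)
  field
    h-period : h n ≡ 0ℤ
    h-≥0     : ∀ t → 0ℤ ℤ.≤ h t
    -- Before an east step, a north step would lead above the diagonal, that is, make h - d₁
    -- negative. `h-north` is the mirror image of this bound, so that the record is stable under
    -- reflection.
    h-east   : ∀ t → st t ≡ east → h t ≺ + d₁
    h-north  : ∀ t → st t ≡ north → h (suc t) ≺ + d₂

module Slope (n : ℕ) (0<n : 0 ℕ.< n) (st : ℕ → Step) (st-per : ∀ i → st (i ℕ.+ n) ≡ st i)
             (d₁ d₂ : ℕ) (bounds : Bounds d₁ d₂ n st)
             (ω : ℕ → ℕ) (ω-per : ∀ i → ω (i ℕ.+ n) ≡ ω i) where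

  open Cyclic n 0<n st st-per
  open Bounds bounds

  D : ℕ → ℤ
  D = pre λ i → dδ d₁ d₂ (st i) (ω i)

  -- At a horizontal edge d₂K and h both gain d₂, at a vertical edge d₁F and h both lose d₁; only
  -- the contributions of the weights survive.
  D-h : ∀ t → D t ≡ + d₁ ℤ.* F ω t ℤ.+ + d₂ ℤ.* K ω t ℤ.- h t
  D-h zero = sym (trans (cong₂ (λ x y → x ℤ.+ y ℤ.- 0ℤ) (ℤ.*-zeroʳ (+ d₁)) (ℤ.*-zeroʳ (+ d₂))) refl)
  D-h (suc t) = trans (cong (ℤ._+ dδ d₁ d₂ (st t) (ω t)) (D-h t)) (step (st t))
    where
    east-eq : ∀ a b x y z k → a ℤ.* x ℤ.+ b ℤ.* y ℤ.- z ℤ.+ a ℤ.* k ≡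
                              a ℤ.* (x ℤ.+ k) ℤ.+ b ℤ.* (y ℤ.+ 1ℤ) ℤ.- (z ℤ.+ b)
    east-eq = solve-∀
    north-eq : ∀ a b x y z k → a ℤ.* x ℤ.+ b ℤ.* y ℤ.- z ℤ.+ ℤ.- (b ℤ.* k) ≡
                               a ℤ.* (x ℤ.+ -1ℤ) ℤ.+ b ℤ.* (y ℤ.+ ℤ.- k) ℤ.- (z ℤ.+ ℤ.- a)
    north-eq = solve-∀
    step : ∀ s → + d₁ ℤ.* F ω t ℤ.+ + d₂ ℤ.* K ω t ℤ.- h t ℤ.+ dδ d₁ d₂ s (ω t) ≡
                 + d₁ ℤ.* (F ω t ℤ.+ fδ s (ω t)) ℤ.+ + d₂ ℤ.* (K ω t ℤ.+ kδ s (ω t)) ℤ.- (h t ℤ.+ hδ d₁ d₂ s)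
    step east  = east-eq (+ d₁) (+ d₂) (F ω t) (K ω t) (h t) (+ ω t)
    step north = north-eq (+ d₁) (+ d₂) (F ω t) (K ω t) (h t) (+ ω t)

  D-idle : ∀ t → ω t ≡ 0 → D (suc t) ≡ D t
  D-idle t ωt≡0 = trans (cong (λ k → D t ℤ.+ dδ d₁ d₂ (st t) k) ωt≡0) (trans (cong (λ z → D t ℤ.+ z) (idle (st t))) (ℤ.+-identityʳ (D t)))
    where
    idle : ∀ s → dδ d₁ d₂ s 0 ≡ 0ℤ
    idle east  = ℤ.*-zeroʳ (+ d₁)
    idle north = cong ℤ.-_ (ℤ.*-zeroʳ (+ d₂))

  ω-per* : ∀ k i → ω (i ℕ.+ k ℕ.* n) ≡ ω i
  ω-per* zero    i = cong ω (ℕ.+-identityʳ i)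
  ω-per* (suc k) i = trans (cong ω (trans (cong (λ z → i ℕ.+ z) (ℕ.+-comm n (k ℕ.* n))) (sym (ℕ.+-assoc i (k ℕ.* n) n))))
                       (trans (ω-per (i ℕ.+ k ℕ.* n)) (ω-per* k i))

  idle-period⇒idle : ∀ x → (∀ y → x ℕ.≤ y → y ℕ.< x ℕ.+ n → ω y ≡ 0) → ∀ i → ω i ≡ 0
  -- Adding x periods moves i past x, because n is at least 1.
  idle-period⇒idle x idle i = trans (sym (ω-per* x i))
    (trans (cong ω (sym (ℕ.m+[n∸m]≡n x≤))) (after (i ℕ.+ x ℕ.* n ∸ x)))
    where
    x≤ : x ℕ.≤ i ℕ.+ x ℕ.* n
    x≤ = ℕ.≤-trans (ℕ.≤-trans (ℕ.≤-reflexive (sym (ℕ.*-identityʳ x))) (ℕ.*-monoʳ-≤ x 0<n)) (ℕ.m≤n+m (x ℕ.* n) i)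
    after : ∀ j → ω (x ℕ.+ j) ≡ 0
    after = periodic-induction (λ j → ω (x ℕ.+ j) ≡ 0) 0<n
      (λ j j<n → idle (x ℕ.+ j) (ℕ.m≤m+n x j) (ℕ.+-monoʳ-< x j<n))
      λ j eq → trans (cong ω (sym (ℕ.+-assoc x j n))) (trans (ω-per (x ℕ.+ j)) eq)

  module _ (compat : Compat ω) (off-free : ∀ v → st v ≡ north → Free ω v → ω v ≡ 0) where

    -- F returns to its value and d₂K gains at least d₂, whereas h grows by at most d₂ - 1: it is
    -- nonnegative at u and below d₂ after the vertical edge v.
    D-block : ∀ {u v} → st u ≡ east → st v ≡ north → 0 ℕ.< ω u → u ℕ.≤ v → v ℕ.< u ℕ.+ n →
              F ω (suc v) ≡ F ω u → Covered ω u v → D u ≺ D (suc v)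
    D-block {u} {v} u-east v-north 0<ωu u≤v v<u+n return covered = subst₂ _≺_ (sym (D-h u)) (sym (D-h (suc v)))
      (≤-from₂ (ℤ.*-monoˡ-≤-nonNeg (+ d₂) (covered⇒K-rises ω ω-per compat u-east covered v<u+n 0<ωu u≤v))
               (ℤ.+-mono-≤ (h-north v v-north) (h-≥0 u))
        (trans (rearrange (+ d₁) (+ d₂) (F ω u) (K ω u) (K ω (suc v)) (h u) (h (suc v)))
          (cong (λ f → + d₁ ℤ.* f ℤ.+ + d₂ ℤ.* K ω (suc v) ℤ.- h (suc v) ℤ.-
                       (1ℤ ℤ.+ (+ d₁ ℤ.* F ω u ℤ.+ + d₂ ℤ.* K ω u ℤ.- h u))) (sym return))))
      where
      rearrange : ∀ a b f x y h h′ → b ℤ.* y ℤ.- b ℤ.* (1ℤ ℤ.+ x) ℤ.+ (b ℤ.+ h ℤ.- ((1ℤ ℤ.+ h′) ℤ.+ 0ℤ)) ≡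
        a ℤ.* f ℤ.+ b ℤ.* y ℤ.- h′ ℤ.- (1ℤ ℤ.+ (a ℤ.* f ℤ.+ b ℤ.* x ℤ.- h))
      rearrange = solve-∀

    Lowest : ℕ → Set
    Lowest t = ∀ y → y ℕ.≤ t → F ω t ℤ.≤ F ω y

    -- With a full period before t, a lowest point in front of a vertical edge makes the edge one
    -- period earlier free, and the grading vanishes there.
    Lowest⇒idle : ∀ t → n ℕ.≤ t → Lowest t → st t ≡ north → ω t ≡ 0
    Lowest⇒idle t n≤t low t-north = subst (λ t → ω t ≡ 0) t≡ (trans (ω-per (t ∸ n)) (off-free (t ∸ n)
      (trans (sym (st-per (t ∸ n))) (trans (cong st t≡) t-north))
      λ j j≤n → subst (λ t → F ω t ℤ.≤ F ω (t′ ℕ.+ j)) (sym t≡)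
        (low (t′ ℕ.+ j) (ℕ.≤-trans (ℕ.+-monoʳ-≤ t′ j≤n) (ℕ.≤-reflexive t≡)))))
      where
      t′ = t ∸ n
      t≡ = ℕ.m∸n+n≡m n≤t

    Lowest-suc : ∀ t → Lowest t → F ω (suc t) ℤ.≤ F ω t → Lowest (suc t)
    Lowest-suc t low p y y≤ with y ℕ.≟ suc t
    ... | yes refl = ℤ.≤-refl
    ... | no ≢     = ℤ.≤-trans p (low y (ℕ.≤-pred (ℕ.≤∧≢⇒< y≤ ≢)))

    Lowest-jump : ∀ t e → t ℕ.≤ e → Lowest t → F ω (suc e) ≡ F ω t → Covered ω t e → Lowest (suc e)
    Lowest-jump t e t≤e low return covered y y≤ with y ℕ.≟ suc e | y ℕ.≤? t
    ... | yes refl | _       = ℤ.≤-refl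
    ... | no _     | yes y≤t = subst (ℤ._≤ F ω y) (sym return) (low y y≤t)
    ... | no ≢     | no y≰t  = subst (ℤ._≤ F ω y) (sym return) (≺⇒≤ (covered y (ℕ.≰⇒> y≰t) (ℕ.≤-pred (ℕ.≤∧≢⇒< y≤ ≢))))

    module _ (x : ℕ) (n≤x : n ℕ.≤ x) (end-low : ∀ t → x ℕ.≤ t → t ℕ.≤ x ℕ.+ n → F ω (x ℕ.+ n) ℤ.≤ F ω t) where

      -- The second alternative says that no edge from t on has positive weight; over a whole period
      -- this contradicts a nonzero grading.
      Outcome : ℕ → Set
      Outcome t = D t ≺ D (x ℕ.+ n) ⊎ (D t ℤ.≤ D (x ℕ.+ n) × ∀ y → t ℕ.≤ y → y ℕ.< x ℕ.+ n → ω y ≡ 0)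

      idle-step : ∀ t → ω t ≡ 0 → Outcome (suc t) → Outcome t
      idle-step t ωt≡0 (inj₁ p) = inj₁ (subst (_≺ D (x ℕ.+ n)) (D-idle t ωt≡0) p)
      idle-step t ωt≡0 (inj₂ (p , idle)) = inj₂ (subst (ℤ._≤ D (x ℕ.+ n)) (D-idle t ωt≡0) p , idle′)
        where
        idle′ : ∀ y → t ℕ.≤ y → y ℕ.< x ℕ.+ n → ω y ≡ 0
        idle′ y t≤y y< with t ℕ.≟ y
        ... | yes refl = ωt≡0
        ... | no t≢y   = idle y (ℕ.≤∧≢⇒< t≤y t≢y) y<

      -- At a lowest point, the path continues with an idle edge or with a
      -- block at whose end F returns to its initial value, and blocks raise D.
      walk : ∀ k t → x ℕ.+ n ℕ.≤ k ℕ.+ t → x ℕ.≤ t → t ℕ.≤ x ℕ.+ n → Lowest t → Outcome t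
      walk zero t ≤t x≤t t≤ low = inj₂ (ℤ.≤-reflexive (cong D (ℕ.≤-antisym t≤ ≤t)) , λ y t≤y y< → ⊥-elim (ℕ.<⇒≱ y< (ℕ.≤-trans ≤t t≤y)))
      walk (suc k) t bound x≤t t≤ low with t ℕ.≟ x ℕ.+ n
      ... | yes refl = inj₂ (ℤ.≤-refl , λ y t≤y y< → ⊥-elim (ℕ.<⇒≱ y< t≤y))
      ... | no t≢ = go (st t) refl (ω t) refl
        where
        t< : t ℕ.< x ℕ.+ n
        t< = ℕ.≤∧≢⇒< t≤ t≢
        continue : ∀ s → suc t ℕ.≤ s → s ℕ.≤ x ℕ.+ n → Lowest s → Outcome s
        continue s t<s s≤ = walk k s (ℕ.≤-trans bound (ℕ.≤-trans (ℕ.≤-reflexive (sym (ℕ.+-suc k t))) (ℕ.+-monoʳ-≤ k t<s)))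
          (ℕ.≤-trans x≤t (ℕ.<⇒≤ t<s)) s≤
        next : ω t ≡ 0 → F ω (suc t) ℤ.≤ F ω t → Outcome t
        next ωt≡0 p = idle-step t ωt≡0 (continue (suc t) ℕ.≤-refl t< (Lowest-suc t low p))
        go : ∀ s → st t ≡ s → ∀ m → ω t ≡ m → Outcome t
        go north t-north _ _ = next (Lowest⇒idle t (ℕ.≤-trans n≤x x≤t) low t-north)
          (subst (ℤ._≤ F ω t) (sym (F-north ω t t-north)) (pred-≤ (F ω t)))
        go east t-east zero ωt = next ωt (ℤ.≤-reflexive (trans (F-east ω t t-east)
          (trans (cong (λ k → F ω t ℤ.+ + k) ωt) (ℤ.+-identityʳ (F ω t)))))
        go east t-east (suc m) ωt with hit-or-covered ω t-east (subst (0 ℕ.<_) (sym ωt) (s≤s z≤n)) (x ℕ.+ n ∸ suc t)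
        -- F cannot stay above F(t), since the end of the period is at least as low.
        ... | inj₂ covered = ⊥-elim (≺⇒≱ (covered (x ℕ.+ n) t< (ℕ.≤-reflexive (sym (ℕ.m∸n+n≡m t<)))) (end-low t x≤t t≤))
        ... | inj₁ (e , t≤e , e< , e-north , return , covered) = finish (continue (suc e) (s≤s t≤e) e<x+n
                (Lowest-jump t e t≤e low return covered))
          where
          e<x+n : e ℕ.< x ℕ.+ n
          e<x+n = subst (e ℕ.<_) (ℕ.m∸n+n≡m t<) e<
          raise : D t ≺ D (suc e)
          raise = D-block t-east e-north (subst (0 ℕ.<_) (sym ωt) (s≤s z≤n)) t≤e (ℕ.≤-trans e<x+n (ℕ.+-monoˡ-≤ n x≤t)) return covered
          finish : Outcome (suc e) → Outcome t
          finish (inj₁ p)       = inj₁ (ℤ.≤-trans raise (≺⇒≤ p))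
          finish (inj₂ (p , _)) = inj₁ (ℤ.≤-trans raise p)

    D-shift : ∀ t → D (t ℕ.+ n) ≡ D t ℤ.+ D n
    D-shift = pre-shift n λ i → cong₂ (dδ d₁ d₂) (st-per i) (ω-per i)

    D-positive-falling : F ω n ℤ.≤ 0ℤ → (∃ λ i → ω i ≢ 0) → 0ℤ ≺ D n
    D-positive-falling F≤0 (i , ωi≢0) with last-minimum ω ω-per n
    -- The walk starts one period after a minimum of F on [0,n]: the position is still lowest
    -- because F does not rise over a period, and now a full period lies before it.
    ... | a , a≤n , min , _ = finish (walk x n≤x end-low n x (ℕ.≤-reflexive (ℕ.+-comm x n)) ℕ.≤-refl (ℕ.m≤m+n x n) low)
      where
      x = a ℕ.+ n
      n≤x : n ℕ.≤ x
      n≤x = ℕ.m≤n+m n a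
      low : Lowest x
      low y y≤ with y ℕ.≤? n
      ... | yes y≤n = ℤ.≤-trans (shift-≤ ω ω-per F≤0 a) (min y y≤n)
      ... | no y≰n  = subst (λ y → F ω x ℤ.≤ F ω y) (ℕ.m∸n+n≡m n≤y) (F-shift-≤ ω ω-per a (y ∸ n) (min (y ∸ n)
                        (ℕ.≤-trans (ℕ.+-cancelʳ-≤ n (y ∸ n) a (ℕ.≤-trans (ℕ.≤-reflexive (ℕ.m∸n+n≡m n≤y)) y≤)) a≤n)))
        where n≤y = ℕ.<⇒≤ (ℕ.≰⇒> y≰n)
      end-low : ∀ t → x ℕ.≤ t → t ℕ.≤ x ℕ.+ n → F ω (x ℕ.+ n) ℤ.≤ F ω t
      end-low t x≤t t≤ = subst (λ t → F ω (x ℕ.+ n) ℤ.≤ F ω t) (ℕ.m∸n+n≡m n≤t) (F-shift-≤ ω ω-per x (t ∸ n) (low (t ∸ n)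
          (ℕ.+-cancelʳ-≤ n (t ∸ n) x (ℕ.≤-trans (ℕ.≤-reflexive (ℕ.m∸n+n≡m n≤t)) t≤))))
        where n≤t = ℕ.≤-trans n≤x x≤t
      finish : Outcome x n≤x end-low x → 0ℤ ≺ D n
      finish (inj₁ p)          = ≤-from (subst (D x ≺_) (D-shift x) p) (cancel (D x) (D n))
        where
        cancel : ∀ a b → a ℤ.+ b ℤ.- (1ℤ ℤ.+ a) ≡ b ℤ.- (1ℤ ℤ.+ 0ℤ)
        cancel = solve-∀
      finish (inj₂ (_ , idle)) = ⊥-elim (ωi≢0 (idle-period⇒idle x idle i))

    -- After the last minimum u on [0,n], F stays above F(u) for a whole period, being higher by
    -- F(n) in the part beyond n. So the edge at u is horizontal with positive weight, and K rises
    -- over the period. As h has period n, D(n) is at least d₁, which is positive since a horizontal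
    -- edge exists.
    D-positive-rising : 0ℤ ≺ F ω n → 0ℤ ≺ D n
    D-positive-rising 0≺F with last-minimum ω ω-per n
    ... | u , u≤n , min , covered = go (st u) refl (ω u) refl
      where
      u≢n : u ≢ n
      u≢n refl = ≺⇒≱ 0≺F (min 0 z≤n)
      u<n : u ℕ.< n
      u<n = ℕ.≤∧≢⇒< u≤n u≢n
      v = u ℕ.+ ℕ.pred n
      1+v : suc v ≡ u ℕ.+ n
      1+v = trans (sym (ℕ.+-suc u (ℕ.pred n))) (cong (λ z → u ℕ.+ z) (ℕ.suc-pred n {{ℕ.>-nonZero 0<n}}))
      covered′ : Covered ω u v
      covered′ t u<t t≤v with t ℕ.≤? n
      ... | yes t≤n = covered t u<t t≤n
      ... | no t≰n = subst (F ω u ≺_) (trans (sym (F-shift ω ω-per (t ∸ n))) (cong (F ω) (ℕ.m∸n+n≡m n≤t)))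
                       (≤-from₂ (min (t ∸ n) t-n≤n) 0≺F (rearrange (F ω u) (F ω (t ∸ n)) (F ω n)))
        where
        n≤t = ℕ.<⇒≤ (ℕ.≰⇒> t≰n)
        t-n≤n : t ∸ n ℕ.≤ n
        t-n≤n = ℕ.≤-trans (ℕ.+-cancelʳ-≤ n (t ∸ n) u (ℕ.≤-trans (ℕ.≤-reflexive (ℕ.m∸n+n≡m n≤t))
          (ℕ.≤-trans t≤v (ℕ.≤-trans (ℕ.n≤1+n v) (ℕ.≤-reflexive 1+v))))) u≤n
        rearrange : ∀ a b c → b ℤ.- a ℤ.+ (c ℤ.- (1ℤ ℤ.+ 0ℤ)) ≡ b ℤ.+ c ℤ.- (1ℤ ℤ.+ a)
        rearrange = solve-∀
      first : F ω u ≺ F ω (suc u)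
      first = covered (suc u) ℕ.≤-refl u<n
      go : ∀ s → st u ≡ s → ∀ m → ω u ≡ m → 0ℤ ≺ D n
      go north u-north _ _ = ⊥-elim (≺⇒≱ first (subst (ℤ._≤ F ω u) (sym (F-north ω u u-north)) (pred-≤ (F ω u))))
      go east u-east zero ωu = ⊥-elim (≺⇒≱ first (ℤ.≤-reflexive (trans (F-east ω u u-east)
          (trans (cong (λ k → F ω u ℤ.+ + k) ωu) (ℤ.+-identityʳ (F ω u))))))
      go east u-east (suc m) ωu = subst (0ℤ ≺_) (sym (D-h n))
        (≤-from₂ (ℤ.+-mono-≤ 1≤d₁ (ℤ.*-monoˡ-≤-nonNeg (+ d₁) 0≺F)) (ℤ.*-monoˡ-≤-nonNeg (+ d₂) 0≺K)
          (trans (rearrange (+ d₁) (+ d₂) (F ω n) (K ω n)) (cong (λ z → + d₁ ℤ.* F ω n ℤ.+ + d₂ ℤ.* K ω n ℤ.- z ℤ.- (1ℤ ℤ.+ 0ℤ)) (sym h-period))))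
        where
        K-rise : K ω u ≺ K ω (u ℕ.+ n)
        K-rise = subst (λ t → K ω u ≺ K ω t) 1+v (covered⇒K-rises ω ω-per compat u-east covered′
          (ℕ.≤-reflexive 1+v) (subst (0 ℕ.<_) (sym ωu) (s≤s z≤n)) (ℕ.m≤m+n u _))
        0≺K : 0ℤ ℤ.≤ K ω n
        0≺K = ≺⇒≤ (≤-from (subst (K ω u ≺_) (K-shift ω ω-per u) K-rise) (cancel (K ω u) (K ω n)))
          where
          cancel : ∀ a b → a ℤ.+ b ℤ.- (1ℤ ℤ.+ a) ≡ b ℤ.- (1ℤ ℤ.+ 0ℤ)
          cancel = solve-∀
        1≤d₁ : 1ℤ ℤ.≤ + d₁
        1≤d₁ = ≤-from₂ (h-east u u-east) (h-≥0 u) (cancel (+ d₁) (h u))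
          where
          cancel : ∀ d h → d ℤ.- (1ℤ ℤ.+ h) ℤ.+ (h ℤ.- 0ℤ) ≡ d ℤ.- 1ℤ
          cancel = solve-∀
        rearrange : ∀ a b f k → a ℤ.+ a ℤ.* f ℤ.- (1ℤ ℤ.+ a ℤ.* (1ℤ ℤ.+ 0ℤ)) ℤ.+ (b ℤ.* k ℤ.- b ℤ.* 0ℤ) ≡
                                a ℤ.* f ℤ.+ b ℤ.* k ℤ.- 0ℤ ℤ.- (1ℤ ℤ.+ 0ℤ)
        rearrange = solve-∀

    D-positive : (∃ λ i → ω i ≢ 0) → 0ℤ ≺ D n
    D-positive nonzero with F ω n ℤ.≤? 0ℤ
    ... | yes F≤0 = D-positive-falling F≤0 nonzero
    ... | no F≰0  = D-positive-rising (≰⇒≺ F≰0)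

-- Reflection, exchanging horizontal and vertical edges

flipStep : Step → Step
flipStep east  = north
flipStep north = east

flipStep-involutive : ∀ s → flipStep (flipStep s) ≡ s
flipStep-involutive east  = refl
flipStep-involutive north = refl

suc-∸ : ∀ {b m} → b ℕ.< m → suc (m ∸ suc b) ≡ m ∸ b
suc-∸ {b} {m} b<m = sym (ℕ.+-∸-assoc 1 b<m)

pre-mirror : ∀ {f f′} m → (∀ i → i ℕ.< m → f′ i ≡ ℤ.- f (m ∸ suc i)) →
             ∀ b → b ℕ.≤ m → pre f′ b ≡ pre f (m ∸ b) ℤ.- pre f m
pre-mirror {f} m eq zero    _   = sym (ℤ.+-inverseʳ (pre f m))
pre-mirror {f} m eq (suc b) b<m = trans (cong₂ ℤ._+_
    (trans (pre-mirror m eq b (ℕ.<⇒≤ b<m)) (cong (λ t → pre f t ℤ.- pre f m) (sym (suc-∸ b<m)))) (eq b b<m))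
  (cancel (pre f (m ∸ suc b)) (f (m ∸ suc b)) (pre f m))
  where
  cancel : ∀ a b c → a ℤ.+ b ℤ.- c ℤ.+ ℤ.- b ≡ a ℤ.- c
  cancel = solve-∀

∸-suc-< : ∀ {i m} → i ℕ.< m → m ∸ suc i ℕ.< m
∸-suc-< {i} {m} i<m = subst (ℕ._≤ m) (sym (suc-∸ i<m)) (ℕ.m∸n≤m m i)

∸-suc-involutive : ∀ {i m} → i ℕ.< m → m ∸ suc (m ∸ suc i) ≡ i
∸-suc-involutive {i} {m} i<m = trans (cong (m ∸_) (suc-∸ i<m)) (ℕ.m∸[m∸n]≡n (ℕ.<⇒≤ i<m))

module _ (n : ℕ) (0<n : 0 ℕ.< n) where

  -- Reflecting twice restores the word and its weights only pointwise.
  Compat-cong : ∀ {st st′ ω ω′} per per′ → (∀ i → st i ≡ st′ i) → (∀ i → ω i ≡ ω′ i) →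
                Cyclic.Compat n 0<n st per ω → Cyclic.Compat n 0<n st′ per′ ω′
  Compat-cong {st} {st′} {ω} {ω′} per per′ st≗ ω≗ compat u v u≤v v<u+n u-east v-north 0<u 0<v =
    convert (compat u v u≤v v<u+n (trans (st≗ u) u-east) (trans (st≗ v) v-north)
      (subst (0 ℕ.<_) (sym (ω≗ u)) 0<u) (subst (0 ℕ.<_) (sym (ω≗ v)) 0<v))
    where
    module A = Cyclic n 0<n st per
    module B = Cyclic n 0<n st′ per′
    F≗ : ∀ t → A.F ω t ≡ B.F ω′ t
    F≗ = pre-cong λ i → cong₂ fδ (st≗ i) (ω≗ i)
    K≗ : ∀ t → A.K ω t ≡ B.K ω′ t
    K≗ = pre-cong λ i → cong₂ kδ (st≗ i) (ω≗ i)
    convert : A.Good ω u v → B.Good ω′ u v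
    convert (inj₁ (e , u≤e , e<v , e-north , hit)) =
      inj₁ (e , u≤e , e<v , trans (sym (st≗ e)) e-north , trans (sym (F≗ (suc e))) (trans hit (F≗ u)))
    convert (inj₂ (e , u<e , e≤v , e-east , hit)) =
      inj₂ (e , u<e , e≤v , trans (sym (st≗ e)) e-east , trans (sym (K≗ e)) (trans hit (K≗ (suc v))))

module Mirror (n : ℕ) {{nz : NonZero n}} where

  0<n : 0 ℕ.< n
  0<n = ℕ.>-nonZero⁻¹ n

  reflect : ℕ → ℕ
  reflect i = n ∸ suc (i % n)

  reflect-per : ∀ i → reflect (i ℕ.+ n) ≡ reflect i
  reflect-per i = cong (λ z → n ∸ suc z) ([m+n]%n≡m%n i n)

  reflect-< : ∀ {i} → i ℕ.< n → reflect i ≡ n ∸ suc i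
  reflect-< i<n = cong (λ z → n ∸ suc z) (m<n⇒m%n≡m i<n)

  module _ {a} {A : Set a} (f : ℕ → A) (f-per : ∀ i → f (i ℕ.+ n) ≡ f i) where

    f∘% : ∀ i → f (i % n) ≡ f i
    f∘% = periodic-induction (λ i → f (i % n) ≡ f i) 0<n (λ i i<n → cong f (m<n⇒m%n≡m i<n))
      λ i eq → trans (cong f ([m+n]%n≡m%n i n)) (trans eq (sym (f-per i)))

    reflect-reflect : ∀ i → f (reflect (reflect i)) ≡ f i
    reflect-reflect i = trans (cong f (trans (reflect-< (∸-suc-< (m%n<n i n))) (∸-suc-involutive (m%n<n i n)))) (f∘% i)

    -- An arc that starts in the first period may end in the second, so reflection is needed on two
    -- periods at once, where it reads i ↦ 2n - 1 - i.
    reflect-2n : ∀ {i} → i ℕ.< n ℕ.+ n → f (reflect i) ≡ f (n ℕ.+ n ∸ suc i)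
    reflect-2n {i} i<2n with i ℕ.<? n
    ... | yes i<n = trans (cong f (reflect-< i<n)) (trans (sym (f-per (n ∸ suc i)))
                      (cong f (sym (ℕ.+-∸-comm n i<n))))
    ... | no i≮n = cong f (begin
        n ∸ suc (i % n)          ≡⟨ cong (λ z → n ∸ suc (z % n)) (sym i≡) ⟩
        n ∸ suc ((j ℕ.+ n) % n)  ≡⟨ reflect-per j ⟩
        n ∸ suc (j % n)          ≡⟨ reflect-< j<n ⟩
        n ∸ suc j                ≡⟨ ℕ.[m+n]∸[m+o]≡n∸o n n (suc j) ⟨
        n ℕ.+ n ∸ (n ℕ.+ suc j)  ≡⟨ cong (n ℕ.+ n ∸_) (trans (ℕ.+-suc n j) (cong suc (trans (ℕ.+-comm n j) i≡))) ⟩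
        n ℕ.+ n ∸ suc i          ∎)
      where
      open ≡-Reasoning
      j = i ∸ n
      i≡ : j ℕ.+ n ≡ i
      i≡ = ℕ.m∸n+n≡m (ℕ.≮⇒≥ i≮n)
      j<n : j ℕ.< n
      j<n = ℕ.+-cancelʳ-< n j n (subst (ℕ._< n ℕ.+ n) (sym i≡) i<2n)

  module _ (st : ℕ → Step) (st-per : ∀ i → st (i ℕ.+ n) ≡ st i) where

    mirror : ℕ → Step
    mirror i = flipStep (st (reflect i))

    mirror-per : ∀ i → mirror (i ℕ.+ n) ≡ mirror i
    mirror-per i = cong (flipStep ∘ st) (reflect-per i)

    mirror-2n : ∀ {i} → i ℕ.< n ℕ.+ n → mirror i ≡ flipStep (st (n ℕ.+ n ∸ suc i))
    mirror-2n i< = cong flipStep (reflect-2n st st-per i<)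

    private
      module S = Cyclic n 0<n st st-per
      module M = Cyclic n 0<n mirror mirror-per

    module _ (ω : ℕ → ℕ) (ω-per : ∀ i → ω (i ℕ.+ n) ≡ ω i) where

      -- Exchanging the edge types turns increments of F into negated increments of K, and reversal
      -- undoes the sign. The additive constant is harmless, as compatibility only compares two
      -- values.
      F-mirror : ∀ b → b ℕ.≤ n ℕ.+ n → M.F (ω ∘ reflect) b ≡ S.K ω (n ℕ.+ n ∸ b) ℤ.- S.K ω (n ℕ.+ n)
      F-mirror = pre-mirror (n ℕ.+ n) λ i i< → trans (cong₂ fδ (mirror-2n i<) (reflect-2n ω ω-per i<)) (flipped (st _) (ω _))
        where
        flipped : ∀ s k → fδ (flipStep s) k ≡ ℤ.- kδ s k
        flipped east  k = refl
        flipped north k = sym (ℤ.neg-involutive (+ k))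

      K-mirror : ∀ b → b ℕ.≤ n ℕ.+ n → M.K (ω ∘ reflect) b ≡ S.F ω (n ℕ.+ n ∸ b) ℤ.- S.F ω (n ℕ.+ n)
      K-mirror = pre-mirror (n ℕ.+ n) λ i i< → trans (cong₂ kδ (mirror-2n i<) (reflect-2n ω ω-per i<)) (flipped (st _) (ω _))
        where
        flipped : ∀ s k → kδ (flipStep s) k ≡ ℤ.- fδ s k
        flipped east  k = refl
        flipped north k = refl

      D-mirror : ∀ d₁ d₂ b → b ℕ.≤ n ℕ.+ n →
        pre (λ i → dδ d₂ d₁ (mirror i) (ω (reflect i))) b ≡
        pre (λ i → dδ d₁ d₂ (st i) (ω i)) (n ℕ.+ n ∸ b) ℤ.- pre (λ i → dδ d₁ d₂ (st i) (ω i)) (n ℕ.+ n)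
      D-mirror d₁ d₂ = pre-mirror (n ℕ.+ n) λ i i< →
          trans (cong₂ (dδ d₂ d₁) (mirror-2n i<) (reflect-2n ω ω-per i<)) (flipped (st _) (ω _))
        where
        flipped : ∀ s k → dδ d₂ d₁ (flipStep s) k ≡ ℤ.- dδ d₁ d₂ s k
        flipped east  k = refl
        flipped north k = sym (ℤ.neg-involutive (+ d₂ ℤ.* + k))

      -- The two alternatives change places. Edge i goes to 2n - 1 - i but the position before it to
      -- 2n - i, the position after its image; this accounts for the exchange of F(suc e) and F(u)
      -- with K(e) and K(suc v).
      compat-mirror : S.Compat ω → M.Compat (ω ∘ reflect)
      compat-mirror compat = M.compat-reduce (ω ∘ reflect) (λ i → cong ω (reflect-per i)) at
        where
        at : ∀ u v → u ℕ.< n → M.CompatibleAt (ω ∘ reflect) u v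
        at u v u<n u≤v v<u+n u-east v-north 0<u 0<v =
          convert (compat u′ v′ (ℕ.∸-monoʳ-≤ N (s≤s u≤v)) v′<u′+n
            (flip-north u′ (trans (sym (mirror-2n v<2n)) v-north)) (flip-east v′ (trans (sym (mirror-2n u<2n)) u-east))
            (subst (0 ℕ.<_) (reflect-2n ω ω-per v<2n) 0<v) (subst (0 ℕ.<_) (reflect-2n ω ω-per u<2n) 0<u))
          where
          N = n ℕ.+ n
          v<2n : v ℕ.< N
          v<2n = ℕ.<-trans v<u+n (ℕ.+-monoˡ-< n u<n)
          u<2n : u ℕ.< N
          u<2n = ℕ.≤-<-trans u≤v v<2n
          u′ = N ∸ suc v
          v′ = N ∸ suc u
          flip-north : ∀ i → flipStep (st i) ≡ north → st i ≡ east
          flip-north i eq = trans (sym (flipStep-involutive (st i))) (cong flipStep eq)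
          flip-east : ∀ i → flipStep (st i) ≡ east → st i ≡ north
          flip-east i eq = trans (sym (flipStep-involutive (st i))) (cong flipStep eq)
          v′<u′+n : v′ ℕ.< u′ ℕ.+ n
          v′<u′+n = subst₂ ℕ._<_ refl (ℕ.+-∸-comm n v<2n) (ℕ.+-cancelʳ-< (suc u) v′ (N ℕ.+ n ∸ suc v) (begin-strict
            v′ ℕ.+ suc u                           ≡⟨ ℕ.m∸n+n≡m u<2n ⟩
            N                                      ≡⟨ ℕ.m+n∸n≡m N (suc v) ⟨
            N ℕ.+ suc v ∸ suc v                    <⟨ ℕ.∸-monoˡ-< (ℕ.+-monoʳ-< N (s≤s v<u+n)) (ℕ.m≤n+m (suc v) N) ⟩
            N ℕ.+ suc (u ℕ.+ n) ∸ suc v            ≡⟨ cong (_∸ suc v) (rearrange N u n) ⟩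
            (N ℕ.+ n) ℕ.+ suc u ∸ suc v            ≡⟨ ℕ.+-∸-comm (suc u) (ℕ.≤-trans v<2n (ℕ.m≤m+n N n)) ⟩
            N ℕ.+ n ∸ suc v ℕ.+ suc u              ∎))
            where
            open ℕ.≤-Reasoning
            rearrange : ∀ N u n → N ℕ.+ suc (u ℕ.+ n) ≡ N ℕ.+ n ℕ.+ suc u
            rearrange N u n = trans (cong (λ z → N ℕ.+ z) (trans (cong suc (ℕ.+-comm u n)) (sym (ℕ.+-suc n u)))) (sym (ℕ.+-assoc N n (suc u)))
          convert : S.Good ω u′ v′ → M.Good (ω ∘ reflect) u v
          convert (inj₁ (e , u′≤e , e<v′ , e-north , hit)) = inj₂ (e′ , u<e′ , e′≤v ,
              trans (mirror-2n e′<2n) (cong flipStep (trans (cong st e″) e-north)) ,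
              trans (K-mirror e′ (ℕ.<⇒≤ e′<2n)) (trans (cong (ℤ._- S.F ω N) (trans (cong (S.F ω) (trans (sym (suc-∸ e′<2n)) (cong suc e″))) hit))
                (sym (K-mirror (suc v) v<2n))))
            where
            e<2n : e ℕ.< N
            e<2n = ℕ.<-trans e<v′ (∸-suc-< u<2n)
            e′ = N ∸ suc e
            e′<2n = ∸-suc-< e<2n
            e″ : N ∸ suc e′ ≡ e
            e″ = ∸-suc-involutive e<2n
            u<e′ : u ℕ.< e′
            u<e′ = subst (ℕ._< e′) (∸-suc-involutive u<2n) (ℕ.∸-monoʳ-< (s≤s e<v′) (∸-suc-< u<2n))
            e′≤v : e′ ℕ.≤ v
            e′≤v = subst (e′ ℕ.≤_) (∸-suc-involutive v<2n) (ℕ.∸-monoʳ-≤ N (s≤s u′≤e))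
          convert (inj₂ (e , u′<e , e≤v′ , e-east , hit)) = inj₁ (e′ , u≤e′ , e′<v ,
              trans (mirror-2n e′<2n) (cong flipStep (trans (cong st e″) e-east)) ,
              trans (F-mirror (suc e′) e′<2n) (trans (cong (ℤ._- S.K ω N) (trans (cong (S.K ω) e″) (trans hit (cong (S.K ω) (suc-∸ u<2n)))))
                (sym (F-mirror u (ℕ.<⇒≤ u<2n)))))
            where
            e<2n : e ℕ.< N
            e<2n = ℕ.≤-<-trans e≤v′ (∸-suc-< u<2n)
            e′ = N ∸ suc e
            e′<2n = ∸-suc-< e<2n
            e″ : N ∸ suc e′ ≡ e
            e″ = ∸-suc-involutive e<2n
            u≤e′ : u ℕ.≤ e′
            u≤e′ = subst (ℕ._≤ e′) (∸-suc-involutive u<2n) (ℕ.∸-monoʳ-≤ N (s≤s e≤v′))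
            e′<v : e′ ℕ.< v
            e′<v = subst (e′ ℕ.<_) (∸-suc-involutive v<2n) (ℕ.∸-monoʳ-< (s≤s u′<e) e<2n)

    -- As h vanishes at multiples of the period, its reflection is h read backwards; the bounds
    -- before horizontal and after vertical edges are thereby exchanged.
    bounds-mirror : ∀ {d₁ d₂} → Bounds d₁ d₂ n st → Bounds d₂ d₁ n mirror
    bounds-mirror {d₁} {d₂} b = record
      { h-period = trans (h-mirror n (ℕ.m≤m+n n n)) (trans (cong h (ℕ.m+n∸n≡m n n)) h-period)
      ; h-≥0     = periodic-induction (λ t → 0ℤ ℤ.≤ h′ t) 0<n
                     (λ t t<n → subst (0ℤ ℤ.≤_) (sym (h-mirror t (<⇒≤2n t<n))) (h-≥0 (n ℕ.+ n ∸ t)))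
                     λ t → subst (0ℤ ℤ.≤_) (sym (h′-shift t))
      ; h-east   = periodic-induction (λ t → mirror t ≡ east → h′ t ≺ + d₂) 0<n
                     (λ t t<n t-east → subst (_≺ + d₂) (trans (cong h (suc-∸ (<⇒<2n t<n))) (sym (h-mirror t (<⇒≤2n t<n))))
                       (h-north (n ℕ.+ n ∸ suc t) (trans (sym (flipStep-involutive _))
                         (cong flipStep (trans (sym (mirror-2n (<⇒<2n t<n))) t-east)))))
                     λ t IH t-east → subst (_≺ + d₂) (sym (h′-shift t)) (IH (trans (sym (mirror-per t)) t-east))
      ; h-north  = periodic-induction (λ t → mirror t ≡ north → h′ (suc t) ≺ + d₁) 0<n
                     (λ t t<n t-north → subst (_≺ + d₁) (sym (h-mirror (suc t) (<⇒<2n t<n)))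
                       (h-east (n ℕ.+ n ∸ suc t) (trans (sym (flipStep-involutive _))
                         (cong flipStep (trans (sym (mirror-2n (<⇒<2n t<n))) t-north)))))
                     λ t IH t-north → subst (_≺ + d₁) (sym (h′-shift (suc t))) (IH (trans (sym (mirror-per t)) t-north)) }
      where
      open Bounds b
      <⇒<2n : ∀ {t} → t ℕ.< n → t ℕ.< n ℕ.+ n
      <⇒<2n t<n = ℕ.<-≤-trans t<n (ℕ.m≤m+n n n)
      <⇒≤2n : ∀ {t} → t ℕ.< n → t ℕ.≤ n ℕ.+ n
      <⇒≤2n t<n = ℕ.<⇒≤ (<⇒<2n t<n)
      h′ : ℕ → ℤ
      h′ = pre λ i → hδ d₂ d₁ (mirror i)
      h-2n : h (n ℕ.+ n) ≡ 0ℤ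
      h-2n = trans (pre-shift n (λ i → cong (hδ d₁ d₂) (st-per i)) n) (cong₂ ℤ._+_ h-period h-period)
      h-mirror : ∀ t → t ℕ.≤ n ℕ.+ n → h′ t ≡ h (n ℕ.+ n ∸ t)
      h-mirror t t≤ = trans (pre-mirror (n ℕ.+ n) (λ i i< → trans (cong (hδ d₂ d₁) (mirror-2n i<)) (flipped (st _))) t t≤)
        (trans (cong (λ z → h (n ℕ.+ n ∸ t) ℤ.- z) h-2n) (ℤ.+-identityʳ _))
        where
        flipped : ∀ s → hδ d₂ d₁ (flipStep s) ≡ ℤ.- hδ d₁ d₂ s
        flipped east  = refl
        flipped north = sym (ℤ.neg-involutive (+ d₁))
      h′-shift : ∀ t → h′ (t ℕ.+ n) ≡ h′ t
      h′-shift t = trans (pre-shift n (λ i → cong (hδ d₂ d₁) (mirror-per i)) t)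
        (trans (cong (λ z → h′ t ℤ.+ z) (trans (h-mirror n (ℕ.m≤m+n n n)) (trans (cong h (ℕ.m+n∸n≡m n n)) h-period)))
          (ℤ.+-identityʳ (h′ t)))

-- Lattice paths as cyclic words

pre-head : ∀ h m → pre h (suc m) ≡ h 0 ℤ.+ pre (h ∘ suc) m
pre-head h zero    = trans (ℤ.+-identityˡ (h 0)) (sym (ℤ.+-identityʳ (h 0)))
pre-head h (suc m) = trans (cong (ℤ._+ h (suc m)) (pre-head h m)) (ℤ.+-assoc (h 0) _ _)

pre-+ : ∀ f g t → pre (λ i → f i ℤ.+ g i) t ≡ pre f t ℤ.+ pre g t
pre-+ f g zero    = refl
pre-+ f g (suc t) = trans (cong (ℤ._+ (f t ℤ.+ g t)) (pre-+ f g t)) (eq (pre f t) (pre g t) (f t) (g t))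
  where
  eq : ∀ a b c d → a ℤ.+ b ℤ.+ (c ℤ.+ d) ≡ a ℤ.+ c ℤ.+ (b ℤ.+ d)
  eq = solve-∀

pre-minus : ∀ f g t → pre (λ i → f i ℤ.- g i) t ≡ pre f t ℤ.- pre g t
pre-minus f g zero    = refl
pre-minus f g (suc t) = trans (cong (ℤ._+ (f t ℤ.- g t)) (pre-minus f g t)) (eq (pre f t) (pre g t) (f t) (g t))
  where
  eq : ∀ a b c d → a ℤ.- b ℤ.+ (c ℤ.- d) ≡ a ℤ.+ c ℤ.- (b ℤ.+ d)
  eq = solve-∀

truncate : ℕ → (ℕ → ℤ) → ℕ → ℤ
truncate a y i = if does (i ℕ.<? a) then y i else 0ℤ

truncate-< : ∀ {a i} y → i ℕ.< a → truncate a y i ≡ y i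
truncate-< {a} {i} y i<a = cong (if_then y i else 0ℤ) (dec-true (i ℕ.<? a) i<a)

truncate-≥ : ∀ {a i} y → a ℕ.≤ i → truncate a y i ≡ 0ℤ
truncate-≥ {a} {i} y a≤i = cong (if_then y i else 0ℤ) (dec-false (i ℕ.<? a) (ℕ.≤⇒≯ a≤i))

pre-truncate-≤ : ∀ a y t → t ℕ.≤ a → pre (truncate a y) t ≡ pre y t
pre-truncate-≤ a y zero    _   = refl
pre-truncate-≤ a y (suc t) t<a = cong₂ ℤ._+_ (pre-truncate-≤ a y t (ℕ.<⇒≤ t<a)) (truncate-< y t<a)

pre-truncate-+ : ∀ {a} y k → pre (truncate a y) (k ℕ.+ a) ≡ pre y a
pre-truncate-+ {a} y zero    = pre-truncate-≤ a y a ℕ.≤-refl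
pre-truncate-+ {a} y (suc k) = trans (cong₂ ℤ._+_ (pre-truncate-+ y k) (truncate-≥ y (ℕ.m≤n+m a k))) (ℤ.+-identityʳ _)

pre-truncate : ∀ {a n} y → a ℕ.≤ n → pre (truncate a y) n ≡ pre y a
pre-truncate {a} {n} y a≤n = trans (cong (pre (truncate a y)) (sym (ℕ.m∸n+n≡m a≤n))) (pre-truncate-+ y (n ∸ a))

letters : (w : Path) → Vec Step (length w)
letters = fromList

-- Turns the change of F along a set of edges into the two numbers that the first alternative in
-- `Witness` compares.
balance-F : ∀ w (ω : Grading w) (C : Subset (length w)) h →
  (∀ i → h (toℕ i) ≡ (if lookup C i then fδ (lookup (letters w) i) (lookup ω i) else 0ℤ)) →
  pre h (length w) ≡ + (ω ⟨ C ∩ horizontal w ⟩) ℤ.- + ∣ C ∩ vertical w ∣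
balance-F []      []      []      h eq = refl
balance-F (x ∷ w) (k ∷ ω) (b ∷ C) h eq = trans (pre-head h (length w))
  (trans (cong₂ ℤ._+_ (eq Fin.zero) (balance-F w ω C (h ∘ suc) (eq ∘ Fin.suc))) (step b x))
  where
  A = + (ω ⟨ C ∩ horizontal w ⟩)
  B = + ∣ C ∩ vertical w ∣
  east-eq : ∀ k a b → k ℤ.+ (a ℤ.- b) ≡ (k ℤ.+ a) ℤ.- b
  east-eq = solve-∀
  north-eq : ∀ a b → -1ℤ ℤ.+ (a ℤ.- b) ≡ a ℤ.- (1ℤ ℤ.+ b)
  north-eq = solve-∀
  step : ∀ b x → (if b then fδ x k else 0ℤ) ℤ.+ (A ℤ.- B) ≡
    + ((k ∷ ω) ⟨ (b ∷ C) ∩ horizontal (x ∷ w) ⟩) ℤ.- + ∣ (b ∷ C) ∩ vertical (x ∷ w) ∣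
  step true  east  = east-eq (+ k) A B
  step true  north = north-eq A B
  step false east  = ℤ.+-identityˡ (A ℤ.- B)
  step false north = ℤ.+-identityˡ (A ℤ.- B)

balance-K : ∀ w (ω : Grading w) (C : Subset (length w)) h →
  (∀ i → h (toℕ i) ≡ (if lookup C i then kδ (lookup (letters w) i) (lookup ω i) else 0ℤ)) →
  pre h (length w) ≡ + ∣ C ∩ horizontal w ∣ ℤ.- + (ω ⟨ C ∩ vertical w ⟩)
balance-K []      []      []      h eq = refl
balance-K (x ∷ w) (k ∷ ω) (b ∷ C) h eq = trans (pre-head h (length w))
  (trans (cong₂ ℤ._+_ (eq Fin.zero) (balance-K w ω C (h ∘ suc) (eq ∘ Fin.suc))) (step b x))
  where
  A = + ∣ C ∩ horizontal w ∣
  B = + (ω ⟨ C ∩ vertical w ⟩)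
  east-eq : ∀ a b → 1ℤ ℤ.+ (a ℤ.- b) ≡ (1ℤ ℤ.+ a) ℤ.- b
  east-eq = solve-∀
  north-eq : ∀ k a b → ℤ.- k ℤ.+ (a ℤ.- b) ≡ a ℤ.- (k ℤ.+ b)
  north-eq = solve-∀
  step : ∀ b x → (if b then kδ x k else 0ℤ) ℤ.+ (A ℤ.- B) ≡
    + ∣ (b ∷ C) ∩ horizontal (x ∷ w) ∣ ℤ.- + ((k ∷ ω) ⟨ (b ∷ C) ∩ vertical (x ∷ w) ⟩)
  step true  east  = east-eq A B
  step true  north = north-eq (+ k) A B
  step false east  = ℤ.+-identityˡ (A ℤ.- B)
  step false north = ℤ.+-identityˡ (A ℤ.- B)

total-F : ∀ w (ω : Grading w) h → (∀ i → h (toℕ i) ≡ fδ (lookup (letters w) i) (lookup ω i)) →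
  pre h (length w) ≡ + (ω ⟨ horizontal w ⟩) ℤ.- + #north w
total-F []          []      h eq = refl
total-F (east  ∷ w) (k ∷ ω) h eq = trans (pre-head h (length w))
  (trans (cong₂ ℤ._+_ (eq Fin.zero) (total-F w ω (h ∘ suc) (eq ∘ Fin.suc))) (step (+ k) (+ (ω ⟨ horizontal w ⟩)) (+ #north w)))
  where
  step : ∀ k a b → k ℤ.+ (a ℤ.- b) ≡ (k ℤ.+ a) ℤ.- b
  step = solve-∀
total-F (north ∷ w) (k ∷ ω) h eq = trans (pre-head h (length w))
  (trans (cong₂ ℤ._+_ (eq Fin.zero) (total-F w ω (h ∘ suc) (eq ∘ Fin.suc))) (step (+ (ω ⟨ horizontal w ⟩)) (+ #north w)))
  where
  step : ∀ a b → -1ℤ ℤ.+ (a ℤ.- b) ≡ a ℤ.- (1ℤ ℤ.+ b)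
  step = solve-∀

total-K : ∀ w (ω : Grading w) h → (∀ i → h (toℕ i) ≡ kδ (lookup (letters w) i) (lookup ω i)) →
  pre h (length w) ≡ + #east w ℤ.- + (ω ⟨ vertical w ⟩)
total-K []          []      h eq = refl
total-K (east  ∷ w) (k ∷ ω) h eq = trans (pre-head h (length w))
  (trans (cong₂ ℤ._+_ (eq Fin.zero) (total-K w ω (h ∘ suc) (eq ∘ Fin.suc))) (step (+ #east w) (+ (ω ⟨ vertical w ⟩))))
  where
  step : ∀ a b → 1ℤ ℤ.+ (a ℤ.- b) ≡ (1ℤ ℤ.+ a) ℤ.- b
  step = solve-∀
total-K (north ∷ w) (k ∷ ω) h eq = trans (pre-head h (length w))
  (trans (cong₂ ℤ._+_ (eq Fin.zero) (total-K w ω (h ∘ suc) (eq ∘ Fin.suc))) (step (+ k) (+ #east w) (+ (ω ⟨ vertical w ⟩))))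
  where
  step : ∀ k a b → ℤ.- k ℤ.+ (a ℤ.- b) ≡ a ℤ.- (k ℤ.+ b)
  step = solve-∀

total-D : ∀ d₁ d₂ w (ω : Grading w) h → (∀ i → h (toℕ i) ≡ dδ d₁ d₂ (lookup (letters w) i) (lookup ω i)) →
  pre h (length w) ≡ + d₁ ℤ.* + (ω ⟨ horizontal w ⟩) ℤ.- + d₂ ℤ.* + (ω ⟨ vertical w ⟩)
total-D d₁ d₂ []          []      h eq = sym (cong₂ ℤ._-_ (ℤ.*-zeroʳ (+ d₁)) (ℤ.*-zeroʳ (+ d₂)))
total-D d₁ d₂ (east  ∷ w) (k ∷ ω) h eq = trans (pre-head h (length w))
  (trans (cong₂ ℤ._+_ (eq Fin.zero) (total-D d₁ d₂ w ω (h ∘ suc) (eq ∘ Fin.suc)))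
    (step (+ d₁) (+ d₂) (+ k) (+ (ω ⟨ horizontal w ⟩)) (+ (ω ⟨ vertical w ⟩))))
  where
  step : ∀ d e k a b → d ℤ.* k ℤ.+ (d ℤ.* a ℤ.- e ℤ.* b) ≡ d ℤ.* (k ℤ.+ a) ℤ.- e ℤ.* b
  step = solve-∀
total-D d₁ d₂ (north ∷ w) (k ∷ ω) h eq = trans (pre-head h (length w))
  (trans (cong₂ ℤ._+_ (eq Fin.zero) (total-D d₁ d₂ w ω (h ∘ suc) (eq ∘ Fin.suc)))
    (step (+ d₁) (+ d₂) (+ k) (+ (ω ⟨ horizontal w ⟩)) (+ (ω ⟨ vertical w ⟩))))
  where
  step : ∀ d e k a b → ℤ.- (e ℤ.* k) ℤ.+ (d ℤ.* a ℤ.- e ℤ.* b) ≡ d ℤ.* a ℤ.- e ℤ.* (k ℤ.+ b)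
  step = solve-∀

prefix-h : ∀ d₁ d₂ w h → (∀ i → h (toℕ i) ≡ hδ d₁ d₂ (lookup (letters w) i)) → ∀ t → t ℕ.≤ length w →
  pre h t ≡ + #east (take t w) ℤ.* + d₂ ℤ.- + #north (take t w) ℤ.* + d₁
prefix-h d₁ d₂ w           h eq zero    _        = refl
prefix-h d₁ d₂ (east ∷ w)  h eq (suc t) (s≤s t≤) = trans (pre-head h t)
  (trans (cong₂ ℤ._+_ (eq Fin.zero) (prefix-h d₁ d₂ w (h ∘ suc) (eq ∘ Fin.suc) t t≤))
    (step (+ d₁) (+ d₂) (+ #east (take t w)) (+ #north (take t w))))
  where
  step : ∀ d e a b → e ℤ.+ (a ℤ.* e ℤ.- b ℤ.* d) ≡ (1ℤ ℤ.+ a) ℤ.* e ℤ.- b ℤ.* d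
  step = solve-∀
prefix-h d₁ d₂ (north ∷ w) h eq (suc t) (s≤s t≤) = trans (pre-head h t)
  (trans (cong₂ ℤ._+_ (eq Fin.zero) (prefix-h d₁ d₂ w (h ∘ suc) (eq ∘ Fin.suc) t t≤))
    (step (+ d₁) (+ d₂) (+ #east (take t w)) (+ #north (take t w))))
  where
  step : ∀ d e a b → ℤ.- d ℤ.+ (a ℤ.* e ℤ.- b ℤ.* d) ≡ a ℤ.* e ℤ.- (1ℤ ℤ.+ b) ℤ.* d
  step = solve-∀

isEast-true : ∀ {s} → isEast s ≡ true → s ≡ east
isEast-true {east} _ = refl

not-isEast-true : ∀ {s} → not (isEast s) ≡ true → s ≡ north
not-isEast-true {north} _ = refl

-- Cyclic arcs as intervals

module Arcs (n : ℕ) where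

  -- The position e moved into the period that starts at u.
  lift : ℕ → ℕ → ℕ
  lift u e with u ℕ.≤? e
  ... | yes _ = e
  ... | no  _ = e ℕ.+ n

  lift-≤ : ∀ {u e} → u ℕ.≤ e → lift u e ≡ e
  lift-≤ {u} {e} u≤e with u ℕ.≤? e
  ... | yes _  = refl
  ... | no u≰e = ⊥-elim (u≰e u≤e)

  lift-> : ∀ {u e} → e ℕ.< u → lift u e ≡ e ℕ.+ n
  lift-> {u} {e} e<u with u ℕ.≤? e
  ... | yes u≤e = ⊥-elim (ℕ.<⇒≱ e<u u≤e)
  ... | no _    = refl

  module _ (y : ℕ → ℤ) (y-per : ∀ i → y (i ℕ.+ n) ≡ y i) where

    -- The arc is written as a combination of initial segments: up to e, minus those before u, plus
    -- a full period if e comes before u. Prefix sums then evaluate directly.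
    arcSum : Fin n → Fin n → ℕ → ℤ
    arcSum u e i with toℕ u ℕ.≤? toℕ e
    ... | yes _ = truncate (suc (toℕ e)) y i ℤ.- truncate (toℕ u) y i
    ... | no  _ = y i ℤ.+ truncate (suc (toℕ e)) y i ℤ.- truncate (toℕ u) y i

    arcSum-lookup : ∀ u e i → arcSum u e (toℕ i) ≡ (if lookup (arc u e) i then y (toℕ i) else 0ℤ)
    arcSum-lookup u e i = trans go (cong (if_then y (toℕ i) else 0ℤ) (sym (Vec.lookup∘tabulate (does ∘ between? u e) i)))
      where
      t = toℕ i
      y+0-0 : ∀ y → y ℤ.+ 0ℤ ℤ.- 0ℤ ≡ y
      y+0-0 = solve-∀
      y+y-y : ∀ y → y ℤ.+ y ℤ.- y ≡ y
      y+y-y = solve-∀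
      y+0-y : ∀ y → y ℤ.+ 0ℤ ℤ.- y ≡ 0ℤ
      y+0-y = solve-∀
      yes-case : ∀ {x} → Between u e i → x ≡ y t → x ≡ (if does (between? u e i) then y t else 0ℤ)
      yes-case b eq = trans eq (sym (cong (if_then y t else 0ℤ) (dec-true (between? u e i) b)))
      no-case : ∀ {x} → ¬ Between u e i → x ≡ 0ℤ → x ≡ (if does (between? u e i) then y t else 0ℤ)
      no-case b eq = trans eq (sym (cong (if_then y t else 0ℤ) (dec-false (between? u e i) b)))
      go : arcSum u e t ≡ (if does (between? u e i) then y t else 0ℤ)
      go with toℕ u ℕ.≤? toℕ e | toℕ u ℕ.≤? t | t ℕ.≤? toℕ e
      ... | yes u≤e | yes u≤t | yes t≤e = yes-case (inj₁ (u≤e , u≤t , t≤e))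
              (trans (cong₂ ℤ._-_ (truncate-< y (s≤s t≤e)) (truncate-≥ y u≤t)) (ℤ.+-identityʳ (y t)))
      ... | yes u≤e | yes u≤t | no t≰e = no-case (λ { (inj₁ (_ , _ , t≤e)) → t≰e t≤e ; (inj₂ (e<u , _)) → ℕ.<⇒≱ e<u u≤e })
              (cong₂ ℤ._-_ (truncate-≥ y (ℕ.≰⇒> t≰e)) (truncate-≥ y u≤t))
      ... | yes u≤e | no u≰t | _ = no-case (λ { (inj₁ (_ , u≤t , _)) → u≰t u≤t ; (inj₂ (e<u , _)) → ℕ.<⇒≱ e<u u≤e })
              (trans (cong₂ ℤ._-_ (truncate-< y (ℕ.<-≤-trans t<u (ℕ.m≤n⇒m≤1+n u≤e))) (truncate-< y t<u)) (ℤ.+-inverseʳ (y t)))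
        where t<u = ℕ.≰⇒> u≰t
      ... | no u≰e | yes u≤t | _ = yes-case (inj₂ (e<u , inj₁ u≤t))
              (trans (cong₂ (λ a b → y t ℤ.+ a ℤ.- b) (truncate-≥ y (ℕ.≤-trans e<u u≤t)) (truncate-≥ y u≤t)) (y+0-0 (y t)))
        where e<u = ℕ.≰⇒> u≰e
      ... | no u≰e | no u≰t | yes t≤e = yes-case (inj₂ (ℕ.≰⇒> u≰e , inj₂ t≤e))
              (trans (cong₂ (λ a b → y t ℤ.+ a ℤ.- b) (truncate-< y (s≤s t≤e)) (truncate-< y (ℕ.≰⇒> u≰t))) (y+y-y (y t)))
      ... | no u≰e | no u≰t | no t≰e = no-case
              (λ { (inj₁ (u≤e , _)) → u≰e u≤e ; (inj₂ (_ , inj₁ u≤t)) → u≰t u≤t ; (inj₂ (_ , inj₂ t≤e)) → t≰e t≤e })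
              (trans (cong₂ (λ a b → y t ℤ.+ a ℤ.- b) (truncate-≥ y (ℕ.≰⇒> t≰e)) (truncate-< y (ℕ.≰⇒> u≰t))) (y+0-y (y t)))

    pre-arcSum : ∀ u e → pre (arcSum u e) n ≡ pre y (suc (lift (toℕ u) (toℕ e))) ℤ.- pre y (toℕ u)
    pre-arcSum u e with toℕ u ℕ.≤? toℕ e
    ... | yes u≤e = trans (pre-minus (truncate (suc (toℕ e)) y) (truncate (toℕ u) y) n)
                      (cong₂ ℤ._-_ (pre-truncate y (Fin.toℕ<n e)) (pre-truncate y (ℕ.<⇒≤ (Fin.toℕ<n u))))
    ... | no u≰e = begin
      pre (λ i → y i ℤ.+ truncate (suc (toℕ e)) y i ℤ.- truncate (toℕ u) y i) n
        ≡⟨ pre-minus (λ i → y i ℤ.+ truncate (suc (toℕ e)) y i) (truncate (toℕ u) y) n ⟩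
      pre (λ i → y i ℤ.+ truncate (suc (toℕ e)) y i) n ℤ.- pre (truncate (toℕ u) y) n
        ≡⟨ cong₂ ℤ._-_ (pre-+ y (truncate (suc (toℕ e)) y) n) (pre-truncate y (ℕ.<⇒≤ (Fin.toℕ<n u))) ⟩
      pre y n ℤ.+ pre (truncate (suc (toℕ e)) y) n ℤ.- pre y (toℕ u)
        ≡⟨ cong (λ z → pre y n ℤ.+ z ℤ.- pre y (toℕ u)) (pre-truncate y (Fin.toℕ<n e)) ⟩
      pre y n ℤ.+ pre y (suc (toℕ e)) ℤ.- pre y (toℕ u)
        ≡⟨ cong (ℤ._- pre y (toℕ u)) (trans (ℤ.+-comm (pre y n) _) (sym (pre-shift n y-per (suc (toℕ e))))) ⟩
      pre y (suc (toℕ e ℕ.+ n)) ℤ.- pre y (toℕ u) ∎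
      where open ≡-Reasoning

  lift-injective : ∀ u e e′ → e ℕ.< n → e′ ℕ.< n → lift u e ≡ lift u e′ → e ≡ e′
  lift-injective u e e′ e<n e′<n eq with u ℕ.≤? e | u ℕ.≤? e′
  ... | yes _   | yes _   = eq
  ... | no _    | no _    = ℕ.+-cancelʳ-≡ n e e′ eq
  ... | yes _   | no _    = ⊥-elim (ℕ.<⇒≱ e<n (ℕ.≤-trans (ℕ.m≤n+m n e′) (ℕ.≤-reflexive (sym eq))))
  ... | no _    | yes _   = ⊥-elim (ℕ.<⇒≱ e′<n (ℕ.≤-trans (ℕ.m≤n+m n e) (ℕ.≤-reflexive eq)))

  ≤-lift : ∀ u e → u ℕ.≤ n → u ℕ.≤ lift u e
  ≤-lift u e u≤n with u ℕ.≤? e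
  ... | yes u≤e = u≤e
  ... | no _    = ℕ.≤-trans u≤n (ℕ.m≤n+m n e)

  lift-< : ∀ u e → e ℕ.< n → lift u e ℕ.< u ℕ.+ n
  lift-< u e e<n with u ℕ.≤? e
  ... | yes _  = ℕ.<-≤-trans e<n (ℕ.m≤n+m n u)
  ... | no u≰e = ℕ.+-monoˡ-< n (ℕ.≰⇒> u≰e)

  lift-surjective : ∀ {u t} → u ℕ.≤ t → t ℕ.< u ℕ.+ n → u ℕ.< n → ∃ λ (e : Fin n) → lift u (toℕ e) ≡ t
  lift-surjective {u} {t} u≤t t<u+n u<n with t ℕ.<? n
  ... | yes t<n = fromℕ< t<n , trans (cong (lift u) (Fin.toℕ-fromℕ< t<n)) (lift-≤ u≤t)
  ... | no t≮n = fromℕ< j<n , trans (cong (lift u) (Fin.toℕ-fromℕ< j<n)) (trans (lift-> j<u) j+n)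
    where
    j+n : t ∸ n ℕ.+ n ≡ t
    j+n = ℕ.m∸n+n≡m (ℕ.≮⇒≥ t≮n)
    j<u : t ∸ n ℕ.< u
    j<u = ℕ.+-cancelʳ-< n (t ∸ n) u (subst (ℕ._< u ℕ.+ n) (sym j+n) t<u+n)
    j<n = ℕ.<-trans j<u u<n

  Between⇒lift-≤ : ∀ (u v e : Fin n) → Between u v e → lift (toℕ u) (toℕ e) ℕ.≤ lift (toℕ u) (toℕ v)
  Between⇒lift-≤ u v e (inj₁ (u≤v , u≤e , e≤v)) = subst₂ ℕ._≤_ (sym (lift-≤ u≤e)) (sym (lift-≤ u≤v)) e≤v
  Between⇒lift-≤ u v e (inj₂ (v<u , inj₁ u≤e)) =
    subst₂ ℕ._≤_ (sym (lift-≤ u≤e)) (sym (lift-> v<u)) (ℕ.≤-trans (ℕ.<⇒≤ (Fin.toℕ<n e)) (ℕ.m≤n+m n _))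
  Between⇒lift-≤ u v e (inj₂ (v<u , inj₂ e≤v)) =
    subst₂ ℕ._≤_ (sym (lift-> (ℕ.≤-<-trans e≤v v<u))) (sym (lift-> v<u)) (ℕ.+-monoˡ-≤ n e≤v)

  lift-≤⇒Between : ∀ (u v e : Fin n) → lift (toℕ u) (toℕ e) ℕ.≤ lift (toℕ u) (toℕ v) → Between u v e
  lift-≤⇒Between u v e le with toℕ u ℕ.≤? toℕ e | toℕ u ℕ.≤? toℕ v
  ... | yes u≤e | yes u≤v = inj₁ (u≤v , u≤e , le)
  ... | yes u≤e | no u≰v  = inj₂ (ℕ.≰⇒> u≰v , inj₁ u≤e)
  ... | no u≰e  | yes u≤v = ⊥-elim (ℕ.<⇒≱ (Fin.toℕ<n v) (ℕ.≤-trans (ℕ.m≤n+m n (toℕ e)) le))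
  ... | no u≰e  | no u≰v  = inj₂ (ℕ.≰⇒> u≰v , inj₂ (ℕ.+-cancelʳ-≤ n (toℕ e) (toℕ v) le))

  -- The second alternative of compatibility is about the arc from e, while `Good` counts positions
  -- from u; for e on the arc from u to v the two counts differ by a common shift of 0 or n.
  lift-lift : ∀ u e v → v ℕ.< n → lift u e ℕ.≤ lift u v →
    (lift u e ≡ e × lift u v ≡ lift e v) ⊎ (lift u e ≡ e ℕ.+ n × lift u v ≡ lift e v ℕ.+ n)
  lift-lift u e v v<n le with u ℕ.≤? e | u ℕ.≤? v
  ... | yes _   | yes _   = inj₁ (refl , sym (lift-≤ le))
  ... | yes u≤e | no u≰v  = inj₁ (refl , sym (lift-> (ℕ.<-≤-trans (ℕ.≰⇒> u≰v) u≤e)))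
  ... | no _    | yes _   = ⊥-elim (ℕ.<⇒≱ v<n (ℕ.≤-trans (ℕ.m≤n+m n e) le))
  ... | no _    | no _    = inj₂ (refl , cong (ℕ._+ n) (sym (lift-≤ (ℕ.+-cancelʳ-≤ n e v le))))

  ≢⇒<-lift : ∀ {u e : Fin n} → e ≢ u → toℕ u ℕ.< lift (toℕ u) (toℕ e)
  ≢⇒<-lift {u} {e} e≢u = ℕ.≤∧≢⇒< (≤-lift (toℕ u) (toℕ e) (ℕ.<⇒≤ (Fin.toℕ<n u))) λ eq →
    e≢u (Fin.toℕ-injective (lift-injective (toℕ u) (toℕ e) (toℕ u) (Fin.toℕ<n e) (Fin.toℕ<n u) (trans (sym eq) (sym (lift-≤ (ℕ.≤-refl {toℕ u}))))))

module Word (w : Path) {{nz : NonZero (length w)}} where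

  n : ℕ
  n = length w

  0<n : 0 ℕ.< n
  0<n = ℕ.>-nonZero⁻¹ n

  open Arcs n

  cyc : ∀ {a} {A : Set a} → Vec A n → ℕ → A
  cyc xs i = lookup xs (i mod n)

  toℕ-mod : ∀ i → toℕ (i mod n) ≡ i % n
  toℕ-mod i = Fin.toℕ-fromℕ< (m%n<n i n)

  cyc-toℕ : ∀ {a} {A : Set a} (xs : Vec A n) i → cyc xs (toℕ i) ≡ lookup xs i
  cyc-toℕ xs i = cong (lookup xs) (Fin.toℕ-injective (trans (toℕ-mod (toℕ i)) (m<n⇒m%n≡m (Fin.toℕ<n i))))

  cyc-per : ∀ {a} {A : Set a} (xs : Vec A n) i → cyc xs (i ℕ.+ n) ≡ cyc xs i
  cyc-per xs i = cong (lookup xs) (Fin.toℕ-injective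
    (trans (toℕ-mod (i ℕ.+ n)) (trans ([m+n]%n≡m%n i n) (sym (toℕ-mod i)))))

  cyc-lift : ∀ {a} {A : Set a} (xs : Vec A n) u e → cyc xs (lift u (toℕ e)) ≡ lookup xs e
  cyc-lift xs u e with u ℕ.≤? toℕ e
  ... | yes _ = cyc-toℕ xs e
  ... | no _  = trans (cyc-per xs (toℕ e)) (cyc-toℕ xs e)

  st : ℕ → Step
  st = cyc (letters w)

  st-per : ∀ i → st (i ℕ.+ n) ≡ st i
  st-per = cyc-per (letters w)

  open Cyclic n 0<n st st-per

  ∈-horizontal⇒ : ∀ {e} → e ∈ horizontal w → lookup (letters w) e ≡ east
  ∈-horizontal⇒ {e} e∈ = isEast-true (trans (sym (Vec.lookup-map e isEast (letters w))) (Vec.[]=⇒lookup e∈))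

  ⇒∈-horizontal : ∀ {e} → lookup (letters w) e ≡ east → e ∈ horizontal w
  ⇒∈-horizontal {e} eq = Vec.lookup⇒[]= e (horizontal w) (trans (Vec.lookup-map e isEast (letters w)) (cong isEast eq))

  ∈-vertical⇒ : ∀ {e} → e ∈ vertical w → lookup (letters w) e ≡ north
  ∈-vertical⇒ {e} e∈ = not-isEast-true (trans (sym (Vec.lookup-map e (not ∘ isEast) (letters w))) (Vec.[]=⇒lookup e∈))

  ⇒∈-vertical : ∀ {e} → lookup (letters w) e ≡ north → e ∈ vertical w
  ⇒∈-vertical {e} eq = Vec.lookup⇒[]= e (vertical w) (trans (Vec.lookup-map e (not ∘ isEast) (letters w)) (cong (not ∘ isEast) eq))

  ∈-arc⇒ : ∀ {u v e : Fin n} → e ∈ arc u v → Between u v e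
  ∈-arc⇒ {u} {v} {e} e∈ = does⇒ (between? u v e) (trans (sym (Vec.lookup∘tabulate (does ∘ between? u v) e)) (Vec.[]=⇒lookup e∈))

  ⇒∈-arc : ∀ {u v e : Fin n} → Between u v e → e ∈ arc u v
  ⇒∈-arc {u} {v} {e} b = Vec.lookup⇒[]= e (arc u v) (trans (Vec.lookup∘tabulate (does ∘ between? u v) e) (dec-true (between? u v e) b))

  module _ (ω : Grading w) where

    ω̂ : ℕ → ℕ
    ω̂ = cyc ω

    ω̂-per : ∀ i → ω̂ (i ℕ.+ n) ≡ ω̂ i
    ω̂-per = cyc-per ω

    F-arc : ∀ u e → F ω̂ (suc (lift (toℕ u) (toℕ e))) ℤ.- F ω̂ (toℕ u) ≡
                    + (ω ⟨ arc u e ∩ horizontal w ⟩) ℤ.- + ∣ arc u e ∩ vertical w ∣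
    F-arc u e = trans (sym (pre-arcSum y y-per u e)) (balance-F w ω (arc u e) (arcSum y y-per u e) λ i →
        trans (arcSum-lookup y y-per u e i) (cong (if lookup (arc u e) i then_else 0ℤ)
          (cong₂ fδ (cyc-toℕ (letters w) i) (cyc-toℕ ω i))))
      where
      y : ℕ → ℤ
      y i = fδ (st i) (ω̂ i)
      y-per : ∀ i → y (i ℕ.+ n) ≡ y i
      y-per i = cong₂ fδ (st-per i) (ω̂-per i)

    K-arc : ∀ e v → K ω̂ (suc (lift (toℕ e) (toℕ v))) ℤ.- K ω̂ (toℕ e) ≡
                    + ∣ arc e v ∩ horizontal w ∣ ℤ.- + (ω ⟨ arc e v ∩ vertical w ⟩)
    K-arc e v = trans (sym (pre-arcSum y y-per e v)) (balance-K w ω (arc e v) (arcSum y y-per e v) λ i →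
        trans (arcSum-lookup y y-per e v i) (cong (if lookup (arc e v) i then_else 0ℤ)
          (cong₂ kδ (cyc-toℕ (letters w) i) (cyc-toℕ ω i))))
      where
      y : ℕ → ℤ
      y i = kδ (st i) (ω̂ i)
      y-per : ∀ i → y (i ℕ.+ n) ≡ y i
      y-per i = cong₂ kδ (st-per i) (ω̂-per i)

    difference-≡ : ∀ {a b c d} → a ℤ.- b ≡ c ℤ.- d → c ≡ d → a ≡ b
    difference-≡ {a} {b} eq c≡d = ℤ.i-j≡0⇒i≡j a b (trans eq (ℤ.i≡j⇒i-j≡0 c≡d))

    K-unshift : ∀ {a b} → K ω̂ a ≡ K ω̂ b → K ω̂ (a ℕ.+ n) ≡ K ω̂ (b ℕ.+ n)
    K-unshift {a} {b} eq = trans (K-shift ω̂ ω̂-per a) (trans (cong (ℤ._+ K ω̂ n) eq) (sym (K-shift ω̂ ω̂-per b)))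

    witness⇒good : ∀ {u v e} → Witness w ω u v e → Good ω̂ (toℕ u) (lift (toℕ u) (toℕ v))
    witness⇒good {u} {v} {e} (e∈arc , inj₁ ((e∈N , e≢v) , eq)) = inj₁ (lift (toℕ u) (toℕ e) ,
      ≤-lift (toℕ u) (toℕ e) (ℕ.<⇒≤ (Fin.toℕ<n u)) ,
      ℕ.≤∧≢⇒< (Between⇒lift-≤ u v e (∈-arc⇒ {u} {v} e∈arc)) (e≢v ∘ Fin.toℕ-injective ∘ lift-injective (toℕ u) (toℕ e) (toℕ v) (Fin.toℕ<n e) (Fin.toℕ<n v)) ,
      trans (cyc-lift (letters w) (toℕ u) e) (∈-vertical⇒ e∈N) ,
      difference-≡ (F-arc u e) (cong +_ (sym eq)))
    witness⇒good {u} {v} {e} (e∈arc , inj₂ ((e∈E , e≢u) , eq)) = inj₂ (lift (toℕ u) (toℕ e) ,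
      ≢⇒<-lift e≢u , e≤v , trans (cyc-lift (letters w) (toℕ u) e) (∈-horizontal⇒ e∈E) ,
      transport (lift-lift (toℕ u) (toℕ e) (toℕ v) (Fin.toℕ<n v) e≤v))
      where
      e≤v = Between⇒lift-≤ u v e (∈-arc⇒ {u} {v} e∈arc)
      hit : K ω̂ (toℕ e) ≡ K ω̂ (suc (lift (toℕ e) (toℕ v)))
      hit = sym (difference-≡ (K-arc e v) (cong +_ eq))
      transport : (lift (toℕ u) (toℕ e) ≡ toℕ e × lift (toℕ u) (toℕ v) ≡ lift (toℕ e) (toℕ v)) ⊎
                  (lift (toℕ u) (toℕ e) ≡ toℕ e ℕ.+ n × lift (toℕ u) (toℕ v) ≡ lift (toℕ e) (toℕ v) ℕ.+ n) →
                  K ω̂ (lift (toℕ u) (toℕ e)) ≡ K ω̂ (suc (lift (toℕ u) (toℕ v)))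
      transport (inj₁ (eq₁ , eq₂)) = subst₂ (λ a b → K ω̂ a ≡ K ω̂ (suc b)) (sym eq₁) (sym eq₂) hit
      transport (inj₂ (eq₁ , eq₂)) = subst₂ (λ a b → K ω̂ a ≡ K ω̂ (suc b)) (sym eq₁) (sym eq₂)
        (K-unshift {toℕ e} {suc (lift (toℕ e) (toℕ v))} hit)

    good⇒witness : ∀ {u v} → Good ω̂ (toℕ u) (lift (toℕ u) (toℕ v)) → ∃ (Witness w ω u v)
    good⇒witness {u} {v} (inj₁ (t , u≤t , t<v , t-north , hit))
      with lift-surjective u≤t (ℕ.<-trans t<v (lift-< (toℕ u) (toℕ v) (Fin.toℕ<n v))) (Fin.toℕ<n u)
    ... | e , refl = e , ⇒∈-arc {u} {v} (lift-≤⇒Between u v e (ℕ.<⇒≤ t<v)) ,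
            inj₁ ((⇒∈-vertical (trans (sym (cyc-lift (letters w) (toℕ u) e)) t-north) , λ { refl → ℕ.<-irrefl refl t<v }) ,
                  sym (ℤ.+-injective (difference-≡ (sym (F-arc u e)) hit)))
    good⇒witness {u} {v} (inj₂ (t , u<t , t≤v , t-east , hit))
      with lift-surjective (ℕ.<⇒≤ u<t) (ℕ.≤-<-trans t≤v (lift-< (toℕ u) (toℕ v) (Fin.toℕ<n v))) (Fin.toℕ<n u)
    ... | e , refl = e , ⇒∈-arc {u} {v} (lift-≤⇒Between u v e t≤v) ,
            inj₂ ((⇒∈-horizontal (trans (sym (cyc-lift (letters w) (toℕ u) e)) t-east) ,
                   λ { refl → ℕ.<-irrefl (sym (lift-≤ {toℕ u} ℕ.≤-refl)) u<t }) ,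
                  ℤ.+-injective (difference-≡ (sym (K-arc e v)) (transport (lift-lift (toℕ u) (toℕ e) (toℕ v) (Fin.toℕ<n v) t≤v))))
      where
      cancel : ∀ {a b} → K ω̂ (a ℕ.+ n) ≡ K ω̂ (b ℕ.+ n) → K ω̂ a ≡ K ω̂ b
      cancel {a} {b} eq = ∙-cancelʳ (K ω̂ n) (K ω̂ a) (K ω̂ b)
        (trans (sym (K-shift ω̂ ω̂-per a)) (trans eq (K-shift ω̂ ω̂-per b)))
      transport : (lift (toℕ u) (toℕ e) ≡ toℕ e × lift (toℕ u) (toℕ v) ≡ lift (toℕ e) (toℕ v)) ⊎
                  (lift (toℕ u) (toℕ e) ≡ toℕ e ℕ.+ n × lift (toℕ u) (toℕ v) ≡ lift (toℕ e) (toℕ v) ℕ.+ n) →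
                  K ω̂ (suc (lift (toℕ e) (toℕ v))) ≡ K ω̂ (toℕ e)
      transport (inj₁ (eq₁ , eq₂)) = sym (subst₂ (λ a b → K ω̂ a ≡ K ω̂ (suc b)) eq₁ eq₂ hit)
      transport (inj₂ (eq₁ , eq₂)) = sym (cancel {toℕ e} {suc (lift (toℕ e) (toℕ v))}
        (subst₂ (λ a b → K ω̂ a ≡ K ω̂ (suc b)) eq₁ eq₂ hit))

    compatible⇒compat : Compatible w ω → Compat ω̂
    compatible⇒compat compatible = compat-reduce ω̂ ω̂-per λ t v t<n →
      subst (λ t → CompatibleAt ω̂ t v) (Fin.toℕ-fromℕ< t<n) (at (fromℕ< t<n) v)
      where
      at : ∀ u v → CompatibleAt ω̂ (toℕ u) v
      at u v u≤v v<u+n u-east v-north 0<ωu 0<ωv with lift-surjective u≤v v<u+n (Fin.toℕ<n u)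
      ... | v′ , refl = witness⇒good (proj₂ (compatible u v′
              (⇒∈-horizontal (trans (sym (cyc-toℕ (letters w) u)) u-east))
              (⇒∈-vertical (trans (sym (cyc-lift (letters w) (toℕ u) v′)) v-north))
              (ℕ.*-mono-< (subst (0 ℕ.<_) (cyc-toℕ ω u) 0<ωu) (subst (0 ℕ.<_) (cyc-lift ω (toℕ u) v′) 0<ωv))))

    compat⇒compatible : Compat ω̂ → Compatible w ω
    compat⇒compatible compat u v u∈E v∈N 0<ωuωv = good⇒witness (compat (toℕ u) (lift (toℕ u) (toℕ v))
      (≤-lift (toℕ u) (toℕ v) (ℕ.<⇒≤ (Fin.toℕ<n u))) (lift-< (toℕ u) (toℕ v) (Fin.toℕ<n v))
      (trans (cyc-toℕ (letters w) u) (∈-horizontal⇒ u∈E)) (trans (cyc-lift (letters w) (toℕ u) v) (∈-vertical⇒ v∈N))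
      (subst (0 ℕ.<_) (sym (cyc-toℕ ω u)) (ℕ.n≢0⇒n>0 λ ωu≡0 → ℕ.<⇒≢ 0<ωuωv (sym (cong (ℕ._* lookup ω v) ωu≡0))))
      (subst (0 ℕ.<_) (sym (cyc-lift ω (toℕ u) v)) (ℕ.n≢0⇒n>0 λ ωv≡0 → ℕ.<⇒≢ 0<ωuωv
        (sym (trans (cong (lookup ω u ℕ.*_) ωv≡0) (ℕ.*-zeroʳ (lookup ω u)))))))

-- Maximality as a local condition

record IsMaximalDyckPath (d₁ d₂ : ℕ) (w : Path) : Set where
  field
    isDyckPath : IsDyckPath d₁ d₂ w
    -- The point reached by going north instead would lie strictly above the segment.
    tight      : ∀ i → lookup (letters w) i ≡ east →
                 #east (take (toℕ i) w) ℕ.* d₂ ℕ.< suc (#north (take (toℕ i) w)) ℕ.* d₁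

module _ (d₁ d₂ : ℕ) where
  open MaximalDyckPath d₁ d₂ using (from)

  from-tight : ∀ r s {a b} → a ℕ.+ r ≡ d₁ → b ℕ.+ s ≡ d₂ → ∀ i → lookup (letters (from r s)) i ≡ east →
    (a ℕ.+ #east (take (toℕ i) (from r s))) ℕ.* d₂ ℕ.< suc (b ℕ.+ #north (take (toℕ i) (from r s))) ℕ.* d₁
  from-tight zero    (suc s) a+r b+s (Fin.suc i) eq = ⊥-elim (all-north s i eq)
    where
    all-north : ∀ s i → ¬ (lookup (letters (from zero s)) i ≡ east)
    all-north (suc s) (Fin.suc i) eq = all-north s i eq
  -- All north steps have been made, so b = d₂, and the bound follows from a < d₁.
  from-tight (suc r) zero {a} {b} a+r b+s Fin.zero eq = subst₂ (λ x y → x ℕ.* d₂ ℕ.< suc y ℕ.* d₁)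
    (sym (ℕ.+-identityʳ a)) (sym (ℕ.+-identityʳ b)) (ℕ.<-≤-trans (ℕ.≤-<-trans (ℕ.*-monoˡ-≤ d₂ (ℕ.<⇒≤ a<d₁))
      (ℕ.m<n+m (d₁ ℕ.* d₂) {d₁} (ℕ.≤-<-trans z≤n a<d₁)))
      (ℕ.≤-reflexive (cong (λ z → d₁ ℕ.+ z) (trans (ℕ.*-comm d₁ d₂) (cong (ℕ._* d₁) (trans (sym b+s) (ℕ.+-identityʳ b)))))))
    where
    a<d₁ : a ℕ.< d₁
    a<d₁ = ℕ.≤-trans (ℕ.m<m+n a {suc r} (s≤s z≤n)) (ℕ.≤-reflexive a+r)
  from-tight (suc r) zero {a} {b} a+r b+s (Fin.suc i) eq = subst (λ x → x ℕ.* d₂ ℕ.< suc (b ℕ.+ #north (take (toℕ i) (from r zero))) ℕ.* d₁)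
    (sym (ℕ.+-suc a _)) (from-tight r zero {suc a} {b} (trans (sym (ℕ.+-suc a r)) a+r) b+s i eq)
  from-tight (suc r) (suc s) {a} {b} a+r b+s i eq with (d₂ ∸ s) ℕ.* d₁ ℕ.≤? (d₁ ∸ suc r) ℕ.* d₂
  from-tight (suc r) (suc s) {a} {b} a+r b+s (Fin.suc i) eq | yes _ =
    subst (λ y → (a ℕ.+ #east (take (toℕ i) (from (suc r) s))) ℕ.* d₂ ℕ.< suc y ℕ.* d₁) (sym (ℕ.+-suc b _))
      (from-tight (suc r) s {a} {suc b} a+r (trans (sym (ℕ.+-suc b s)) b+s) i eq)
  -- The failed test for a north step is precisely the claim.
  from-tight (suc r) (suc s) {a} {b} a+r b+s Fin.zero eq | no ¬p = subst₂ (λ x y → x ℕ.* d₂ ℕ.< y ℕ.* d₁)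
    (trans (cong (_∸ suc r) (sym a+r)) (trans (ℕ.m+n∸n≡m a (suc r)) (sym (ℕ.+-identityʳ a))))
    (trans (cong (_∸ s) (trans (sym b+s) (ℕ.+-suc b s))) (trans (ℕ.m+n∸n≡m (suc b) s) (cong suc (sym (ℕ.+-identityʳ b)))))
    (ℕ.≰⇒> ¬p)
  from-tight (suc r) (suc s) {a} {b} a+r b+s (Fin.suc i) eq | no _ =
    subst (λ x → x ℕ.* d₂ ℕ.< suc (b ℕ.+ #north (take (toℕ i) (from r (suc s)))) ℕ.* d₁)
    (sym (ℕ.+-suc a _)) (from-tight r (suc s) {suc a} {b} (trans (sym (ℕ.+-suc a r)) a+r) b+s i eq)

  𝒫-isMaximalDyckPath : IsMaximalDyckPath d₁ d₂ (𝒫 d₁ d₂)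
  𝒫-isMaximalDyckPath = record
    { isDyckPath = IsHighestDyckPath.isDyckPath (𝒫-highest d₁ d₂)
    ; tight      = from-tight d₁ d₂ refl refl }

-- Free edges of lattice paths

length-#east-#north : ∀ w → length w ≡ #east w ℕ.+ #north w
length-#east-#north []          = refl
length-#east-#north (east  ∷ w) = cong suc (length-#east-#north w)
length-#east-#north (north ∷ w) = trans (cong suc (length-#east-#north w)) (sym (ℕ.+-suc (#east w) (#north w)))

count-tabulate : ∀ m (b : ℕ → Bool) → + count (tabulate {n = m} (b ∘ toℕ)) ≡ pre (λ i → if b i then 1ℤ else 0ℤ) m
count-tabulate zero    b = refl
count-tabulate (suc m) b = trans head (sym (pre-head (λ i → if b i then 1ℤ else 0ℤ) m))
  where
  head : + count (tabulate {n = suc m} (b ∘ toℕ)) ≡ (if b 0 then 1ℤ else 0ℤ) ℤ.+ pre (λ i → if b (suc i) then 1ℤ else 0ℤ) m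
  head with b 0
  ... | true  = cong (λ z → 1ℤ ℤ.+ z) (count-tabulate m (b ∘ suc))
  ... | false = trans (count-tabulate m (b ∘ suc)) (sym (ℤ.+-identityˡ _))

ZeroOn⇒≡0 : ∀ {n} (S : Vec Bool n) ω → ZeroOn S ω ≡ true → ∀ i → lookup S i ≡ true → lookup ω i ≡ 0
ZeroOn⇒≡0 (true  ∷ S) (zero ∷ ω) z Fin.zero    _  = refl
ZeroOn⇒≡0 (true  ∷ S) (zero ∷ ω) z (Fin.suc i) eq = ZeroOn⇒≡0 S ω z i eq
ZeroOn⇒≡0 (false ∷ S) (_    ∷ ω) z (Fin.suc i) eq = ZeroOn⇒≡0 S ω z i eq

-- The combinatorial input, for the edges selected by χ (of which there are d)
-- against the edges selected by χ̄ (of which there are d′): the values of a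
-- compatible grading on free χ-edges may be changed at will.
record FreeEdges (χ χ̄ : Step → Bool) (d d′ : ℕ) (w : Path) : Set where
  field
    free       : Grading w → Vec Bool (length w)
    free⊆      : ∀ ω i → lookup (free ω) i ≡ true → χ (lookup (letters w) i) ≡ true
    free-count : ∀ ω → count (free ω) ≡ d ∸ deg χ̄ w ω
    free-agree : ∀ ω ω′ → AgreeOff (free ω) ω ω′ → free ω ≡ free ω′ × (Compatible w ω → Compatible w ω′)
    slope      : ∀ ω → Compatible w ω → ZeroOn (free ω) ω ≡ true → (∃ λ i → lookup ω i ≢ 0) →
                 d ℕ.* deg χ w ω ℕ.< d′ ℕ.* deg χ̄ w ω

module _ (w : Path) {{nz : NonZero (length w)}} where
  open Word w using (n; 0<n)

  -- A way of reading w cyclically, edge i of w being read at time κ(i).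
  record Reading (χ χ̄ : Step → Bool) (d d′ : ℕ) : Set where
    field
      κ      : ℕ → ℕ
      κ-<    : ∀ {i} → i ℕ.< n → κ i ℕ.< n
      κ-κ    : ∀ {i} → i ℕ.< n → κ (κ i) ≡ i
      κ-pre  : ∀ f → pre (f ∘ κ) n ≡ pre f n
      st     : ℕ → Step
      st-per : ∀ i → st (i ℕ.+ n) ≡ st i
      -- The edges selected by χ are read as vertical, whatever they are on the path.
      st-χ   : ∀ i → not (isEast (st (κ (toℕ i)))) ≡ χ (lookup (letters w) i)
      val     : Grading w → ℕ → ℕ
      val-per : ∀ ω i → val ω (i ℕ.+ n) ≡ val ω i
      val-κ   : ∀ ω i → val ω (κ (toℕ i)) ≡ lookup ω i
    open Cyclic n 0<n st st-per public
    field
      compat⁺ : ∀ ω → Compatible w ω → Compat (val ω)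
      compat⁻ : ∀ ω → Compat (val ω) → Compatible w ω
      bounds  : Bounds d′ d n st
      F-total : ∀ ω → F (val ω) n ≡ + deg χ̄ w ω ℤ.- + d
      D-total : ∀ ω → pre (λ i → dδ d′ d (st i) (val ω i)) n ≡ + d′ ℤ.* + deg χ̄ w ω ℤ.- + d ℤ.* + deg χ w ω

  module _ {χ χ̄ d d′} (reading : Reading χ χ̄ d d′) where
    open Reading reading

    freeVec : Grading w → Vec Bool n
    freeVec ω = tabulate (isFree (val ω) ∘ κ ∘ toℕ)

    lookup-free : ∀ ω i → lookup (freeVec ω) i ≡ isFree (val ω) (κ (toℕ i))
    lookup-free ω = Vec.lookup∘tabulate (isFree (val ω) ∘ κ ∘ toℕ)

    time : ∀ {t} → t ℕ.< n → ∃ λ (i : Fin n) → κ (toℕ i) ≡ t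
    time t<n = fromℕ< (κ-< t<n) , trans (cong κ (Fin.toℕ-fromℕ< (κ-< t<n))) (κ-κ t<n)

    -- Over a period F changes by deg χ̄ - d. If this is at most 0, its negative is the number of
    -- free edges; otherwise there are none, in accordance with truncated subtraction.
    count-free : ∀ ω → count (freeVec ω) ≡ d ∸ deg χ̄ w ω
    count-free ω with F (val ω) n ℤ.≤? 0ℤ
    ... | yes F≤0 = ℤ.+-injective (begin
        + count (freeVec ω)              ≡⟨ count-tabulate n (isFree (val ω) ∘ κ) ⟩
        pre (indicator ∘ isFree (val ω) ∘ κ) n ≡⟨ κ-pre (indicator ∘ isFree (val ω)) ⟩
        freeCount (val ω) (val-per ω) n ≡⟨ freeCount-falling (val ω) (val-per ω) F≤0 ⟩
        ℤ.- F (val ω) n               ≡⟨ cong ℤ.-_ (F-total ω) ⟩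
        ℤ.- (+ deg χ̄ w ω ℤ.- + d)     ≡⟨ flipped (+ deg χ̄ w ω) (+ d) ⟩
        + d ℤ.- + deg χ̄ w ω           ≡⟨ ℤ.m-n≡m⊖n d (deg χ̄ w ω) ⟩
        d ℤ.⊖ deg χ̄ w ω               ≡⟨ ℤ.⊖-≥ {d} {deg χ̄ w ω} (ℤ.drop‿+≤+ (ℤ.i-j≤0⇒i≤j {+ deg χ̄ w ω} {+ d} (subst (ℤ._≤ 0ℤ) (F-total ω) F≤0))) ⟩
        + (d ∸ deg χ̄ w ω)             ∎)
      where
      open ≡-Reasoning
      flipped : ∀ a b → ℤ.- (a ℤ.- b) ≡ b ℤ.- a
      flipped = solve-∀
    ... | no F≰0 = trans (ℤ.+-injective (begin
        + count (freeVec ω)              ≡⟨ count-tabulate n (isFree (val ω) ∘ κ) ⟩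
        pre (indicator ∘ isFree (val ω) ∘ κ) n ≡⟨ κ-pre (indicator ∘ isFree (val ω)) ⟩
        freeCount (val ω) (val-per ω) n ≡⟨ freeCount-rising (val ω) (val-per ω) F≰0 n ⟩
        0ℤ                            ∎))
      (sym (ℕ.m≤n⇒m∸n≡0 {d} {deg χ̄ w ω} (ℕ.<⇒≤ (ℕ.≰⇒> λ deg≤d → F≰0 (subst (ℤ._≤ 0ℤ) (sym (F-total ω)) (ℤ.i≤j⇒i-j≤0 (ℤ.+≤+ deg≤d)))))))
      where open ≡-Reasoning

    agree⇒ : ∀ ω ω′ → AgreeOff (freeVec ω) ω ω′ → ∀ t → isFree (val ω) t ≡ false → val ω t ≡ val ω′ t
    agree⇒ ω ω′ agree = periodic-induction (λ t → isFree (val ω) t ≡ false → val ω t ≡ val ω′ t) 0<n base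
      λ t IH eq → trans (val-per ω t) (trans (IH (trans (sym (isFree-shift (val ω) (val-per ω) t)) eq)) (sym (val-per ω′ t)))
      where
      base : ∀ t → t ℕ.< n → isFree (val ω) t ≡ false → val ω t ≡ val ω′ t
      base t t<n eq with time t<n
      ... | i , refl = trans (val-κ ω i) (trans (agree i (trans (lookup-free ω i) eq)) (sym (val-κ ω′ i)))

    off-free : ∀ ω → ZeroOn (freeVec ω) ω ≡ true → ∀ t → isFree (val ω) t ≡ true → val ω t ≡ 0
    off-free ω zeroOn = periodic-induction (λ t → isFree (val ω) t ≡ true → val ω t ≡ 0) 0<n base
      λ t IH eq → trans (val-per ω t) (IH (trans (sym (isFree-shift (val ω) (val-per ω) t)) eq))
      where
      base : ∀ t → t ℕ.< n → isFree (val ω) t ≡ true → val ω t ≡ 0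
      base t t<n eq with time t<n
      ... | i , refl = trans (val-κ ω i) (ZeroOn⇒≡0 (freeVec ω) ω zeroOn i (trans (lookup-free ω i) eq))

    freeEdges : FreeEdges χ χ̄ d d′ w
    freeEdges = record
      { free = freeVec
      ; free⊆ = λ ω i eq → trans (sym (st-χ i)) (∧-trueˡ (not (isEast (st (κ (toℕ i))))) (trans (sym (lookup-free ω i)) eq))
      ; free-count = count-free
      ; free-agree = λ ω ω′ agree →
          Vec.tabulate-cong (λ i → isFree-agree (val ω) (val ω′) (val-per ω) (agree⇒ ω ω′ agree) (κ (toℕ i))) ,
          λ compatible → compat⁻ ω′ (compat-agree (val ω) (val ω′) (val-per ω) (agree⇒ ω ω′ agree) (compat⁺ ω compatible))
      ; slope = slope }
      where
      ∧-trueˡ : ∀ x {y} → x ∧ y ≡ true → x ≡ true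
      ∧-trueˡ true _ = refl
      slope : ∀ ω → Compatible w ω → ZeroOn (freeVec ω) ω ≡ true → (∃ λ i → lookup ω i ≢ 0) →
              d ℕ.* deg χ w ω ℕ.< d′ ℕ.* deg χ̄ w ω
      slope ω compatible zeroOn (i , ωi≢0) = ℤ.drop‿+≤+ (subst₂ (λ x y → 1ℤ ℤ.+ x ℤ.≤ y) (sym (ℤ.pos-* d (deg χ w ω)))
          (sym (ℤ.pos-* d′ (deg χ̄ w ω))) (≤-from (subst (0ℤ ≺_) (D-total ω)
            (Slope.D-positive n 0<n st st-per d′ d bounds (val ω) (val-per ω) (compat⁺ ω compatible)
              (λ t t-north t-free → off-free ω zeroOn t (Free⇒isFree (val ω) (val-per ω) t t-north t-free))
              (κ (toℕ i) , λ eq → ωi≢0 (trans (sym (val-κ ω i)) eq))))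
            (rearrange (+ d ℤ.* + deg χ w ω) (+ d′ ℤ.* + deg χ̄ w ω))))
        where
        rearrange : ∀ x y → y ℤ.- x ℤ.- (1ℤ ℤ.+ 0ℤ) ≡ y ℤ.- (1ℤ ℤ.+ x)
        rearrange = solve-∀

  module _ {d₁ d₂ : ℕ} (maximal : IsMaximalDyckPath d₁ d₂ w) where
    open IsMaximalDyckPath maximal
    open IsDyckPath isDyckPath
    open Word w hiding (n; 0<n)

    word-bounds : Bounds d₁ d₂ n st
    word-bounds = record { h-period = h-period ; h-≥0 = h-≥0 ; h-east = h-east ; h-north = h-north }
      where
      h : ℕ → ℤ
      h = pre λ i → hδ d₁ d₂ (st i)
      h-prefix : ∀ t → t ℕ.≤ n → h t ≡ + #east (take t w) ℤ.* + d₂ ℤ.- + #north (take t w) ℤ.* + d₁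
      h-prefix = prefix-h d₁ d₂ w (λ i → hδ d₁ d₂ (st i)) λ i → cong (hδ d₁ d₂) (cyc-toℕ (letters w) i)
      h-period : h n ≡ 0ℤ
      h-period = trans (h-prefix n ℕ.≤-refl) (trans (cong (λ w → + #east w ℤ.* + d₂ ℤ.- + #north w ℤ.* + d₁) (List.take-all n w ℕ.≤-refl))
        (trans (cong₂ (λ a b → + a ℤ.* + d₂ ℤ.- + b ℤ.* + d₁) ends-east ends-north) (cancel (+ d₁) (+ d₂))))
        where
        cancel : ∀ a b → a ℤ.* b ℤ.- b ℤ.* a ≡ 0ℤ
        cancel = solve-∀
      h-shift : ∀ t → h (t ℕ.+ n) ≡ h t
      h-shift t = trans (pre-shift n (λ i → cong (hδ d₁ d₂) (st-per i)) t)
        (trans (cong (λ z → h t ℤ.+ z) h-period) (ℤ.+-identityʳ (h t)))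
      h-≥0 : ∀ t → 0ℤ ℤ.≤ h t
      h-≥0 = periodic-induction (λ t → 0ℤ ℤ.≤ h t) 0<n
        (λ t t<n → subst (0ℤ ℤ.≤_) (sym (h-prefix t (ℕ.<⇒≤ t<n)))
          (ℤ.i≤j⇒0≤j-i (subst₂ ℤ._≤_ (ℤ.pos-* (#north (take t w)) d₁) (ℤ.pos-* (#east (take t w)) d₂) (ℤ.+≤+ (below t)))))
        λ t → subst (0ℤ ℤ.≤_) (sym (h-shift t))
      h-east : ∀ t → st t ≡ east → h t ≺ + d₁
      h-east = periodic-induction (λ t → st t ≡ east → h t ≺ + d₁) 0<n base
        λ t IH t-east → subst (_≺ + d₁) (sym (h-shift t)) (IH (trans (sym (st-per t)) t-east))
        where
        base : ∀ t → t ℕ.< n → st t ≡ east → h t ≺ + d₁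
        base t t<n t-east = subst (_≺ + d₁) (sym (h-prefix t (ℕ.<⇒≤ t<n))) (≤-from
            (subst₂ ℤ._≤_ (cong (λ z → 1ℤ ℤ.+ z) (ℤ.pos-* a d₂)) (ℤ.pos-* (suc b) d₁) (ℤ.+≤+ bound))
            (rearrange (+ a) (+ b) (+ d₁) (+ d₂)))
          where
          a = #east (take t w)
          b = #north (take t w)
          rearrange : ∀ a b d e → (1ℤ ℤ.+ b) ℤ.* d ℤ.- (1ℤ ℤ.+ a ℤ.* e) ≡ d ℤ.- (1ℤ ℤ.+ (a ℤ.* e ℤ.- b ℤ.* d))
          rearrange = solve-∀
          bound : a ℕ.* d₂ ℕ.< suc b ℕ.* d₁
          bound = subst (λ t → #east (take t w) ℕ.* d₂ ℕ.< suc (#north (take t w)) ℕ.* d₁) (Fin.toℕ-fromℕ< t<n)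
            (tight (fromℕ< t<n) (trans (sym (cyc-toℕ (letters w) (fromℕ< t<n))) (trans (cong st (Fin.toℕ-fromℕ< t<n)) t-east)))
      -- h grows only at horizontal edges, before which it is below d₁, and then by d₂. Since a
      -- vertical edge subtracts d₁, `h-north` follows.
      h-< : ∀ t → h t ≺ + d₁ ℤ.+ + d₂
      h-< zero    = ℤ.+≤+ (ℕ.≤-trans 0<n (ℕ.≤-reflexive (trans (length-#east-#north w) (cong₂ ℕ._+_ ends-east ends-north))))
      h-< (suc t) = go (st t) refl
        where
        go : ∀ s → st t ≡ s → h t ℤ.+ hδ d₁ d₂ (st t) ≺ + d₁ ℤ.+ + d₂
        go east t-east = ≤-from (h-east t t-east)
          (trans (rearrange (+ d₁) (+ d₂) (h t)) (cong (λ s → + d₁ ℤ.+ + d₂ ℤ.- (1ℤ ℤ.+ (h t ℤ.+ hδ d₁ d₂ s))) (sym t-east)))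
          where
          rearrange : ∀ a b h → a ℤ.- (1ℤ ℤ.+ h) ≡ a ℤ.+ b ℤ.- (1ℤ ℤ.+ (h ℤ.+ b))
          rearrange = solve-∀
        go north t-north = ≤-from₂ (h-< t) (ℤ.+≤+ (z≤n {d₁}))
          (trans (rearrange (+ d₁) (+ d₂) (h t)) (cong (λ s → + d₁ ℤ.+ + d₂ ℤ.- (1ℤ ℤ.+ (h t ℤ.+ hδ d₁ d₂ s))) (sym t-north)))
          where
          rearrange : ∀ a b h → a ℤ.+ b ℤ.- (1ℤ ℤ.+ h) ℤ.+ (a ℤ.- 0ℤ) ≡ a ℤ.+ b ℤ.- (1ℤ ℤ.+ (h ℤ.+ ℤ.- a))
          rearrange = solve-∀
      h-north : ∀ t → st t ≡ north → h (suc t) ≺ + d₂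
      h-north t t-north = ≤-from (h-< t)
        (trans (rearrange (+ d₁) (+ d₂) (h t)) (cong (λ s → + d₂ ℤ.- (1ℤ ℤ.+ (h t ℤ.+ hδ d₁ d₂ s))) (sym t-north)))
        where
        rearrange : ∀ a b h → a ℤ.+ b ℤ.- (1ℤ ℤ.+ h) ≡ b ℤ.- (1ℤ ℤ.+ (h ℤ.+ ℤ.- a))
        rearrange = solve-∀

    forwards : Reading (not ∘ isEast) isEast d₂ d₁
    forwards = record
      { κ = λ i → i ; κ-< = λ i<n → i<n ; κ-κ = λ _ → refl ; κ-pre = λ f → refl
      ; st = st ; st-per = st-per ; st-χ = λ i → cong (not ∘ isEast) (cyc-toℕ (letters w) i)
      ; val = ω̂ ; val-per = ω̂-per ; val-κ = cyc-toℕ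
      ; compat⁺ = compatible⇒compat ; compat⁻ = compat⇒compatible
      ; bounds = word-bounds
      ; F-total = λ ω → trans (total-F w ω _ λ i → cong₂ fδ (cyc-toℕ (letters w) i) (cyc-toℕ ω i))
                    (cong (λ z → + deg isEast w ω ℤ.- + z) ends-north)
      ; D-total = λ ω → total-D d₁ d₂ w ω _ λ i → cong₂ (dδ d₁ d₂) (cyc-toℕ (letters w) i) (cyc-toℕ ω i) }

    backwards : Reading isEast (not ∘ isEast) d₁ d₂
    backwards = record
      { κ = λ i → n ∸ suc i ; κ-< = ∸-suc-< ; κ-κ = ∸-suc-involutive
      -- `pre-mirror` reverses the sign along with the order, so it is applied to -f.
      ; κ-pre = λ f → trans (pre-mirror {f = λ i → ℤ.- f i} n (λ i _ → sym (ℤ.neg-involutive (f (n ∸ suc i)))) n ℕ.≤-refl)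
          (trans (cong₂ (λ t z → pre (λ i → ℤ.- f i) t ℤ.- z) (ℕ.n∸n≡0 n) (pre-neg f n)) (double-neg (pre f n)))
      ; st = mirror st st-per ; st-per = mirror-per st st-per
      ; st-χ = λ i → trans (flipped (st (reflect (n ∸ suc (toℕ i)))))
          (cong isEast (trans (cong st (reflect-κ i)) (cyc-toℕ (letters w) i)))
      ; val = λ ω → ω̂ ω ∘ reflect ; val-per = λ ω i → cong (ω̂ ω) (reflect-per i)
      ; val-κ = λ ω i → trans (cong (ω̂ ω) (reflect-κ i)) (cyc-toℕ ω i)
      ; compat⁺ = λ ω compatible → compat-mirror st st-per (ω̂ ω) (ω̂-per ω) (compatible⇒compat ω compatible)
      -- The converse direction is obtained by reflecting a second time.
      ; compat⁻ = λ ω compat → compat⇒compatible ω (Compat-cong n 0<n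
          (mirror-per (mirror st st-per) (mirror-per st st-per)) st-per
          (λ i → trans (flipStep-involutive (st (reflect (reflect i)))) (reflect-reflect st st-per i))
          (reflect-reflect (ω̂ ω) (ω̂-per ω))
          (compat-mirror (mirror st st-per) (mirror-per st st-per) (ω̂ ω ∘ reflect) (λ i → cong (ω̂ ω) (reflect-per i)) compat))
      ; bounds = bounds-mirror st st-per word-bounds
      -- The reflected F takes the value K(n) - K(2n) = -K(n) after one period.
      ; F-total = λ ω → trans (F-mirror st st-per (ω̂ ω) (ω̂-per ω) n (ℕ.m≤m+n n n))
          (trans (cong₂ (λ t z → Cyclic.K n 0<n st st-per (ω̂ ω) t ℤ.- z) (ℕ.m+n∸n≡m n n)
                   (Cyclic.K-shift n 0<n st st-per (ω̂ ω) (ω̂-per ω) n))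
            (trans (cong (λ k → k ℤ.- (k ℤ.+ k)) (trans (total-K w ω _ λ i → cong₂ kδ (cyc-toℕ (letters w) i) (cyc-toℕ ω i))
                     (cong (λ z → + z ℤ.- + deg (not ∘ isEast) w ω) ends-east)))
              (negate (+ d₁) (+ deg (not ∘ isEast) w ω))))
      ; D-total = λ ω → trans (D-mirror st st-per (ω̂ ω) (ω̂-per ω) d₁ d₂ n (ℕ.m≤m+n n n))
          (trans (cong₂ (λ t z → pre (λ i → dδ d₁ d₂ (st i) (ω̂ ω i)) t ℤ.- z) (ℕ.m+n∸n≡m n n)
                   (pre-shift n (λ i → cong₂ (dδ d₁ d₂) (st-per i) (ω̂-per ω i)) n))
            (trans (cong (λ k → k ℤ.- (k ℤ.+ k)) (total-D d₁ d₂ w ω _ λ i → cong₂ (dδ d₁ d₂) (cyc-toℕ (letters w) i) (cyc-toℕ ω i)))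
              (negate (+ d₁ ℤ.* + deg isEast w ω) (+ d₂ ℤ.* + deg (not ∘ isEast) w ω)))) }
      where
      open Mirror n hiding (0<n)
      reflect-κ : ∀ (i : Fin n) → reflect (n ∸ suc (toℕ i)) ≡ toℕ i
      reflect-κ i = trans (reflect-< (∸-suc-< (Fin.toℕ<n i))) (∸-suc-involutive (Fin.toℕ<n i))
      flipped : ∀ s → not (isEast (flipStep s)) ≡ isEast s
      flipped east  = refl
      flipped north = refl
      double-neg : ∀ x → 0ℤ ℤ.- (ℤ.- x) ≡ x
      double-neg = solve-∀
      negate : ∀ a b → a ℤ.- b ℤ.- (a ℤ.- b ℤ.+ (a ℤ.- b)) ≡ b ℤ.- a
      negate = solve-∀
      pre-neg : ∀ f t → pre (λ i → ℤ.- f i) t ≡ ℤ.- pre f t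
      pre-neg f zero    = refl
      pre-neg f (suc t) = trans (cong (ℤ._+ ℤ.- f t) (pre-neg f t)) (sym (ℤ.neg-distrib-+ (pre f t) (f t)))

-- The empty path has no positive period and cannot be read cyclically.
freeEdges-[] : ∀ {χ χ̄ d d′} → d ≡ 0 → FreeEdges χ χ̄ d d′ []
freeEdges-[] refl = record
  { free = λ _ → [] ; free⊆ = λ _ () ; free-count = λ { [] → refl }
  ; free-agree = λ { [] [] _ → refl , λ compatible → compatible } ; slope = λ _ _ _ () }

free-vertical : ∀ {d₁ d₂} w → IsMaximalDyckPath d₁ d₂ w → FreeEdges (not ∘ isEast) isEast d₂ d₁ w
free-vertical []      m = freeEdges-[] (sym (IsDyckPath.ends-north (IsMaximalDyckPath.isDyckPath m)))
free-vertical (x ∷ w) m = freeEdges (x ∷ w) (forwards (x ∷ w) m)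

free-horizontal : ∀ {d₁ d₂} w → IsMaximalDyckPath d₁ d₂ w → FreeEdges isEast (not ∘ isEast) d₁ d₂ w
free-horizontal []      m = freeEdges-[] (sym (IsDyckPath.ends-east (IsMaximalDyckPath.isDyckPath m)))
free-horizontal (x ∷ w) m = freeEdges (x ∷ w) (backwards (x ∷ w) m)

-- The recursion

open Series Poly-commutativeRing
private module ℙ = CommutativeRing Poly-commutativeRing
open import Relation.Binary.Reasoning.Setoid ℙ.setoid

∑-++ : ∀ fs gs → ∑ (fs ++ gs) ≋ ∑ fs +ᵖ ∑ gs
∑-++ []       gs = ℙ.refl
∑-++ (f ∷ fs) gs = ℙ.trans (ℙ.+-congˡ {f} (∑-++ fs gs)) (ℙ.sym (ℙ.+-assoc f (∑ fs) (∑ gs)))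

module _ {a} {A : Set a} where

  ∑-cong : ∀ {f g : A → Poly} xs → (∀ x → f x ≋ g x) → ∑ (List.map f xs) ≋ ∑ (List.map g xs)
  ∑-cong []       eq = ℙ.refl
  ∑-cong (x ∷ xs) eq = ℙ.+-cong (eq x) (∑-cong xs eq)

  ∑-0 : ∀ {f : A → Poly} xs → (∀ x → f x ≋ 0ᵖ) → ∑ (List.map f xs) ≋ 0ᵖ
  ∑-0 []       eq = ℙ.refl
  ∑-0 (x ∷ xs) eq = ℙ.+-cong (eq x) (∑-0 xs eq)

  ∑-*ˡ : ∀ r (f : A → Poly) xs → ∑ (List.map (λ x → r *ᵖ f x) xs) ≋ r *ᵖ ∑ (List.map f xs)
  ∑-*ˡ r f []       = ℙ.sym (ℙ.zeroʳ r)
  ∑-*ˡ r f (x ∷ xs) = ℙ.trans (ℙ.+-congˡ {r *ᵖ f x} (∑-*ˡ r f xs)) (ℙ.sym (ℙ.distribˡ r (f x) _))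

  ∑-concatMap : ∀ {b} {B : Set b} (f : B → Poly) (g : A → List B) xs →
    ∑ (List.map f (concatMap g xs)) ≋ ∑ (List.map (λ x → ∑ (List.map f (g x))) xs)
  ∑-concatMap f g []       = ℙ.refl
  ∑-concatMap f g (x ∷ xs) = ℙ.trans (≡⇒≋ (cong ∑ (List.map-++ f (g x) (concatMap g xs))))
    (ℙ.trans (∑-++ (List.map f (g x)) _) (ℙ.+-congˡ {∑ (List.map f (g x))} (∑-concatMap f g xs)))

  ∑-filter : ∀ {p} {P : A → Set p} (P? : ∀ x → Dec (P x)) (f : A → Poly) xs →
    ∑ (List.map f (filter P? xs)) ≋ ∑ (List.map (λ x → if does (P? x) then f x else 0ᵖ) xs)
  ∑-filter P? f []       = ℙ.refl
  ∑-filter P? f (x ∷ xs) with does (P? x)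
  ... | true  = ℙ.+-congˡ {f x} (∑-filter P? f xs)
  ... | false = ∑-filter P? f xs

∑-upTo : ∀ h n → ∑ (List.map h (upTo n)) ≋ sum< h n
∑-upTo h n = go id n
  where
  go : ∀ e n → ∑ (List.map h (applyUpTo e n)) ≋ sum< (h ∘ e) n
  go e zero    = ℙ.refl
  go e (suc n) = ℙ.trans (ℙ.+-congˡ {h (e 0)} (go (e ∘ suc) n)) (ℙ.sym (sum<-head (h ∘ e) n))

sum<-cong : ∀ {h h′} n → (∀ k → k ℕ.< n → h k ≋ h′ k) → sum< h n ≋ sum< h′ n
sum<-cong zero    eq = ℙ.refl
sum<-cong (suc n) eq = ℙ.+-cong (sum<-cong n λ k k<n → eq k (ℕ.m≤n⇒m≤1+n k<n)) (eq n ℕ.≤-refl)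

sum<-0 : ∀ {h} m i → (∀ k → m ℕ.≤ k → h k ≋ 0ᵖ) → sum< h (i ℕ.+ m) ≋ sum< h m
sum<-0 m zero    eq = ℙ.refl
sum<-0 {h} m (suc i) eq = ℙ.trans (ℙ.+-cong (sum<-0 m i eq) (eq (i ℕ.+ m) (ℕ.m≤n+m m i))) (ℙ.+-identityʳ (sum< h m))

-- Powers and inverses of the generating series

π-pow : ∀ m f n → π m f n ≋ pow m f n
π-pow zero    f zero    = ℙ.refl
π-pow zero    f (suc n) = ℙ.refl
π-pow (suc m) f n = begin
  ∑ (List.map (λ k → f k *ᵖ π m f (n ∸ k)) (upTo (suc n)))  ≈⟨ ∑-upTo (λ k → f k *ᵖ π m f (n ∸ k)) (suc n) ⟩
  sum< (λ k → f k *ᵖ π m f (n ∸ k)) (suc n)                 ≈⟨ dconv-sum< (λ k j → f k *ᵖ π m f j) n ⟨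
  conv f (π m f) n                                          ≈⟨ conv-cong {f} {f} {π m f} {pow m f} n (λ _ → ℙ.refl) (π-pow m f) ⟩
  conv f (pow m f) n                                        ∎

conv-inverse : ∀ f → f 0 ≋ 1ᵖ → ∀ n → conv f (inverse f) n ≋ δ n
conv-inverse f f0≋1 zero    = ℙ.trans (ℙ.*-congʳ {1ᵖ} f0≋1) (ℙ.*-identityˡ 1ᵖ)
conv-inverse f f0≋1 n@(suc _) = begin
  conv f (inverse f) n                                 ≈⟨ dconv-flip (λ k j → f k *ᵖ inverse f j) n ⟩
  dconv (λ k j → f j *ᵖ inverse f k) n                 ≈⟨ dconv-sum< (λ k j → f j *ᵖ inverse f k) n ⟩
  sum< h n +ᵖ f (n ∸ n) *ᵖ (-ᵖ inverse-partial f n n)  ≈⟨ ℙ.+-cong (partial n) (ℙ.*-congʳ { -ᵖ inverse-partial f n n}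
                                                            (ℙ.trans (≡⇒≋ (cong f (ℕ.n∸n≡0 n))) f0≋1)) ⟩
  inverse-partial f n n +ᵖ 1ᵖ *ᵖ (-ᵖ inverse-partial f n n)  ≈⟨ ℙ.+-congˡ {inverse-partial f n n} (ℙ.*-identityˡ _) ⟩
  inverse-partial f n n +ᵖ (-ᵖ inverse-partial f n n)        ≈⟨ ℙ.-‿inverseʳ (inverse-partial f n n) ⟩
  0ᵖ                                                   ∎
  where
  h : ℕ → Poly
  h i = f (n ∸ i) *ᵖ inverse f i
  partial : ∀ j → sum< h j ≋ inverse-partial f n j
  partial zero    = ℙ.refl
  partial (suc j) = ℙ.+-congʳ {h j} (partial j)

-- The convention for negative exponents amounts to the exponent 0, just as the number of free edges
-- is cut off at 0.
ς-inverse : ∀ z f n → ς z f n ≋ inverse (π [ z ]₊ f) n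
ς-inverse (+ m)    f n       = ℙ.refl
ς-inverse -[1+ m ] f zero    = ℙ.refl
ς-inverse -[1+ m ] f (suc n) = ℙ.sym (begin
  inverse (π 0 f) (suc n)                 ≈⟨ conv-δʳ (inverse (π 0 f)) (suc n) ⟨
  conv (inverse (π 0 f)) δ (suc n)        ≈⟨ conv-comm (inverse (π 0 f)) δ (suc n) ⟩
  conv δ (inverse (π 0 f)) (suc n)        ≈⟨ conv-cong {δ} {π 0 f} {inverse (π 0 f)} {inverse (π 0 f)} (suc n)
                                               (λ i → ℙ.sym (π-pow 0 f i)) (λ _ → ℙ.refl) ⟩
  conv (π 0 f) (inverse (π 0 f)) (suc n)  ≈⟨ conv-inverse (π 0 f) ℙ.refl (suc n) ⟩
  0ᵖ                                      ∎)

[]₊-∸ : ∀ d q → [ d ℤ.- + q ]₊ ≡ [ d ]₊ ∸ q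
[]₊-∸ (+ m) q with q ℕ.≤? m
... | yes q≤m = cong [_]₊ (trans (ℤ.m-n≡m⊖n m q) (ℤ.⊖-≥ {m} {q} q≤m))
... | no q≰m = trans (trans (cong [_]₊ (trans (ℤ.m-n≡m⊖n m q) (ℤ.⊖-< {m} {q} m<q))) (negative (q ∸ m)))
                 (sym (ℕ.m≤n⇒m∸n≡0 {m} {q} (ℕ.<⇒≤ m<q)))
  where
  m<q = ℕ.≰⇒> q≰m
  negative : ∀ k → [ ℤ.- + k ]₊ ≡ 0
  negative zero    = refl
  negative (suc k) = refl
[]₊-∸ -[1+ m ] zero    = refl
[]₊-∸ -[1+ m ] (suc q) = refl

conv-pow-ς : ∀ d q f → f 0 ≋ 1ᵖ → ∀ n → conv (pow ([ d ]₊ ∸ q) f) (ς (d ℤ.- + q) f) n ≋ δ n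
conv-pow-ς d q f f0≋1 n = begin
  conv (pow m f) (ς z f) n             ≈⟨ conv-cong {pow m f} {π m f} {ς z f} {inverse (π m f)} n (λ i → ℙ.sym (π-pow m f i))
                                            (λ i → ℙ.trans (ς-inverse z f i) (≡⇒≋ (cong (λ m → inverse (π m f) i) ([]₊-∸ d q)))) ⟩
  conv (π m f) (inverse (π m f)) n     ≈⟨ conv-inverse (π m f) (ℙ.trans (π-pow m f 0) (pow-0 m f0≋1)) n ⟩
  δ n                                  ∎
  where
  z = d ℤ.- + q
  m = [ d ]₊ ∸ q

ς-0 : ∀ z f → ς z f 0 ≡ 1ᵖ
ς-0 (+ m)    f = refl
ς-0 -[1+ m ] f = refl

-- A condition on the listed terms: stronger than nonnegative coefficients, but visibly preserved by
-- sums and products.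
Nonneg : Poly → Set
Nonneg = All (λ (a , _) → 0ℤ ℤ.≤ a)

Nonneg⇒0≤coeff : ∀ e {f} → Nonneg f → 0ℤ ℤ.≤ coeff e f
Nonneg⇒0≤coeff e All.[] = ℤ.≤-refl
Nonneg⇒0≤coeff e {(a , e′) ∷ f} (0≤a All.∷ 0≤f) with does (e ↭? e′)
... | true  = ℤ.+-mono-≤ 0≤a (Nonneg⇒0≤coeff e 0≤f)
... | false = ℤ.+-mono-≤ (ℤ.≤-refl {0ℤ}) (Nonneg⇒0≤coeff e 0≤f)

Nonneg-* : ∀ {f g} → Nonneg f → Nonneg g → Nonneg (f *ᵖ g)
Nonneg-* All.[]            0≤g = All.[]
Nonneg-* {(+ a , e) ∷ f} (0≤a All.∷ 0≤f) 0≤g = All.++⁺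
  (All.map⁺ (All.map (λ {(b , _)} 0≤b → subst (ℤ._≤ + a ℤ.* b) (ℤ.*-zeroʳ (+ a)) (ℤ.*-monoˡ-≤-nonNeg (+ a) 0≤b)) 0≤g))
  (Nonneg-* 0≤f 0≤g)

Nonneg-dconv : ∀ {H} n → (∀ k j → Nonneg (H k j)) → Nonneg (dconv H n)
Nonneg-dconv zero    0≤H = 0≤H 0 0
Nonneg-dconv (suc n) 0≤H = All.++⁺ (0≤H 0 (suc n)) (Nonneg-dconv n (0≤H ∘ suc))

Nonneg-T : ∀ χ {f g} → (∀ k → Nonneg (f k)) → (∀ k → Nonneg (g k)) → ∀ w Φ → (∀ ω → Nonneg (Φ ω)) → ∀ a b → Nonneg (T χ f g w Φ a b)
Nonneg-T χ 0≤f 0≤g []      Φ 0≤Φ zero    zero    = 0≤Φ []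
Nonneg-T χ 0≤f 0≤g []      Φ 0≤Φ zero    (suc _) = All.[]
Nonneg-T χ 0≤f 0≤g []      Φ 0≤Φ (suc _) _       = All.[]
Nonneg-T χ 0≤f 0≤g (x ∷ w) Φ 0≤Φ a b with χ x
... | true  = Nonneg-dconv a λ k j → Nonneg-* (0≤f k) (Nonneg-T χ 0≤f 0≤g w _ (λ ω → 0≤Φ (k ∷ ω)) j b)
... | false = Nonneg-dconv b λ k j → Nonneg-* (0≤g k) (Nonneg-T χ 0≤f 0≤g w _ (λ ω → 0≤Φ (k ∷ ω)) a j)

Nonneg-1 : Nonneg 1ᵖ
Nonneg-1 = ℤ.+≤+ z≤n All.∷ All.[]

Nonneg-if : ∀ b → Nonneg (if b then 1ᵖ else 0ᵖ)
Nonneg-if true  = Nonneg-1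
Nonneg-if false = All.[]

Nonneg-p₁ : ∀ ℓ k → Nonneg (p₁• ℓ k)
Nonneg-p₁ ℓ zero    = Nonneg-1
Nonneg-p₁ ℓ k@(suc _) with k ≤∞ᵇ ℓ
... | true  = ℤ.+≤+ z≤n All.∷ All.[]
... | false = All.[]

Nonneg-p₂ : ∀ ℓ k → Nonneg (p₂• ℓ k)
Nonneg-p₂ ℓ zero    = Nonneg-1
Nonneg-p₂ ℓ k@(suc _) with k ≤∞ᵇ ℓ
... | true  = ℤ.+≤+ z≤n All.∷ All.[]
... | false = All.[]

T-zero-degree : ∀ χ {f g} → f 0 ≋ 1ᵖ → g 0 ≋ 1ᵖ → ∀ w Φ → T χ f g w Φ 0 0 ≋ Φ (Vec.replicate (length w) 0)
T-zero-degree χ f0 g0 []      Φ = ℙ.refl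
T-zero-degree χ {f} {g} f0 g0 (x ∷ w) Φ with χ x
... | true  = ℙ.trans (ℙ.*-cong f0 (T-zero-degree χ f0 g0 w (Φ ∘ (0 ∷_)))) (ℙ.*-identityˡ _)
... | false = ℙ.trans (ℙ.*-cong g0 (T-zero-degree χ f0 g0 w (Φ ∘ (0 ∷_)))) (ℙ.*-identityˡ _)

-- Grading sums sorted by vertical and horizontal degree

module _ (ℓ₁ ℓ₂ : ℕ≥1∪∞) where

  weight : (w : Path) → Grading w → Poly
  weight []          []      = 1ᵖ
  weight (east  ∷ w) (k ∷ ω) = p₂• ℓ₂ k *ᵖ weight w ω
  weight (north ∷ w) (k ∷ ω) = p₁• ℓ₁ k *ᵖ weight w ω

  wt≡weight : ∀ w ω → wt ℓ₁ ℓ₂ w ω ≡ weight w ω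
  wt≡weight w ω = go _ (λ _ → refl) (λ _ → refl) w ω
    where
    -- The local function in `wt` formally depends on the whole path and grading, so the induction
    -- abstracts from it, keeping its two values.
    go : ∀ (F : Step → ℕ → Poly) → (∀ k → F east k ≡ p₂• ℓ₂ k) → (∀ k → F north k ≡ p₁• ℓ₁ k) →
         ∀ w (ω : Grading w) → ∏ (Vec.toList (Vec.zipWith F (fromList w) ω)) ≡ weight w ω
    go F east-eq north-eq []          []      = refl
    go F east-eq north-eq (east  ∷ w) (k ∷ ω) = cong₂ _*ᵖ_ (east-eq k) (go F east-eq north-eq w ω)
    go F east-eq north-eq (north ∷ w) (k ∷ ω) = cong₂ _*ᵖ_ (north-eq k) (go F east-eq north-eq w ω)

  term-of : (w : Path) (Φ : Grading w → Poly) (p q : ℕ) → Grading w → Poly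
  term-of w Φ p q ω = if does (hasDegree? w p q ω) then weight w ω *ᵖ Φ ω else 0ᵖ

  term-of-cong : ∀ {w₁ w₂ Φ₁ Φ₂ a₁ a₂ b₁ b₂} {ω₁ : Grading w₁} {ω₂ : Grading w₂} r →
    (HasDegree w₁ a₁ b₁ ω₁ → HasDegree w₂ a₂ b₂ ω₂) → (HasDegree w₂ a₂ b₂ ω₂ → HasDegree w₁ a₁ b₁ ω₁) →
    weight w₁ ω₁ *ᵖ Φ₁ ω₁ ≋ r *ᵖ (weight w₂ ω₂ *ᵖ Φ₂ ω₂) →
    term-of w₁ Φ₁ a₁ b₁ ω₁ ≋ r *ᵖ term-of w₂ Φ₂ a₂ b₂ ω₂
  term-of-cong {w₁} {w₂} {Φ₁} {Φ₂} {a₁} {a₂} {b₁} {b₂} {ω₁} {ω₂} r to from eq =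
    ℙ.trans (≡⇒≋ (cong (if_then weight w₁ ω₁ *ᵖ Φ₁ ω₁ else 0ᵖ) (does-⇔ (mk⇔ to from) (hasDegree? w₁ a₁ b₁ ω₁) (hasDegree? w₂ a₂ b₂ ω₂))))
      (branch (does (hasDegree? w₂ a₂ b₂ ω₂)))
    where
    branch : ∀ b → (if b then weight w₁ ω₁ *ᵖ Φ₁ ω₁ else 0ᵖ) ≋ r *ᵖ (if b then weight w₂ ω₂ *ᵖ Φ₂ ω₂ else 0ᵖ)
    branch true  = eq
    branch false = ℙ.sym (ℙ.zeroʳ r)

  term-of-0 : ∀ {w Φ p q} {ω : Grading w} → ¬ HasDegree w p q ω → term-of w Φ p q ω ≋ 0ᵖ
  term-of-0 {w} {Φ} {p} {q} {ω} ¬deg = ≡⇒≋ (cong (if_then weight w ω *ᵖ Φ ω else 0ᵖ) (dec-false (hasDegree? w p q ω) ¬deg))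

  -- The list is organised by total degree p + q and admits first weights up to p + q; those above p
  -- on a vertical edge, or above q on a horizontal one, fail the degree test and drop out.
  ∑-vectorsOfSum : ∀ w Φ p q → ∑ (List.map (term-of w Φ p q) (vectorsOfSum (length w) (p ℕ.+ q))) ≋
                               T (not ∘ isEast) (p₁• ℓ₁) (p₂• ℓ₂) w Φ p q
  ∑-vectorsOfSum [] Φ zero    zero    = ℙ.trans (ℙ.+-identityʳ _) (ℙ.*-identityˡ (Φ []))
  ∑-vectorsOfSum [] Φ zero    (suc q) = ℙ.refl
  ∑-vectorsOfSum [] Φ (suc p) q       = ℙ.refl
  ∑-vectorsOfSum (x ∷ w) Φ p q = begin
    ∑ (List.map t₀ (vectorsOfSum (suc (length w)) s))
      ≈⟨ ∑-concatMap t₀ (λ k → List.map (k ∷_) (V k)) (upTo (suc s)) ⟩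
    ∑ (List.map (λ k → ∑ (List.map t₀ (List.map (k ∷_) (V k)))) (upTo (suc s)))
      ≈⟨ ∑-upTo (λ k → ∑ (List.map t₀ (List.map (k ∷_) (V k)))) (suc s) ⟩
    sum< (λ k → ∑ (List.map t₀ (List.map (k ∷_) (V k)))) (suc s)
      ≈⟨ sum<-cong (suc s) (λ k _ → ≡⇒≋ (cong ∑ (sym (List.map-∘ (V k))))) ⟩
    sum< (λ k → ∑ (List.map (t₀ ∘ (k ∷_)) (V k))) (suc s)
      ≈⟨ split x ⟩
    T (not ∘ isEast) (p₁• ℓ₁) (p₂• ℓ₂) (x ∷ w) Φ p q ∎
    where
    s = p ℕ.+ q
    t₀ = term-of (x ∷ w) Φ p q
    V : ℕ → List (Grading w)
    V k = vectorsOfSum (length w) (s ∸ k)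
    split : ∀ x → sum< (λ k → ∑ (List.map (term-of (x ∷ w) Φ p q ∘ (k ∷_)) (V k))) (suc s) ≋
                  T (not ∘ isEast) (p₁• ℓ₁) (p₂• ℓ₂) (x ∷ w) Φ p q
    split north = begin
      sum< h (suc (p ℕ.+ q))       ≈⟨ ≡⇒≋ (cong (sum< h) (trans (cong suc (ℕ.+-comm p q)) (sym (ℕ.+-suc q p)))) ⟩
      sum< h (q ℕ.+ suc p)         ≈⟨ sum<-0 {h} (suc p) q (λ k p<k → ∑-0 (V k) λ ω → term-of-0 {north ∷ w} {Φ}
                                        λ (dp , _) → ℕ.<⇒≱ p<k (ℕ.≤-trans (ℕ.m≤m+n k _) (ℕ.≤-reflexive dp))) ⟩
      sum< h (suc p)               ≈⟨ sum<-cong (suc p) (λ k k≤p → summand k (ℕ.≤-pred k≤p)) ⟩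
      sum< (λ k → H k (p ∸ k)) (suc p)  ≈⟨ dconv-sum< H p ⟨
      dconv H p                    ∎
      where
      h : ℕ → Poly
      h k = ∑ (List.map (term-of (north ∷ w) Φ p q ∘ (k ∷_)) (V k))
      H : ℕ → ℕ → Poly
      H k j = p₁• ℓ₁ k *ᵖ T (not ∘ isEast) (p₁• ℓ₁) (p₂• ℓ₂) w (Φ ∘ (k ∷_)) j q
      summand : ∀ k → k ℕ.≤ p → h k ≋ H k (p ∸ k)
      summand k k≤p = begin
        h k ≈⟨ ∑-cong (V k) (λ ω → term-of-cong {north ∷ w} {w} {Φ} {Φ ∘ (k ∷_)} {p} {p ∸ k} {q} {q} (p₁• ℓ₁ k)
                 (λ (dp , dq) → trans (sym (ℕ.m+n∸m≡n k _)) (cong (_∸ k) dp) , dq)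
                 (λ (dp , dq) → trans (cong (k ℕ.+_) dp) (ℕ.m+[n∸m]≡n k≤p) , dq)
                 (≡⇒≋ (*ᵖ-assoc (p₁• ℓ₁ k) (weight w ω) (Φ (k ∷ ω))))) ⟩
        ∑ (List.map (λ ω → p₁• ℓ₁ k *ᵖ t ω) (V k)) ≈⟨ ∑-*ˡ (p₁• ℓ₁ k) t (V k) ⟩
        p₁• ℓ₁ k *ᵖ ∑ (List.map t (V k)) ≈⟨ ℙ.*-congˡ {p₁• ℓ₁ k} (ℙ.trans
          (≡⇒≋ (cong (λ s → ∑ (List.map t (vectorsOfSum (length w) s))) (ℕ.+-∸-comm q k≤p)))
          (∑-vectorsOfSum w (Φ ∘ (k ∷_)) (p ∸ k) q)) ⟩
        H k (p ∸ k) ∎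
        where
        t = term-of w (Φ ∘ (k ∷_)) (p ∸ k) q
    split east = begin
      sum< h (suc (p ℕ.+ q))       ≈⟨ ≡⇒≋ (cong (sum< h) (sym (ℕ.+-suc p q))) ⟩
      sum< h (p ℕ.+ suc q)         ≈⟨ sum<-0 {h} (suc q) p (λ k q<k → ∑-0 (V k) λ ω → term-of-0 {east ∷ w} {Φ}
                                        λ (_ , dq) → ℕ.<⇒≱ q<k (ℕ.≤-trans (ℕ.m≤m+n k _) (ℕ.≤-reflexive dq))) ⟩
      sum< h (suc q)               ≈⟨ sum<-cong (suc q) (λ k k≤q → summand k (ℕ.≤-pred k≤q)) ⟩
      sum< (λ k → H k (q ∸ k)) (suc q)  ≈⟨ dconv-sum< H q ⟨
      dconv H q                    ∎
      where
      h : ℕ → Poly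
      h k = ∑ (List.map (term-of (east ∷ w) Φ p q ∘ (k ∷_)) (V k))
      H : ℕ → ℕ → Poly
      H k j = p₂• ℓ₂ k *ᵖ T (not ∘ isEast) (p₁• ℓ₁) (p₂• ℓ₂) w (Φ ∘ (k ∷_)) p j
      summand : ∀ k → k ℕ.≤ q → h k ≋ H k (q ∸ k)
      summand k k≤q = begin
        h k ≈⟨ ∑-cong (V k) (λ ω → term-of-cong {east ∷ w} {w} {Φ} {Φ ∘ (k ∷_)} {p} {p} {q} {q ∸ k} (p₂• ℓ₂ k)
                 (λ (dp , dq) → dp , trans (sym (ℕ.m+n∸m≡n k _)) (cong (_∸ k) dq))
                 (λ (dp , dq) → dp , trans (cong (k ℕ.+_) dq) (ℕ.m+[n∸m]≡n k≤q))
                 (≡⇒≋ (*ᵖ-assoc (p₂• ℓ₂ k) (weight w ω) (Φ (k ∷ ω))))) ⟩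
        ∑ (List.map (λ ω → p₂• ℓ₂ k *ᵖ t ω) (V k)) ≈⟨ ∑-*ˡ (p₂• ℓ₂ k) t (V k) ⟩
        p₂• ℓ₂ k *ᵖ ∑ (List.map t (V k)) ≈⟨ ℙ.*-congˡ {p₂• ℓ₂ k} (ℙ.trans
          (≡⇒≋ (cong (λ s → ∑ (List.map t (vectorsOfSum (length w) s))) (ℕ.+-∸-assoc p k≤q)))
          (∑-vectorsOfSum w (Φ ∘ (k ∷_)) p (q ∸ k))) ⟩
        H k (q ∸ k) ∎
        where
        t = term-of w (Φ ∘ (k ∷_)) p (q ∸ k)

  ⟦compatible⟧ : (w : Path) → Grading w → Poly
  ⟦compatible⟧ w ω = if does (compatible? w ω) then 1ᵖ else 0ᵖ

  gradingSum-T : ∀ w p q → gradingSum ℓ₁ ℓ₂ w p q ≋ T (not ∘ isEast) (p₁• ℓ₁) (p₂• ℓ₂) w (⟦compatible⟧ w) p q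
  gradingSum-T w p q = ℙ.trans (∑-filter (λ ω → hasDegree? w p q ω ×-dec compatible? w ω) (wt ℓ₁ ℓ₂ w) (vectorsOfSum (length w) (p ℕ.+ q)))
    (ℙ.trans (∑-cong (vectorsOfSum (length w) (p ℕ.+ q)) λ ω →
        ℙ.trans (≡⇒≋ (cong (if does (hasDegree? w p q ω) ∧ does (compatible? w ω) then_else 0ᵖ) (wt≡weight w ω)))
          (split (does (hasDegree? w p q ω)) (does (compatible? w ω)) (weight w ω)))
      (∑-vectorsOfSum w (⟦compatible⟧ w) p q))
    where
    split : ∀ x y f → (if x ∧ y then f else 0ᵖ) ≋ (if x then f *ᵖ (if y then 1ᵖ else 0ᵖ) else 0ᵖ)
    split true  true  f = ℙ.sym (ℙ.*-identityʳ f)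
    split true  false f = ℙ.sym (ℙ.zeroʳ f)
    split false y     f = ℙ.refl

all-zero⇒deg≡0 : ∀ χ w (ω : Grading w) → (∀ i → lookup ω i ≡ 0) → deg χ w ω ≡ 0
all-zero⇒deg≡0 χ []      []      eq = refl
all-zero⇒deg≡0 χ (x ∷ w) (k ∷ ω) eq with χ x
... | true  = cong₂ ℕ._+_ (eq Fin.zero) (all-zero⇒deg≡0 χ w ω (eq ∘ Fin.suc))
... | false = all-zero⇒deg≡0 χ w ω (eq ∘ Fin.suc)

deg≢0⇒nonzero : ∀ χ w (ω : Grading w) → deg χ w ω ≢ 0 → ∃ λ i → lookup ω i ≢ 0
deg≢0⇒nonzero χ w ω deg≢0 with Fin.any? (λ i → ¬? (lookup ω i ℕ.≟ 0))
... | yes nonzero = nonzero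
... | no ¬nonzero = ⊥-elim (deg≢0 (all-zero⇒deg≡0 χ w ω λ i → decidable-stable (lookup ω i ℕ.≟ 0) λ ≢0 → ¬nonzero (i , ≢0)))

-- When χ selects the vertical edges, its complement `not ∘ not ∘ isEast` does not reduce to
-- `isEast`.
deg-not-not : ∀ χ w (ω : Grading w) → deg (not ∘ not ∘ χ) w ω ≡ deg χ w ω
deg-not-not χ []      []      = refl
deg-not-not χ (x ∷ w) (k ∷ ω) with χ x
... | true  = cong (k ℕ.+_) (deg-not-not χ w ω)
... | false = deg-not-not χ w ω

-- Half of the recursion: the part of the sum over compatible gradings that
-- vanishes on the free edges selected by χ.
module Reduced (χ χ̄ : Step → Bool) {d d′ : ℕ} (w : Path) (edges : FreeEdges χ χ̄ d d′ w)
               (χ̄≡ : ∀ ω → deg χ̄ w ω ≡ deg (not ∘ χ) w ω)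
               (Φ : Grading w → Poly) (Φ≡ : ∀ ω → Φ ω ≡ (if does (compatible? w ω) then 1ᵖ else 0ᵖ))
               (f g : Seq) (f0 : f 0 ≋ 1ᵖ) where
  open FreeEdges edges

  reduced : ℕ → ℕ → Poly
  reduced = T χ f g w λ ω → restrict χ f g (free ω) Φ ω

  Φ-agree : ∀ ω ω′ → AgreeOff (free ω) ω ω′ → Φ ω ≡ Φ ω′
  Φ-agree ω ω′ agree = trans (Φ≡ ω) (trans (cong (if_then 1ᵖ else 0ᵖ)
      (does-⇔ (mk⇔ (proj₂ (free-agree ω ω′ agree)) (proj₂ (free-agree ω′ ω agree′))) (compatible? w ω) (compatible? w ω′)))
      (sym (Φ≡ ω′)))
    where
    agree′ : AgreeOff (free ω′) ω′ ω
    agree′ i i∉ = sym (agree i (trans (cong (λ S → lookup S i) (proj₁ (free-agree ω ω′ agree))) i∉))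

  divide : ∀ b {s : Seq} → (∀ n → conv (pow (d ∸ b) f) s n ≋ δ n) → ∀ a →
           conv (λ i → T χ f g w Φ i b) s a ≋ reduced a b
  divide b {s} = conv-divide {λ i → T χ f g w Φ i b} {λ i → reduced i b} {pow (d ∸ b) f} {s} λ i →
    T-free χ f g f0 w free Φ d free⊆ (λ ω → trans (free-count ω) (cong (d ∸_) (χ̄≡ ω)))
      (λ ω ω′ agree → proj₁ (free-agree ω ω′ agree) , ≡⇒≋ (Φ-agree ω ω′ agree)) i b

  Nonneg-reduced : (∀ k → Nonneg (f k)) → (∀ k → Nonneg (g k)) → ∀ a b → Nonneg (reduced a b)
  Nonneg-reduced 0≤f 0≤g = Nonneg-T χ 0≤f 0≤g w _ λ ω → nonneg ω (ZeroOn (free ω) ω)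
    where
    nonneg : ∀ ω z → Nonneg (if z then Φ ω else 0ᵖ)
    nonneg ω false = All.[]
    nonneg ω true  = subst Nonneg (sym (Φ≡ ω)) (Nonneg-if (does (compatible? w ω)))

  -- A surviving summand would come from a compatible grading that vanishes on its free edges and,
  -- its degree being nontrivial, is nonzero; this forces the slope inequality.
  reduced-0 : ∀ {a b} → ¬ (a ≡ 0 × b ≡ 0) → ¬ (d ℕ.* a ℕ.< d′ ℕ.* b) → reduced a b ≋ 0ᵖ
  reduced-0 {a} {b} nontrivial ¬slope = ℙ.trans (T-cong χ f g w a b vanish) (T-0 χ f g w a b)
    where
    vanish : ∀ ω → deg χ w ω ≡ a → deg (not ∘ χ) w ω ≡ b → restrict χ f g (free ω) Φ ω ≋ 0ᵖ
    vanish ω da db with ZeroOn (free ω) ω in zeroOn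
    ... | false = ℙ.refl
    ... | true  = ≡⇒≋ (trans (Φ≡ ω) (cong (if_then 1ᵖ else 0ᵖ) (dec-false (compatible? w ω) λ compatible →
            ¬slope (subst₂ (λ x y → d ℕ.* x ℕ.< d′ ℕ.* y) da (trans (χ̄≡ ω) db) (slope ω compatible zeroOn nonzero)))))
      where
      nonzero : ∃ λ i → lookup ω i ≢ 0
      nonzero with a ℕ.≟ 0
      ... | no a≢0  = deg≢0⇒nonzero χ w ω (λ eq → a≢0 (trans (sym da) eq))
      ... | yes a≡0 = deg≢0⇒nonzero (not ∘ χ) w ω (λ eq → nontrivial (a≡0 , trans (sym db) eq))

-- Comparison of the recursion with the grading sum

c-step : ∀ ℓ₁ ℓ₂ d₁ d₂ p q → ¬ (p ≡ 0 × q ≡ 0) →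
         c ℓ₁ ℓ₂ d₁ d₂ p q ≡ T-max (c-sum₁ ℓ₁ ℓ₂ d₁ d₂ p p q) (c-sum₂ ℓ₁ ℓ₂ d₁ d₂ p q q)
c-step ℓ₁ ℓ₂ d₁ d₂ zero    zero    nontrivial = ⊥-elim (nontrivial (refl , refl))
c-step ℓ₁ ℓ₂ d₁ d₂ zero    (suc q) nontrivial = refl
c-step ℓ₁ ℓ₂ d₁ d₂ (suc p) q       nontrivial = refl

-- Nonnegative remainders put both candidates at or below x, and a vanishing remainder makes one of
-- them attain it.
⊔-from-remainders : ∀ {x a b r s} → x ≡ r ℤ.+ a → x ≡ s ℤ.+ b → 0ℤ ℤ.≤ r → 0ℤ ℤ.≤ s → r ≡ 0ℤ ⊎ s ≡ 0ℤ → a ℤ.⊔ b ≡ x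
⊔-from-remainders {x} {a} {b} x≡r+a x≡s+b 0≤r 0≤s (inj₁ refl) = trans (ℤ.i≥j⇒i⊔j≡i b≤a) (sym x≡a)
  where
  x≡a = trans x≡r+a (ℤ.+-identityˡ a)
  b≤a : b ℤ.≤ a
  b≤a = subst₂ ℤ._≤_ (ℤ.+-identityˡ b) (trans (sym x≡s+b) x≡a) (ℤ.+-monoˡ-≤ b 0≤s)
⊔-from-remainders {x} {a} {b} x≡r+a x≡s+b 0≤r 0≤s (inj₂ refl) = trans (ℤ.i≤j⇒i⊔j≡j a≤b) (sym x≡b)
  where
  x≡b = trans x≡s+b (ℤ.+-identityˡ b)
  a≤b : a ℤ.≤ b
  a≤b = subst₂ ℤ._≤_ (ℤ.+-identityˡ a) (trans (sym x≡r+a) x≡b) (ℤ.+-monoˡ-≤ a 0≤r)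

module _ (ℓ₁ ℓ₂ : ℕ≥1∪∞) (d₁ d₂ : ℤ) where

  private
    w : Path
    w = 𝒫 [ d₁ ]₊ [ d₂ ]₊
    f g : Seq
    f = p₁• ℓ₁
    g = p₂• ℓ₂
    Φ : Grading w → Poly
    Φ = ⟦compatible⟧ ℓ₁ ℓ₂ w
    C X : ℕ → ℕ → Poly
    C = c ℓ₁ ℓ₂ d₁ d₂
    X = gradingSum ℓ₁ ℓ₂ w
    module Vert = Reduced (not ∘ isEast) isEast w (free-vertical w (𝒫-isMaximalDyckPath [ d₁ ]₊ [ d₂ ]₊))
                 (λ ω → sym (deg-not-not isEast w ω)) Φ (λ _ → refl) f g ℙ.refl
    module Horiz = Reduced isEast (not ∘ isEast) w (free-horizontal w (𝒫-isMaximalDyckPath [ d₁ ]₊ [ d₂ ]₊))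
                 (λ _ → refl) Φ (λ _ → refl) g f ℙ.refl

  X-T-vertical : ∀ p q → X p q ≋ T (not ∘ isEast) f g w Φ p q
  X-T-vertical = gradingSum-T ℓ₁ ℓ₂ w

  X-T-horizontal : ∀ p q → X p q ≋ T isEast g f w Φ q p
  X-T-horizontal p q = ℙ.trans (X-T-vertical p q) (ℙ.sym (T-swap isEast g f w Φ q p))

  -- In the convolution the last term is x(n)s(0) = x(n); solving for it leaves the negated sum that
  -- occurs in the recursion.
  remainder : ∀ {x y : ℕ → Poly} {s : Seq} {r} n → s 0 ≡ 1ᵖ → (∀ i → x i ≋ y i) → conv y s n ≋ r →
              x n ≋ r +ᵖ sum< (λ i → -ᵖ (x i *ᵖ s (n ∸ i))) n
  remainder {x} {y} {s} {r} n s0≡1 x≋y conv≋r = ℙ.sym (begin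
    r +ᵖ sum< (λ i → -ᵖ h i) n                           ≈⟨ ℙ.+-cong (ℙ.sym conv≋r) (negate n) ⟩
    conv y s n +ᵖ -ᵖ sum< h n                            ≈⟨ ℙ.+-congʳ { -ᵖ sum< h n} (conv-cong {y} {x} {s} {s} n (λ i → ℙ.sym (x≋y i)) (λ _ → ℙ.refl)) ⟩
    conv x s n +ᵖ -ᵖ sum< h n                            ≈⟨ ℙ.+-congʳ { -ᵖ sum< h n} (dconv-sum< (λ k j → x k *ᵖ s j) n) ⟩
    (sum< h n +ᵖ x n *ᵖ s (n ∸ n)) +ᵖ -ᵖ sum< h n        ≈⟨ ℙ.+-congʳ { -ᵖ sum< h n} (ℙ.+-congˡ {sum< h n} (ℙ.*-congˡ {x n}
                                                              (≡⇒≋ (trans (cong s (ℕ.n∸n≡0 n)) s0≡1)))) ⟩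
    (sum< h n +ᵖ x n *ᵖ 1ᵖ) +ᵖ -ᵖ sum< h n               ≈⟨ ℙ.+-congʳ { -ᵖ sum< h n} (ℙ.+-congˡ {sum< h n} (ℙ.*-identityʳ (x n))) ⟩
    (sum< h n +ᵖ x n) +ᵖ -ᵖ sum< h n                     ≈⟨ ℙ.+-congʳ { -ᵖ sum< h n} (ℙ.+-comm (sum< h n) (x n)) ⟩
    (x n +ᵖ sum< h n) +ᵖ -ᵖ sum< h n                     ≈⟨ ℙ.+-assoc (x n) (sum< h n) (-ᵖ sum< h n) ⟩
    x n +ᵖ (sum< h n +ᵖ -ᵖ sum< h n)                     ≈⟨ ℙ.+-congˡ {x n} (ℙ.-‿inverseʳ (sum< h n)) ⟩
    x n +ᵖ 0ᵖ                                            ≈⟨ ℙ.+-identityʳ (x n) ⟩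
    x n                                                  ∎)
    where
    h : ℕ → Poly
    h i = x i *ᵖ s (n ∸ i)
    negate : ∀ j → sum< (λ i → -ᵖ h i) j ≋ -ᵖ sum< h j
    negate zero    = ℙ.refl
    negate (suc j) = ℙ.trans (ℙ.+-congʳ { -ᵖ h j} (negate j)) (≡⇒≋ (sym (List.map-++ _ (sum< h j) (h j))))

  X-remainder₁ : ∀ p q → X p q ≋ Vert.reduced p q +ᵖ sum< (λ i → -ᵖ (X i q *ᵖ ς (d₂ ℤ.- + q) f (p ∸ i))) p
  X-remainder₁ p q = remainder {λ i → X i q} {λ i → T (not ∘ isEast) f g w Φ i q} {ς (d₂ ℤ.- + q) f} p
    (ς-0 (d₂ ℤ.- + q) f) (λ i → X-T-vertical i q) (Vert.divide q {ς (d₂ ℤ.- + q) f} (conv-pow-ς d₂ q f ℙ.refl) p)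

  X-remainder₂ : ∀ p q → X p q ≋ Horiz.reduced q p +ᵖ sum< (λ i → -ᵖ (X p i *ᵖ ς (d₁ ℤ.- + p) g (q ∸ i))) q
  X-remainder₂ p q = remainder {X p} {λ i → T isEast g f w Φ i p} {ς (d₁ ℤ.- + p) g} q
    (ς-0 (d₁ ℤ.- + p) g) (λ i → X-T-horizontal p i) (Horiz.divide p {ς (d₁ ℤ.- + p) g} (conv-pow-ς d₁ p g ℙ.refl) q)

  c-sum₁-X : ∀ p q → (∀ i → i ℕ.< p → C i q ≋ X i q) → ∀ j → j ℕ.≤ p →
    c-sum₁ ℓ₁ ℓ₂ d₁ d₂ p j q ≋ sum< (λ i → -ᵖ (X i q *ᵖ ς (d₂ ℤ.- + q) f (p ∸ i))) j
  c-sum₁-X p q IH zero    _   = ℙ.refl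
  c-sum₁-X p q IH (suc j) j<p = ℙ.+-cong (c-sum₁-X p q IH j (ℕ.<⇒≤ j<p)) (ℙ.-‿cong (ℙ.*-congʳ {ς (d₂ ℤ.- + q) f (p ∸ j)} (IH j j<p)))

  c-sum₂-X : ∀ p q → (∀ i → i ℕ.< q → C p i ≋ X p i) → ∀ j → j ℕ.≤ q →
    c-sum₂ ℓ₁ ℓ₂ d₁ d₂ p q j ≋ sum< (λ i → -ᵖ (X p i *ᵖ ς (d₁ ℤ.- + p) g (q ∸ i))) j
  c-sum₂-X p q IH zero    _   = ℙ.refl
  c-sum₂-X p q IH (suc j) j<q = ℙ.+-cong (c-sum₂-X p q IH j (ℕ.<⇒≤ j<q)) (ℙ.-‿cong (ℙ.*-congʳ {ς (d₁ ℤ.- + p) g (q ∸ j)} (IH j j<q)))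

  X-0 : X 0 0 ≋ 1ᵖ
  X-0 = ℙ.trans (X-T-vertical 0 0) (ℙ.trans (T-zero-degree (not ∘ isEast) {f} {g} ℙ.refl ℙ.refl w Φ)
    (≡⇒≋ (cong (if_then 1ᵖ else 0ᵖ) (dec-true (compatible? w _) λ u v _ _ 0<uv →
      ⊥-elim (ℕ.<⇒≢ 0<uv (sym (cong (ℕ._* _) (Vec.lookup-replicate u 0))))))))

  C-step : ∀ p q → ¬ (p ≡ 0 × q ≡ 0) → (∀ i → i ℕ.< p → C i q ≋ X i q) → (∀ i → i ℕ.< q → C p i ≋ X p i) → C p q ≋ X p q
  C-step p q nontrivial IH₁ IH₂ = mk≋ λ e → trans (cong (coeff e) (c-step ℓ₁ ℓ₂ d₁ d₂ p q nontrivial))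
    (trans (coeff-T-max e S₁ S₂) (⊔-from-remainders {coeff e (X p q)} {coeff e S₁} {coeff e S₂} {coeff e R₁} {coeff e R₂}
      (trans (coeffs X≋₁ e) (coeff-++ e R₁ S₁)) (trans (coeffs X≋₂ e) (coeff-++ e R₂ S₂))
      (Nonneg⇒0≤coeff e (Vert.Nonneg-reduced (Nonneg-p₁ ℓ₁) (Nonneg-p₂ ℓ₂) p q))
      (Nonneg⇒0≤coeff e (Horiz.Nonneg-reduced (Nonneg-p₂ ℓ₂) (Nonneg-p₁ ℓ₁) q p))
      (vanishing e)))
    where
    S₁ = c-sum₁ ℓ₁ ℓ₂ d₁ d₂ p p q
    S₂ = c-sum₂ ℓ₁ ℓ₂ d₁ d₂ p q q
    R₁ = Vert.reduced p q
    R₂ = Horiz.reduced q p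
    X≋₁ : X p q ≋ R₁ +ᵖ S₁
    X≋₁ = ℙ.trans (X-remainder₁ p q) (ℙ.+-congˡ {R₁} (ℙ.sym (c-sum₁-X p q IH₁ p ℕ.≤-refl)))
    X≋₂ : X p q ≋ R₂ +ᵖ S₂
    X≋₂ = ℙ.trans (X-remainder₂ p q) (ℙ.+-congˡ {R₂} (ℙ.sym (c-sum₂-X p q IH₂ q ℕ.≤-refl)))
    vanishing : ∀ e → coeff e R₁ ≡ 0ℤ ⊎ coeff e R₂ ≡ 0ℤ
    -- The slope inequalities required by the two remainders exclude each other, so a single
    -- comparison decides which one is zero for all e.
    vanishing e with [ d₂ ]₊ ℕ.* p ℕ.<? [ d₁ ]₊ ℕ.* q
    ... | no ¬slope = inj₁ (coeffs (Vert.reduced-0 nontrivial ¬slope) e)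
    ... | yes slope = inj₂ (coeffs (Horiz.reduced-0 (λ (q≡0 , p≡0) → nontrivial (p≡0 , q≡0)) (ℕ.<-asym slope)) e)

  C≋X : ∀ s p q → p ℕ.+ q ℕ.≤ s → C p q ≋ X p q
  C≋X s zero zero _ = ℙ.sym X-0
  C≋X (suc s) p@zero (suc q) le = C-step p (suc q) (λ ()) (λ _ ()) λ i i<q → C≋X s p i (ℕ.≤-pred (ℕ.≤-trans (ℕ.+-monoʳ-< p i<q) le))
  C≋X (suc s) (suc p) q le = C-step (suc p) q (λ ())
    (λ i i<p → C≋X s i q (ℕ.≤-pred (ℕ.≤-trans (ℕ.+-monoˡ-< q i<p) le)))
    (λ i i<q → C≋X s (suc p) i (ℕ.≤-pred (ℕ.≤-trans (ℕ.+-monoʳ-< (suc p) i<q) le)))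

series-cong : ∀ {a b} → (∀ p q → a p q ≈ b p q) → series a ≈ᴸ series b
series-cong eq (+ p)    (+ q)    = eq p q
series-cong eq (+ p)    -[1+ _ ] = λ e → refl
series-cong eq -[1+ _ ] _        = λ e → refl

theorem3p13 : (ℓ₁ ℓ₂ : ℕ≥1∪∞) (d₁ d₂ : ℤ) →
    (∀ (p q : ℕ) → c ℓ₁ ℓ₂ d₁ d₂ p q ≈ gradingSum ℓ₁ ℓ₂ (𝒫 [ d₁ ]₊ [ d₂ ]₊) p q)
    × (x[ d₁ , d₂ ] ℓ₁ ℓ₂ ≈ᴸ x₁^ (- d₁) x₂^ (- d₂) · gradingSeries ℓ₁ ℓ₂ (𝒫 [ d₁ ]₊ [ d₂ ]₊))
theorem3p13 ℓ₁ ℓ₂ d₁ d₂ = c≈ , λ i j → series-cong c≈ (i ℤ.- - d₁) (j ℤ.- - d₂)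
  where
  c≈ : ∀ p q → c ℓ₁ ℓ₂ d₁ d₂ p q ≈ gradingSum ℓ₁ ℓ₂ (𝒫 [ d₁ ]₊ [ d₂ ]₊) p q
  c≈ p q = coeffs (C≋X ℓ₁ ℓ₂ d₁ d₂ (p ℕ.+ q) p q ℕ.≤-refl)
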